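{- If $d\in\Delta^\times$ has level $n=p^r+m-1$ of type $0$ (so $m\ge1$ and $m\not\equiv0\bmod p$), then $d\equiv[u,1-\Pi^mx]\bmod\Pi^{n+1}\Delta$ for some $x\in\Delta$.
   Context: Let $p$ be an odd prime, $r\ge1$, $s\ge1$ integers, $F/\mathbb Q_p$ a finite unramified extension with ring of integers $\mathfrak O$. Fix primitive $p^m$-th roots of unity $\zeta_m$ with $\zeta_0=1$, $\zeta_m^p=\zeta_{m-1}$; put $\mathfrak O_m=\mathfrak O[\zeta_m]$, $\pi_m=1-\zeta_m$, $\Pi=\pi_{r+s}$, $\pi=\pi_r$, $A=\mathfrak O_r[[T]]$, $B=\mathfrak O_{r+s}[[T]]$, with fraction fields $\mathfrak q(A),\mathfrak q(B)$. Let $g$ be the generator of the cyclic group $\mathrm{Gal}(\mathfrak q(B)/\mathfrak q(A))$ (of order $p^s$) fixing $\mathfrak q(A)$ with $\zeta_{r+s}\mapsto\zeta_{r+s}^{1+p^r}$. $D=\bigoplus_{j=0}^{p^s-1}\mathfrak q(B)u^j$ with $ub={}^gb\,u$ and $u^{p^s}=1+T$ is a division algebra with centre $\mathfrak q(A)$, and $\Delta=\bigoplus_{j=0}^{p^s-1}Bu^j$ is an $A$-order in $D$ with $\Pi\Delta=\Delta\Pi$. The level of $d\in1+\Pi\Delta$ is $\max\{k\ge1:d\in1+\Pi^k\Delta\}$ (having level $n$ includes $d\in 1+\Pi\Delta$). The integer $n\ge1$ has type $t\ge0$ if $n=p^{r+t}+p^tm-1$ for some $m\ge1$ with $m\not\equiv0\bmod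 p$. $[x,y]=xyx^{ -1}y^{ -1}$; elements of $1+\Pi\Delta$ are units of $\Delta$. -}

module Defs where

open import Algebra.Apartness.Bundles using (HeytingField; HeytingCommutativeRing)
open import Algebra.Bundles using (RawRing; CommutativeRing)
import Algebra.Definitions as AlgDefs
import Algebra.Definitions.RawSemiring as RawSemiringDefs
open import Algebra.Morphism.Structures using (IsRingHomomorphism; IsRingMonomorphism)
open import Data.Fin.Base using (Fin; toℕ)
open import Data.Integer.Base as ℤ using (ℤ; +_)
open import Data.Integer.Divisibility.Signed using (_∣_; ∣m∣n⇒∣m+n; ∣m⇒∣-m; ∣n⇒∣m*n; divides)
import Data.Integer.Tactic.RingSolver as ℤSolver
open import Data.List.Base using (List; []; _∷_; map)
open import Data.Nat.Base as ℕ using (ℕ; zero; suc; NonZero; _∸_; _^_; _≤_; _/_; _%_)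
import Data.Nat.Divisibility as ℕDiv
open import Data.Nat.GeneralisedArithmetic using (fold)
open import Data.Nat.Primality using (Prime; prime⇒nonZero)
open import Data.Nat.Properties using (m^n≢0; _≟_)
open import Data.Product.Base using (_×_; _,_; ∃; ∃-syntax)
open import Data.Sum.Base using (_⊎_)
open import Function.Bundles using (_⇔_)
open import Level using (Level; _⊔_; 0ℓ) renaming (suc to lsuc)
open import Relation.Binary.PropositionalEquality using (_≡_; subst)
open import Relation.Nullary.Negation.Core using (¬_)
open import Relation.Nullary.Decidable.Core using (yes; no)

private variable
  c ℓ : Level

------------------------------------------------------------------------
-- The raw rings below fix carriers, equalities and operations only; all
-- quotients are expressed through the setoid equality.

module Polynomial (R : RawRing c ℓ) where
  private module R = RawRing R

  -- Coefficient lists, constant term first; trailing zeros are allowed.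
  Poly : Set c
  Poly = List R.Carrier

  coeff : Poly → ℕ → R.Carrier
  coeff []      _       = R.0#
  coeff (a ∷ _) zero    = a
  coeff (_ ∷ f) (suc i) = coeff f i

  const : R.Carrier → Poly
  const a = a ∷ []

  X : Poly
  X = R.0# ∷ R.1# ∷ []

  infixl 6 _+ₚ_
  infixl 7 _*ₚ_

  _+ₚ_ : Poly → Poly → Poly
  []      +ₚ g       = g
  (a ∷ f) +ₚ []      = a ∷ f
  (a ∷ f) +ₚ (b ∷ g) = a R.+ b ∷ f +ₚ g

  -ₚ_ : Poly → Poly
  -ₚ_ = map R.-_

  _*ₚ_ : Poly → Poly → Poly
  []      *ₚ g = []
  (a ∷ f) *ₚ g = map (a R.*_) g +ₚ (R.0# ∷ f *ₚ g)

  _≈ₚ_ : Poly → Poly → Set ℓ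
  f ≈ₚ g = ∀ i → coeff f i R.≈ coeff g i

  polynomialRing : RawRing c ℓ
  polynomialRing = record
    { Carrier = Poly ; _≈_ = _≈ₚ_ ; _+_ = _+ₚ_ ; _*_ = _*ₚ_ ; -_ = -ₚ_
    ; 0# = [] ; 1# = const R.1# }

  -- R[X] / (f)
  quotientRing : Poly → RawRing c (c ⊔ ℓ)
  quotientRing f = record
    { Carrier = Poly
    ; _≈_ = λ g h → ∃[ q ] (g +ₚ (-ₚ h)) ≈ₚ (q *ₚ f)
    ; _+_ = _+ₚ_ ; _*_ = _*ₚ_ ; -_ = -ₚ_
    ; 0# = [] ; 1# = const R.1# }

  -- the composite f(h)
  _⟪_⟫ : Poly → Poly → Poly
  []      ⟪ h ⟫ = []
  (a ∷ f) ⟪ h ⟫ = const a +ₚ h *ₚ (f ⟪ h ⟫)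

module PowerSeries (R : RawRing c ℓ) where
  private module R = RawRing R
  open RawSemiringDefs R.rawSemiring using (sum)

  Series : Set c
  Series = ℕ → R.Carrier

  const : R.Carrier → Series
  const a zero    = a
  const a (suc _) = R.0#

  T : Series
  T 1 = R.1#
  T _ = R.0#

  powerSeriesRing : RawRing c ℓ
  powerSeriesRing = record
    { Carrier = Series
    ; _≈_ = λ f g → ∀ n → f n R.≈ g n
    ; _+_ = λ f g n → f n R.+ g n
    ; _*_ = λ f g n → sum {suc n} λ i → f (toℕ i) R.* g (n ∸ toℕ i)
    ; -_  = λ f n → R.- f n
    ; 0#  = λ _ → R.0#
    ; 1#  = const R.1# }

-- ⊕_{j<N} R u^j with u b = σ(b) u and u^N = γ, where σ(γ) = γ and σ^N = id.
module CyclicAlgebra (R : RawRing c ℓ)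
  (σ : RawRing.Carrier R → RawRing.Carrier R) (γ : RawRing.Carrier R)
  (N : ℕ) .{{_ : NonZero N}} where
  private module R = RawRing R
  open RawSemiringDefs R.rawSemiring using (sum) renaming (_^_ to _^R_)

  Elt : Set c
  Elt = Fin N → R.Carrier

  -- b u^n = (b γ^⌊n/N⌋) u^(n mod N), as an element of the direct sum
  monomial : R.Carrier → ℕ → Elt
  monomial b n k with n % N ≟ toℕ k
  ... | yes _ = b R.* (γ ^R (n / N))
  ... | no  _ = R.0#

  const : R.Carrier → Elt
  const b = monomial b 0

  u : Elt
  u = monomial R.1# 1

  cyclicAlgebra : RawRing c ℓ
  cyclicAlgebra = record
    { Carrier = Elt
    ; _≈_ = λ x y → ∀ k → x k R.≈ y k
    ; _+_ = λ x y k → x k R.+ y k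
      -- (a u^i)(b u^j) = a σ^i(b) u^(i+j)
    ; _*_ = λ x y k → sum λ i → sum λ j →
              monomial (x i R.* fold (y j) σ (toℕ i)) (toℕ i ℕ.+ toℕ j) k
    ; -_  = λ x k → R.- x k
    ; 0#  = λ _ → R.0#
    ; 1#  = const R.1# }

------------------------------------------------------------------------

-- An element of lim ℤ/pⁿ, given by integer representatives at each level.
record PadicInt (p : ℕ) : Set where
  constructor mkPadic
  field
    rep      : ℕ → ℤ
    coherent : ∀ n → + (p ^ n) ∣ rep (suc n) ℤ.- rep n

open PadicInt

padicIntegers : ℕ → RawRing 0ℓ 0ℓ
padicIntegers p = record
  { Carrier = PadicInt p
  ; _≈_ = λ x y → ∀ n → + (p ^ n) ∣ rep x n ℤ.- rep y n
  ; _+_ = λ x y → mkPadic (λ n → rep x n ℤ.+ rep y n) λ n →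
      subst (+ (p ^ n) ∣_) (sum-diff (rep x (suc n)) (rep x n) (rep y (suc n)) (rep y n))
        (∣m∣n⇒∣m+n (coherent x n) (coherent y n))
  ; _*_ = λ x y → mkPadic (λ n → rep x n ℤ.* rep y n) λ n →
      subst (+ (p ^ n) ∣_) (prod-diff (rep x (suc n)) (rep x n) (rep y (suc n)) (rep y n))
        (∣m∣n⇒∣m+n (∣n⇒∣m*n (rep x (suc n)) (coherent y n))
                   (∣n⇒∣m*n (rep y n) (coherent x n)))
  ; -_ = λ x → mkPadic (λ n → ℤ.- rep x n) λ n →
      subst (+ (p ^ n) ∣_) (neg-diff (rep x (suc n)) (rep x n)) (∣m⇒∣-m (coherent x n))
  ; 0# = fromℤ (+ 0)
  ; 1# = fromℤ (+ 1) }
  where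
  sum-diff : ∀ a b c d → (a ℤ.- b) ℤ.+ (c ℤ.- d) ≡ (a ℤ.+ c) ℤ.- (b ℤ.+ d)
  sum-diff = ℤSolver.solve-∀
  prod-diff : ∀ a b c d → a ℤ.* (c ℤ.- d) ℤ.+ d ℤ.* (a ℤ.- b) ≡ a ℤ.* c ℤ.- b ℤ.* d
  prod-diff = ℤSolver.solve-∀
  neg-diff : ∀ a b → ℤ.- (a ℤ.- b) ≡ ℤ.- a ℤ.- ℤ.- b
  neg-diff = ℤSolver.solve-∀
  self-diff : ∀ a m → a ℤ.- a ≡ + 0 ℤ.* m
  self-diff = ℤSolver.solve-∀
  fromℤ : ℤ → PadicInt p
  fromℤ a = mkPadic (λ _ → a) λ n → divides (+ 0) (self-diff a (+ (p ^ n)))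

-- ℚ_p = ℤ_p[1/p]; the pair (a , k) stands for a / p^k.
padicNumbers : ℕ → RawRing 0ℓ 0ℓ
padicNumbers p = record
  { Carrier = Z.Carrier × ℕ
  ; _≈_ = λ (a , k) (b , l) → (p^ l) Z.* a Z.≈ (p^ k) Z.* b
  ; _+_ = λ (a , k) (b , l) → (p^ l) Z.* a Z.+ (p^ k) Z.* b , k ℕ.+ l
  ; _*_ = λ (a , k) (b , l) → a Z.* b , k ℕ.+ l
  ; -_  = λ (a , k) → Z.- a , k
  ; 0#  = Z.0# , 0
  ; 1#  = Z.1# , 0 }
  where
  module Z = RawRing (padicIntegers p)
  open RawSemiringDefs Z.rawSemiring renaming (_×_ to _·_) using ()
  p^_ : ℕ → Z.Carrier
  p^ k = (p ^ k) · Z.1#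

------------------------------------------------------------------------

heytingRawRing : ∀ {ℓ′} → HeytingField c ℓ ℓ′ → RawRing c ℓ
heytingRawRing F = CommutativeRing.rawRing
  (HeytingCommutativeRing.commutativeRing (HeytingField.heytingCommutativeRing F))

record FiniteUnramifiedExtension (p : ℕ) (c ℓ ℓ′ c₀ ℓ₀ : Level)
       : Set (lsuc (c ⊔ ℓ ⊔ ℓ′ ⊔ c₀ ⊔ ℓ₀)) where
  field
    field′ : HeytingField c ℓ ℓ′
    𝔒      : CommutativeRing c₀ ℓ₀

  rawF : RawRing c ℓ
  rawF = heytingRawRing field′

  module F  = RawRing rawF
  module 𝔒  = CommutativeRing 𝔒
  module ℤₚ = RawRing (padicIntegers p)
  module ℚₚ = RawRing (padicNumbers p)
  open RawSemiringDefs F.rawSemiring using (sum) renaming (_^_ to _^F_)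
  open RawSemiringDefs (RawRing.rawSemiring 𝔒.rawRing) using () renaming (_×_ to _·_)

  field
    ι       : ℚₚ.Carrier → F.Carrier
    ι-isHom : IsRingHomomorphism (padicNumbers p) rawF ι

  ι₀ : ℤₚ.Carrier → F.Carrier
  ι₀ a = ι (a , 0)

  -- x is a root of a monic polynomial over ℤ_p
  IsIntegral : F.Carrier → Set ℓ
  IsIntegral x = ∃ λ (k : ℕ) → ∃ λ (a : Fin k → ℤₚ.Carrier) →
    ((x ^F k) F.+ sum λ i → ι₀ (a i) F.* (x ^F toℕ i)) F.≈ F.0#

  -- 𝔒 is the integral closure of ℤ_p in F
  field
    incl             : 𝔒.Carrier → F.Carrier
    incl-isMono      : IsRingMonomorphism 𝔒.rawRing rawF incl
    integral-closure : ∀ x → IsIntegral x ⇔ (∃[ y ] incl y F.≈ x)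

  -- F/ℚ_p is finite.  Constructively this is given by an integral basis:
  -- a ℚ_p-basis of F that also spans 𝔒 over ℤ_p.
  field
    degree  : ℕ
    basis   : Fin degree → 𝔒.Carrier
    indep   : ∀ (a : Fin degree → ℚₚ.Carrier) →
              sum (λ i → ι (a i) F.* incl (basis i)) F.≈ F.0# → ∀ i → a i ℚₚ.≈ ℚₚ.0#
    span-F  : ∀ x → ∃ λ (a : Fin degree → ℚₚ.Carrier) →
              x F.≈ sum (λ i → ι (a i) F.* incl (basis i))
    span-𝔒  : ∀ y → ∃ λ (a : Fin degree → ℤₚ.Carrier) →
              incl y F.≈ sum (λ i → ι₀ (a i) F.* incl (basis i))

  -- F/ℚ_p is unramified: p generates the maximal ideal of 𝔒, i.e. every
  -- element is a unit or a multiple of p.  (p itself is not a unit, since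
  -- 1/p is not integral over ℤ_p.)
  field
    unramified : ∀ y → AlgDefs.Invertible 𝔒._≈_ 𝔒.1# 𝔒._*_ y
                     ⊎ (∃[ z ] y 𝔒.≈ (p · 𝔒.1#) 𝔒.* z)

------------------------------------------------------------------------

module Order {p : ℕ} (p-prime : Prime p) (O : CommutativeRing c ℓ) (r s : ℕ) where

  private
    module O = CommutativeRing O
    instance
      p≢0 : NonZero p
      p≢0 = prime⇒nonZero p-prime
      p^s≢0 : NonZero (p ^ s)
      p^s≢0 = m^n≢0 p s

  module O[X] = Polynomial O.rawRing
  open RawSemiringDefs (RawRing.rawSemiring O[X].polynomialRing) using ()
    renaming (_^_ to _^ₚ_; sum to sumₚ)

  -- Φ_{p^m}, the p^m-th cyclotomic polynomial: X - 1 for m = 0, and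
  -- 1 + X^{p^(m-1)} + … + X^{(p-1) p^(m-1)} for m ≥ 1.
  Φ : ℕ → O[X].Poly
  Φ zero    = O[X].X O[X].+ₚ (O[X].-ₚ O[X].const O.1#)
  Φ (suc m) = sumₚ {p} λ i → O[X].X ^ₚ (toℕ i ℕ.* p ^ m)

  -- 𝔒_m = 𝔒[ζ_m].  As F/ℚ_p is unramified, Φ_{p^m} is the minimal
  -- polynomial of ζ_m over F, so 𝔒[ζ_m] = 𝔒[X]/(Φ_{p^m}) with ζ_m the
  -- class of X.
  𝔒[ζ_] : ℕ → RawRing c (c ⊔ ℓ)
  𝔒[ζ m ] = O[X].quotientRing (Φ m)

  module B₀ = RawRing 𝔒[ζ r ℕ.+ s ]
  module B₀[[T]] = PowerSeries 𝔒[ζ r ℕ.+ s ]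

  B : RawRing c (c ⊔ ℓ)
  B = B₀[[T]].powerSeriesRing

  module B = RawRing B

  ζ : B₀.Carrier
  ζ = O[X].X

  -- ζ ↦ ζ^(1 + p^r) on 𝔒[ζ], extended coefficientwise to B; this is the
  -- restriction to B of the automorphism of its field of fractions.
  g₀ : B₀.Carrier → B₀.Carrier
  g₀ f = f O[X].⟪ O[X].X ^ₚ (1 ℕ.+ p ^ r) ⟫

  g : B.Carrier → B.Carrier
  g b k = g₀ (b k)

  module Cyclic = CyclicAlgebra B g (B.1# B.+ B₀[[T]].T) (p ^ s) {{p^s≢0}}

  Δ : RawRing c (c ⊔ ℓ)
  Δ = Cyclic.cyclicAlgebra

  open RawRing Δ public
  open AlgDefs _≈_ using (Invertible) public
  open RawSemiringDefs (RawRing.rawSemiring Δ) using () renaming (_^_ to _^Δ_) public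
  open Cyclic using (u) public

  infixl 6 _-_
  _-_ : Carrier → Carrier → Carrier
  x - y = x + (- y)

  IsUnit : Carrier → Set (c ⊔ ℓ)
  IsUnit = Invertible 1# _*_

  Π : Carrier
  Π = Cyclic.const (B₀[[T]].const (B₀.1# B₀.+ (B₀.- ζ)))

  infix 4 _≡_[modΠ^_]
  _≡_[modΠ^_] : Carrier → Carrier → ℕ → Set (c ⊔ ℓ)
  x ≡ y [modΠ^ k ] = ∃[ z ] (x - y) ≈ (Π ^Δ k) * z

  HasLevel : Carrier → ℕ → Set (c ⊔ ℓ)
  HasLevel d n = 1 ≤ n × d ≡ 1# [modΠ^ n ]
               × (∀ k → 1 ≤ k → d ≡ 1# [modΠ^ k ] → k ≤ n)

  HasType : ℕ → ℕ → Set
  HasType n t = ∃[ m ] 1 ≤ m × ¬ (p ℕDiv.∣ m) × n ≡ p ^ (r ℕ.+ t) ℕ.+ p ^ t ℕ.* m ∸ 1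

  -- [x , y] = x y x⁻¹ y⁻¹
  commutator : ∀ {x y} → IsUnit x → IsUnit y → Carrier
  commutator {x} {y} (x⁻¹ , _) (y⁻¹ , _) = x * y * x⁻¹ * y⁻¹

{-# OPTIONS --safe #-}

-- Write q = p^r and ᵘx = u x u⁻¹.  On Δ this conjugation acts coefficientwise by
-- g, hence ᵘx ≡ x mod Π^q for every x, while ᵘΠ = 1 - ζ^(1+q) ≡ Π + Π^q mod
-- Π^(q+1) because Π^(q+1) divides p and 1 - ζ^q ≡ Π^q mod p.  For y = 1 - Π^m x
-- this gives ᵘy - y ≡ -m Π^(q+m-1) x mod Π^(q+m), so if d = 1 + Π^n z then
-- d ≡ ᵘy y⁻¹ as soon as -m x ≡ z mod Π, which is solvable since p ∤ m.
--
-- That y is a unit needs no completeness.  As d has a level, Π is not a unit, so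
-- neither is p, and 1 - p a is invertible for all a in 𝔒.  By Nakayama's lemma
-- the same holds in 𝔒[ζ], then in B = 𝔒[ζ][[T]] and in Δ; and a power of Π x
-- lies in p Δ.
module Submission where

open import Algebra.Bundles
open import Algebra.Structures
open import Algebra.Morphism.Structures
import Algebra.Definitions as AlgDefs
import Algebra.Definitions.RawSemiring as RawSemiringDefs
import Algebra.Morphism.Construct.Composition as Composition
import Algebra.Morphism.RingMonomorphism as RingMonomorphism
import Algebra.Properties.AbelianGroup as AbelianGroupProps
import Algebra.Properties.CommutativeSemigroup as CommutativeSemigroupProps
import Algebra.Properties.CommutativeSemiring.Binomial as Binomial
import Algebra.Properties.CommutativeSemiring.Exp as CommutativeSemiringExp
import Algebra.Properties.Ring as RingProps
import Algebra.Properties.Semiring.Exp as SemiringExp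
import Algebra.Properties.Semiring.Mult as SemiringMult
import Algebra.Properties.Semiring.Sum as SemiringSum
open import Data.Fin.Base using (Fin; zero; suc; toℕ; fromℕ; fromℕ<; inject₁)
open import Data.Fin.Properties using (toℕ-injective; toℕ-fromℕ; toℕ-fromℕ<; toℕ-inject₁; toℕ<n)
open import Data.Fin.Relation.Unary.Top using (view; ‵fromℕ; ‵inject₁)
open import Data.List.Base using ([]; _∷_; map)
open import Data.Nat.Base as ℕ using (ℕ; zero; suc; NonZero; _≤_; _<_; _∸_; _/_; _%_)
open import Data.Nat.Combinatorics using (_C_; nCn≡1; nC1≡n; nCk+nC[k+1]≡[n+1]C[k+1])
open import Data.Nat.Coprimality using (Coprime; coprime-Bézout)
open import Data.Nat.Divisibility using (_∣_; divides; ∣⇒≤; m∣m*n; n∣m*n)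
open import Data.Nat.DivMod
open import Data.Nat.GCD using (module Bézout)
open import Data.Nat.GeneralisedArithmetic using (fold)
open import Data.Nat.Primality
  using (Prime; euclidsLemma; prime⇒nonZero; prime⇒nonTrivial; prime⇒irreducible)
import Data.Nat.Properties as ℕ
import Data.Nat.Tactic.RingSolver as ℕSolver
open import Data.Product.Base using (Σ; ∃; ∃-syntax; _×_; _,_; proj₁; proj₂)
open import Data.Sum.Base using (_⊎_; inj₁; inj₂)
open import Function.Base using (_∘_; id)
open import Level using (Level; _⊔_)
import Relation.Binary.Reasoning.Setoid as SetoidReasoning
open import Relation.Binary.PropositionalEquality as ≡ using (_≡_; _≢_)
open import Relation.Nullary.Decidable.Core using (yes; no)
open import Relation.Nullary.Negation.Core using (¬_; contradiction)
open import Defs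

private variable
  c ℓ c′ ℓ′ ι : Level

module RingHom (R : Ring c ℓ) (S : Ring c′ ℓ′)
  (f : Ring.Carrier R → Ring.Carrier S) where
  private
    module R = Ring R
    module S = Ring S
    module Rd = RawSemiringDefs (Semiring.rawSemiring R.semiring)
    module Sd = RawSemiringDefs (Semiring.rawSemiring S.semiring)
  open RingProps S

  isRingHomomorphism :
    (∀ {x y} → x R.≈ y → f x S.≈ f y) →
    (∀ x y → f (x R.+ y) S.≈ f x S.+ f y) →
    (∀ x y → f (x R.* y) S.≈ f x S.* f y) →
    f R.1# S.≈ S.1# → IsRingHomomorphism R.rawRing S.rawRing f
  isRingHomomorphism f-cong f-+ f-* f-1 = record
    { isSemiringHomomorphism = record
      { isNearSemiringHomomorphism = record
        { +-isMonoidHomomorphism = record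
          { isMagmaHomomorphism = record
            { isRelHomomorphism = record { cong = f-cong } ; homo = f-+ }
          ; ε-homo = f-0 }
        ; *-homo = f-* }
      ; 1#-homo = f-1 }
    ; -‿homo = λ x → +-inverseˡ-unique (f (R.- x)) (f x)
        (S.trans (S.sym (f-+ (R.- x) x)) (S.trans (f-cong (R.-‿inverseˡ x)) f-0)) }
    where
    f-0 : f R.0# S.≈ S.0#
    f-0 = x+x≈x⇒x≈0 (f R.0#) (S.trans (S.sym (f-+ R.0# R.0#)) (f-cong (R.+-identityˡ R.0#)))

  module Properties (isHom : IsRingHomomorphism R.rawRing S.rawRing f) where
    open IsRingHomomorphism isHom public using (+-homo; *-homo; 0#-homo; 1#-homo; -‿homo)
      renaming (⟦⟧-cong to f-cong)

    minus-homo : ∀ x y → f (x R.- y) S.≈ f x S.- f y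
    minus-homo x y = S.trans (+-homo x (R.- y)) (S.+-congˡ (-‿homo y))

    ^-homo : ∀ x n → f (x Rd.^ n) S.≈ f x Sd.^ n
    ^-homo x zero    = 1#-homo
    ^-homo x (suc n) = S.trans (*-homo x _) (S.*-congˡ (^-homo x n))

    ×1-homo : ∀ n → f (n Rd.× R.1#) S.≈ n Sd.× S.1#
    ×1-homo zero    = 0#-homo
    ×1-homo (suc n) = S.trans (+-homo _ _) (S.+-cong 1#-homo (×1-homo n))

    sum-homo : ∀ {n} (t : Fin n → R.Carrier) → f (Rd.sum t) S.≈ Sd.sum (f ∘ t)
    sum-homo {zero}  t = 0#-homo
    sum-homo {suc n} t = S.trans (+-homo _ _) (S.+-congˡ (sum-homo (t ∘ suc)))

isRingHomomorphism-resp : (R : Ring c ℓ) (S : Ring c′ ℓ′) → let module S = Ring S in ∀ {f f′} →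
  (∀ x → f′ x S.≈ f x) → IsRingHomomorphism (Ring.rawRing R) S.rawRing f →
  IsRingHomomorphism (Ring.rawRing R) S.rawRing f′
isRingHomomorphism-resp R S {f} {f′} f′≈f isHom = RingHom.isRingHomomorphism R S f′
  (λ {x} {y} eq → S.trans (f′≈f x) (S.trans (F.f-cong eq) (S.sym (f′≈f y))))
  (λ x y → S.trans (f′≈f _) (S.trans (F.+-homo x y) (S.sym (S.+-cong (f′≈f x) (f′≈f y)))))
  (λ x y → S.trans (f′≈f _) (S.trans (F.*-homo x y) (S.sym (S.*-cong (f′≈f x) (f′≈f y)))))
  (S.trans (f′≈f _) F.1#-homo)
  where
  module S = Ring S
  module F = RingHom.Properties R S f isHom

module Invertibility (D : Ring c ℓ) where
  open Ring D hiding (zero)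
  open RingProps D
  open SetoidReasoning setoid
  open SemiringExp semiring using (_^_)
  open AlgDefs _≈_ using (Invertible)

  IsUnit : Carrier → Set (c ⊔ ℓ)
  IsUnit = Invertible 1# _*_

  inverses⇒unit : ∀ {x y z} → y * x ≈ 1# → x * z ≈ 1# → IsUnit x
  inverses⇒unit {x} {y} {z} yx xz = y , yx , (begin
    x * y            ≈⟨ *-congˡ y≈z ⟩
    x * z            ≈⟨ xz ⟩
    1#               ∎)
    where
    y≈z : y ≈ z
    y≈z = begin
      y              ≈⟨ *-identityʳ y ⟨
      y * 1#         ≈⟨ *-congˡ xz ⟨
      y * (x * z)    ≈⟨ *-assoc y x z ⟨
      y * x * z      ≈⟨ *-congʳ yx ⟩
      1# * z         ≈⟨ *-identityˡ z ⟩
      z              ∎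

  unit-resp : ∀ {x y} → x ≈ y → IsUnit x → IsUnit y
  unit-resp eq (z , zx , xz) = z , trans (*-congˡ (sym eq)) zx , trans (*-congʳ (sym eq)) xz

  x[1-y]≈x-xy : ∀ x y → x * (1# - y) ≈ x - x * y
  x[1-y]≈x-xy x y = trans (x[y-z]≈xy-xz x 1# y) (+-congʳ (*-identityʳ x))

  [1-y]x≈x-yx : ∀ x y → (1# - y) * x ≈ x - y * x
  [1-y]x≈x-yx x y = trans ([y-z]x≈yx-zx x 1# y) (+-congʳ (*-identityˡ x))

  [x-y]+[y-z]≈x-z : ∀ x y z → (x - y) + (y - z) ≈ x - z
  [x-y]+[y-z]≈x-z x y z = trans (+-assoc x (- y) (y - z)) (+-congˡ (\\-leftDividesʳ y (- z)))

  module _ (w : Carrier) where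

    geometric : ℕ → Carrier
    geometric zero    = 0#
    geometric (suc k) = 1# + w * geometric k

    1-w+w[1-w^k] : ∀ k → (1# - w) + w * (1# - w ^ k) ≈ 1# - w ^ suc k
    1-w+w[1-w^k] k = trans (+-congˡ (x[1-y]≈x-xy w (w ^ k))) ([x-y]+[y-z]≈x-z 1# w (w * w ^ k))

    geometric-* : ∀ k → geometric k * (1# - w) ≈ 1# - w ^ k
    geometric-* zero    = trans (zeroˡ _) (sym (-‿inverseʳ 1#))
    geometric-* (suc k) = begin
      (1# + w * geometric k) * (1# - w)             ≈⟨ distribʳ _ _ _ ⟩
      1# * (1# - w) + w * geometric k * (1# - w)    ≈⟨ +-cong (*-identityˡ _) (*-assoc _ _ _) ⟩
      (1# - w) + w * (geometric k * (1# - w))       ≈⟨ +-congˡ (*-congˡ (geometric-* k)) ⟩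
      (1# - w) + w * (1# - w ^ k)                   ≈⟨ 1-w+w[1-w^k] k ⟩
      1# - w ^ suc k                                ∎

    *-geometric : ∀ k → (1# - w) * geometric k ≈ 1# - w ^ k
    *-geometric zero    = trans (zeroʳ _) (sym (-‿inverseʳ 1#))
    *-geometric (suc k) = begin
      (1# - w) * (1# + w * geometric k)             ≈⟨ distribˡ _ _ _ ⟩
      (1# - w) * 1# + (1# - w) * (w * geometric k)  ≈⟨ +-cong (*-identityʳ _) (sym (*-assoc _ _ _)) ⟩
      (1# - w) + (1# - w) * w * geometric k         ≈⟨ +-congˡ (*-congʳ (trans ([1-y]x≈x-yx w w) (sym (x[1-y]≈x-xy w w)))) ⟩
      (1# - w) + w * (1# - w) * geometric k         ≈⟨ +-congˡ (trans (*-assoc _ _ _) (*-congˡ (*-geometric k))) ⟩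
      (1# - w) + w * (1# - w ^ k)                   ≈⟨ 1-w+w[1-w^k] k ⟩
      1# - w ^ suc k                                ∎

    1-w^k-unit⇒1-w-unit : ∀ k → IsUnit (1# - w ^ k) → IsUnit (1# - w)
    1-w^k-unit⇒1-w-unit k (z , zx , xz) = inverses⇒unit {y = z * geometric k} {z = geometric k * z}
      (trans (*-assoc _ _ _) (trans (*-congˡ (geometric-* k)) zx))
      (trans (sym (*-assoc _ _ _)) (trans (*-congʳ (*-geometric k)) xz))

record IsIdeal (R : Ring c ℓ) (I : Ring.Carrier R → Set ι) : Set (c ⊔ ℓ ⊔ ι) where
  open Ring R
  field
    resp      : ∀ {x y} → x ≈ y → I x → I y
    0∈        : I 0#
    +-closed  : ∀ {x y} → I x → I y → I (x + y)
    *ˡ-closed : ∀ a {x} → I x → I (a * x)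
    *ʳ-closed : ∀ a {x} → I x → I (x * a)

module Quotient (R : Ring c ℓ) {I : Ring.Carrier R → Set ι} (isIdeal : IsIdeal R I) where
  open Ring R
  open IsIdeal isIdeal
  open RingProps R
  open Invertibility R using ([x-y]+[y-z]≈x-z)

  infix 4 _≋_
  _≋_ : Carrier → Carrier → Set ι
  x ≋ y = I (x - y)

  ≈⇒≋ : ∀ {x y} → x ≈ y → x ≋ y
  ≈⇒≋ eq = resp (sym (x≈y⇒x∙y⁻¹≈ε eq)) 0∈

  I⇒≋0 : ∀ {x} → I x → x ≋ 0#
  I⇒≋0 = resp (sym (trans (+-congˡ -0#≈0#) (+-identityʳ _)))

  ≋0⇒I : ∀ {x} → x ≋ 0# → I x
  ≋0⇒I = resp (trans (+-congˡ -0#≈0#) (+-identityʳ _))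

  neg-closed : ∀ {x} → I x → I (- x)
  neg-closed Ix = resp (-1*x≈-x _) (*ˡ-closed (- 1#) Ix)

  ≋-sym : ∀ {x y} → x ≋ y → y ≋ x
  ≋-sym {x} {y} p = resp (AbelianGroupProps.⁻¹-anti-homo‿- +-abelianGroup x y) (neg-closed p)

  ≋-trans : ∀ {x y z} → x ≋ y → y ≋ z → x ≋ z
  ≋-trans {x} {y} {z} p q = resp ([x-y]+[y-z]≈x-z x y z) (+-closed p q)

  +-cong′ : ∀ {x y u v} → x ≋ y → u ≋ v → x + u ≋ y + v
  +-cong′ {x} {y} {u} {v} p q =
    resp (trans (interchange x (- y) u (- v)) (+-congˡ (-‿+-comm y v))) (+-closed p q)
    where open CommutativeSemigroupProps +-commutativeSemigroup using (interchange)

  neg-cong′ : ∀ {x y} → x ≋ y → - x ≋ - y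
  neg-cong′ {x} {y} p = resp (sym (-‿+-comm x (- y))) (neg-closed p)

  *-cong′ : ∀ {x y u v} → x ≋ y → u ≋ v → x * u ≋ y * v
  *-cong′ {x} {y} {u} {v} p q =
    ≋-trans (resp ([y-z]x≈yx-zx u x y) (*ʳ-closed u p))
            (resp (x[y-z]≈xy-xz y u v) (*ˡ-closed y q))

  isRing′ : IsRing _≋_ _+_ _*_ -_ 0# 1#
  isRing′ = record
    { +-isAbelianGroup = record
      { isGroup = record
        { isMonoid = record
          { isSemigroup = record
            { isMagma = record
              { isEquivalence = record
                { refl = ≈⇒≋ refl ; sym = ≋-sym ; trans = ≋-trans }
              ; ∙-cong = +-cong′ }
            ; assoc = λ x y z → ≈⇒≋ (+-assoc x y z) }
          ; identity = (λ x → ≈⇒≋ (+-identityˡ x)) , λ x → ≈⇒≋ (+-identityʳ x) }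
        ; inverse = (λ x → ≈⇒≋ (-‿inverseˡ x)) , λ x → ≈⇒≋ (-‿inverseʳ x)
        ; ⁻¹-cong = neg-cong′ }
      ; comm = λ x y → ≈⇒≋ (+-comm x y) }
    ; *-cong = *-cong′
    ; *-assoc = λ x y z → ≈⇒≋ (*-assoc x y z)
    ; *-identity = (λ x → ≈⇒≋ (*-identityˡ x)) , λ x → ≈⇒≋ (*-identityʳ x)
    ; distrib = (λ x y z → ≈⇒≋ (distribˡ x y z)) , λ x y z → ≈⇒≋ (distribʳ x y z) }

  quotientRing : Ring c ι
  quotientRing = record { isRing = isRing′ }

  π-isHom : IsRingHomomorphism rawRing (Ring.rawRing quotientRing) id
  π-isHom = RingHom.isRingHomomorphism R quotientRing id ≈⇒≋
    (λ _ _ → ≈⇒≋ refl) (λ _ _ → ≈⇒≋ refl) (≈⇒≋ refl)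

  -- Powers, multiples and sums in the quotient do not reduce to those of R.
  module π = RingHom.Properties R quotientRing id π-isHom

module PrincipalIdeal (R : CommutativeRing c ℓ) (f : CommutativeRing.Carrier R) where
  open CommutativeRing R
  open SetoidReasoning setoid

  ⟨f⟩ : Carrier → Set (c ⊔ ℓ)
  ⟨f⟩ x = ∃[ q ] x ≈ q * f

  isIdeal : IsIdeal ring ⟨f⟩
  isIdeal = record
    { resp      = λ eq (q , p) → q , trans (sym eq) p
    ; 0∈        = 0# , sym (zeroˡ f)
    ; +-closed  = λ (q , p) (q′ , p′) → q + q′ , trans (+-cong p p′) (sym (distribʳ f q q′))
    ; *ˡ-closed = λ a (q , p) → a * q , trans (*-congˡ p) (sym (*-assoc a q f))
    ; *ʳ-closed = λ a (q , p) → q * a , (begin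
        _ * a        ≈⟨ *-congʳ p ⟩
        q * f * a    ≈⟨ *-assoc q f a ⟩
        q * (f * a)  ≈⟨ *-congˡ (*-comm f a) ⟩
        q * (a * f)  ≈⟨ *-assoc q a f ⟨
        q * a * f    ∎) }

  module Q = Quotient ring isIdeal

  quotientCommutativeRing : CommutativeRing c (c ⊔ ℓ)
  quotientCommutativeRing = record
    { isCommutativeRing = record
      { isRing = Q.isRing′ ; *-comm = λ x y → Q.≈⇒≋ (*-comm x y) } }

  f≋0 : f Q.≋ 0#
  f≋0 = Q.I⇒≋0 (1# , sym (*-identityˡ f))

  descend : (T : Ring c′ ℓ′) → let module T = Ring T in ∀ {ψ} →
    IsRingHomomorphism rawRing T.rawRing ψ → ψ f T.≈ T.0# →
    IsRingHomomorphism (CommutativeRing.rawRing quotientCommutativeRing) T.rawRing ψ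
  descend T {ψ} isHom ψf≈0 = RingHom.isRingHomomorphism Q.quotientRing T ψ
    (λ {x} {y} (q , eq) → x∙y⁻¹≈ε⇒x≈y (ψ x) (ψ y) (T.trans (T.sym (F.minus-homo x y))
      (T.trans (F.f-cong eq) (T.trans (F.*-homo q f) (T.trans (T.*-congˡ ψf≈0) (T.zeroʳ (ψ q)))))))
    F.+-homo F.*-homo F.1#-homo
    where
    module T = Ring T
    module F = RingHom.Properties ring T ψ isHom
    open RingProps T

module SeriesRing (R : CommutativeRing c ℓ) where
  open CommutativeRing R
  open SetoidReasoning setoid
  open CommutativeSemigroupProps +-commutativeSemigroup using (interchange; x∙yz≈y∙xz)
  module P = PowerSeries rawRing
  open P public using (Series)
  module S = RawRing P.powerSeriesRing
  open S public using () renaming (_+_ to _⊕_; _*_ to _⊛_; _≈_ to _≈ₛ_)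

  tail : Series → Series
  tail f = f ∘ suc

  infixr 7 _·_
  _·_ : Carrier → Series → Series
  (a · f) n = a * f n

  ⊛-cong : ∀ {f f′ g g′} → f ≈ₛ f′ → g ≈ₛ g′ → f ⊛ g ≈ₛ f′ ⊛ g′
  ⊛-cong p q zero    = +-congʳ (*-cong (p 0) (q 0))
  ⊛-cong p q (suc n) = +-cong (*-cong (p 0) (q (suc n))) (⊛-cong (p ∘ suc) q n)

  ⊛-distribʳ : ∀ h f g → (f ⊕ g) ⊛ h ≈ₛ (f ⊛ h) ⊕ (g ⊛ h)
  ⊛-distribʳ h f g zero    = trans (+-congʳ (distribʳ _ _ _))
    (trans (+-congˡ (sym (+-identityʳ 0#))) (interchange _ _ _ _))
  ⊛-distribʳ h f g (suc n) = trans (+-cong (distribʳ _ _ _) (⊛-distribʳ h (tail f) (tail g) n))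
    (interchange _ _ _ _)

  ·-⊛-assoc : ∀ a f g → (a · f) ⊛ g ≈ₛ a · (f ⊛ g)
  ·-⊛-assoc a f g zero    = begin
    a * f 0 * g 0 + 0#        ≈⟨ +-cong (*-assoc _ _ _) (sym (zeroʳ a)) ⟩
    a * (f 0 * g 0) + a * 0#  ≈⟨ distribˡ _ _ _ ⟨
    a * (f 0 * g 0 + 0#)      ∎
  ·-⊛-assoc a f g (suc n) = trans (+-cong (*-assoc _ _ _) (·-⊛-assoc a (tail f) g n))
    (sym (distribˡ _ _ _))

  ⊛-assoc : ∀ f g h → (f ⊛ g) ⊛ h ≈ₛ f ⊛ (g ⊛ h)
  ⊛-assoc f g h zero    = +-congʳ (begin
    (f 0 * g 0 + 0#) * h 0   ≈⟨ *-congʳ (+-identityʳ _) ⟩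
    f 0 * g 0 * h 0          ≈⟨ *-assoc _ _ _ ⟩
    f 0 * (g 0 * h 0)        ≈⟨ *-congˡ (+-identityʳ _) ⟨
    f 0 * (g 0 * h 0 + 0#)   ∎)
  ⊛-assoc f g h (suc n) = begin
    (f 0 * g 0 + 0#) * h (suc n) + (tail (f ⊛ g) ⊛ h) n
      ≈⟨ +-cong (trans (*-congʳ (+-identityʳ _)) (*-assoc _ _ _))
           (⊛-distribʳ h (f 0 · tail g) (tail f ⊛ g) n) ⟩
    f 0 * (g 0 * h (suc n)) + (((f 0 · tail g) ⊛ h) n + ((tail f ⊛ g) ⊛ h) n)
      ≈⟨ +-congˡ (+-cong (·-⊛-assoc (f 0) (tail g) h n) (⊛-assoc (tail f) g h n)) ⟩
    f 0 * (g 0 * h (suc n)) + (f 0 * (tail g ⊛ h) n + (tail f ⊛ (g ⊛ h)) n)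
      ≈⟨ +-assoc _ _ _ ⟨
    f 0 * (g 0 * h (suc n)) + f 0 * (tail g ⊛ h) n + (tail f ⊛ (g ⊛ h)) n
      ≈⟨ +-congʳ (distribˡ _ _ _) ⟨
    f 0 * (g 0 * h (suc n) + (tail g ⊛ h) n) + (tail f ⊛ (g ⊛ h)) n  ∎

  ⊛-sucʳ : ∀ f g n → (f ⊛ g) (suc n) ≈ f (suc n) * g 0 + (f ⊛ tail g) n
  ⊛-sucʳ f g zero    = trans (x∙yz≈y∙xz _ _ _) (+-congˡ refl)
  ⊛-sucʳ f g (suc n) = trans (+-congˡ (⊛-sucʳ (tail f) g n)) (x∙yz≈y∙xz _ _ _)

  ⊛-comm : ∀ f g → f ⊛ g ≈ₛ g ⊛ f
  ⊛-comm f g zero    = +-congʳ (*-comm _ _)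
  ⊛-comm f g (suc n) = trans (⊛-sucʳ f g n)
    (+-cong (*-comm _ _) (⊛-comm f (tail g) n))

  ⊛-zeroˡ : ∀ f g → (∀ n → f n ≈ 0#) → ∀ n → (f ⊛ g) n ≈ 0#
  ⊛-zeroˡ f g z zero    = trans (+-identityʳ _) (trans (*-congʳ (z 0)) (zeroˡ _))
  ⊛-zeroˡ f g z (suc n) = trans (+-cong (trans (*-congʳ (z 0)) (zeroˡ _))
    (⊛-zeroˡ (tail f) g (z ∘ suc) n)) (+-identityʳ _)

  const-⊛ : ∀ a f → P.const a ⊛ f ≈ₛ a · f
  const-⊛ a f zero    = +-identityʳ _
  const-⊛ a f (suc n) = trans (+-congˡ (⊛-zeroˡ _ f (λ _ → refl) n)) (+-identityʳ _)

  ⊛-identityˡ : ∀ f → S.1# ⊛ f ≈ₛ f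
  ⊛-identityˡ f n = trans (const-⊛ 1# f n) (*-identityˡ _)

  isCommutativeRing′ : IsCommutativeRing _≈ₛ_ _⊕_ _⊛_ S.-_ S.0# S.1#
  isCommutativeRing′ = record
    { isRing = record
      { +-isAbelianGroup = record
        { isGroup = record
          { isMonoid = record
            { isSemigroup = record
              { isMagma = record
                { isEquivalence = record
                  { refl = λ _ → refl ; sym = λ p n → sym (p n) ; trans = λ p q n → trans (p n) (q n) }
                ; ∙-cong = λ p q n → +-cong (p n) (q n) }
              ; assoc = λ f g h n → +-assoc _ _ _ }
            ; identity = (λ f n → +-identityˡ _) , λ f n → +-identityʳ _ }
          ; inverse = (λ f n → -‿inverseˡ _) , λ f n → -‿inverseʳ _
          ; ⁻¹-cong = λ p n → -‿cong (p n) }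
        ; comm = λ f g n → +-comm _ _ }
      ; *-cong = ⊛-cong
      ; *-assoc = ⊛-assoc
      ; *-identity = ⊛-identityˡ , λ f n → trans (⊛-comm f S.1# n) (⊛-identityˡ f n)
      ; distrib = (λ h f g n → trans (⊛-comm h (f ⊕ g) n) (trans (⊛-distribʳ h f g n)
                      (+-cong (⊛-comm f h n) (⊛-comm g h n)))) , ⊛-distribʳ }
    ; *-comm = ⊛-comm }

  seriesRing : CommutativeRing c ℓ
  seriesRing = record { isCommutativeRing = isCommutativeRing′ }

module SeriesDivision (R : CommutativeRing c ℓ) where
  open CommutativeRing R
  open SeriesRing R
  open RingProps ring
  open SetoidReasoning setoid

  -- The quotient h / f when a is the inverse of f 0.  Cancelling the constant
  -- term of the quotient leaves a division of h - (a * h 0) · f by f, shifted.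
  quot : Carrier → Series → Series → Series
  quot a f h zero    = a * h 0
  quot a f h (suc n) = quot a f (λ k → h (suc k) - f (suc k) * (a * h 0)) n

  quot-correct : ∀ {a f} → f 0 * a ≈ 1# → ∀ h → f ⊛ quot a f h ≈ₛ h
  quot-correct {a} {f} inv h zero = begin
    f 0 * (a * h 0) + 0#  ≈⟨ +-identityʳ _ ⟩
    f 0 * (a * h 0)       ≈⟨ *-assoc _ _ _ ⟨
    f 0 * a * h 0         ≈⟨ *-congʳ inv ⟩
    1# * h 0              ≈⟨ *-identityˡ _ ⟩
    h 0                   ∎
  quot-correct {a} {f} inv h (suc n) = begin
    (f ⊛ quot a f h) (suc n)                            ≈⟨ ⊛-sucʳ f (quot a f h) n ⟩
    f (suc n) * (a * h 0) + (f ⊛ tail (quot a f h)) n   ≈⟨ +-congˡ (quot-correct inv _ n) ⟩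
    f (suc n) * (a * h 0) + (h (suc n) - f (suc n) * (a * h 0))
                                                        ≈⟨ +-comm _ _ ⟩
    h (suc n) - f (suc n) * (a * h 0) + f (suc n) * (a * h 0)
                                                        ≈⟨ //-rightDividesˡ _ _ ⟩
    h (suc n)                                           ∎

  invertible : ∀ {a f} → f 0 * a ≈ 1# → ∃[ g ] f ⊛ g ≈ₛ S.1#
  invertible {a} {f} inv = quot a f S.1# , quot-correct inv S.1#

  const-isHom : IsRingHomomorphism rawRing P.powerSeriesRing P.const
  const-isHom = RingHom.isRingHomomorphism ring (CommutativeRing.ring seriesRing) P.const
    (λ { eq zero → eq ; eq (suc n) → refl })
    (λ { a b zero → refl ; a b (suc n) → sym (+-identityʳ 0#) })
    (λ { a b n → sym (trans (const-⊛ a (P.const b) n) (lemma a b n)) })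
    (λ _ → refl)
    where
    lemma : ∀ a b → a · P.const b ≈ₛ P.const (a * b)
    lemma a b zero    = refl
    lemma a b (suc n) = zeroʳ a

module SeriesMap (R : CommutativeRing c ℓ) (σ : CommutativeRing.Carrier R → CommutativeRing.Carrier R)
  (isHom : IsRingHomomorphism (CommutativeRing.rawRing R) (CommutativeRing.rawRing R) σ) where
  open CommutativeRing R
  open SeriesRing R
  private module σ = RingHom.Properties ring ring σ isHom

  ⊛-homo : ∀ f g n → σ ((f ⊛ g) n) ≈ ((σ ∘ f) ⊛ (σ ∘ g)) n
  ⊛-homo f g zero    = trans (σ.+-homo _ _) (+-cong (σ.*-homo _ _) σ.0#-homo)
  ⊛-homo f g (suc n) = trans (σ.+-homo _ _) (+-cong (σ.*-homo _ _) (⊛-homo (tail f) g n))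

  map-isHom : IsRingHomomorphism P.powerSeriesRing P.powerSeriesRing (σ ∘_)
  map-isHom = RingHom.isRingHomomorphism Sr Sr (σ ∘_)
    (λ eq n → σ.f-cong (eq n)) (λ f g n → σ.+-homo _ _) ⊛-homo
    (λ { zero → σ.1#-homo ; (suc n) → σ.0#-homo })
    where Sr = CommutativeRing.ring seriesRing

module PolynomialRing (R : CommutativeRing c ℓ) where
  open CommutativeRing R hiding (zero)
  open SeriesRing R using (_⊕_; _⊛_; _≈ₛ_; ⊛-zeroˡ; module P; isCommutativeRing′)
  open Polynomial rawRing public
  open RingProps ring

  coeff-+ : ∀ f g → coeff (f +ₚ g) ≈ₛ coeff f ⊕ coeff g
  coeff-+ []      g       i       = sym (+-identityˡ _)
  coeff-+ (a ∷ f) []      i       = sym (+-identityʳ _)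
  coeff-+ (a ∷ f) (b ∷ g) zero    = refl
  coeff-+ (a ∷ f) (b ∷ g) (suc i) = coeff-+ f g i

  coeff-map : ∀ {h : Carrier → Carrier} → h 0# ≈ 0# → ∀ f i → coeff (map h f) i ≈ h (coeff f i)
  coeff-map h0 []      i       = sym h0
  coeff-map h0 (a ∷ f) zero    = refl
  coeff-map h0 (a ∷ f) (suc i) = coeff-map h0 f i

  coeff-* : ∀ f g → coeff (f *ₚ g) ≈ₛ coeff f ⊛ coeff g
  coeff-* []      g n = sym (⊛-zeroˡ (coeff []) (coeff g) (λ _ → refl) n)
  coeff-* (a ∷ f) g n = trans (coeff-+ (map (a *_) g) (0# ∷ f *ₚ g) n)
    (trans (+-congʳ (coeff-map (zeroʳ a) g n)) (shift n))
    where
    shift : ∀ n → a * coeff g n + coeff (0# ∷ f *ₚ g) n ≈ (coeff (a ∷ f) ⊛ coeff g) n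
    shift zero    = refl
    shift (suc n) = +-congˡ (coeff-* f g n)

  coeff-isMono : IsRingMonomorphism polynomialRing P.powerSeriesRing coeff
  coeff-isMono = record
    { isRingHomomorphism = record
      { isSemiringHomomorphism = record
        { isNearSemiringHomomorphism = record
          { +-isMonoidHomomorphism = record
            { isMagmaHomomorphism = record
              { isRelHomomorphism = record { cong = id } ; homo = coeff-+ }
            ; ε-homo = λ _ → refl }
          ; *-homo = coeff-* }
        ; 1#-homo = λ { zero → refl ; (suc i) → refl } }
      ; -‿homo = coeff-map -0#≈0# }
    ; injective = id }

  polynomialCommutativeRing : CommutativeRing c ℓ
  polynomialCommutativeRing = record
    { isCommutativeRing = RingMonomorphism.isCommutativeRing coeff-isMono isCommutativeRing′ }

  const-isHom : IsRingHomomorphism rawRing polynomialRing const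
  const-isHom = RingHom.isRingHomomorphism ring (CommutativeRing.ring polynomialCommutativeRing) const
    (λ { eq zero → eq ; eq (suc _) → refl })
    (λ a b _ → refl)
    (λ { a b zero → sym (+-identityʳ _) ; a b (suc _) → refl })
    (λ _ → refl)

module Evaluation (R : CommutativeRing c ℓ) (S : CommutativeRing c′ ℓ′)
  (κ : CommutativeRing.Carrier R → CommutativeRing.Carrier S)
  (κ-isHom : IsRingHomomorphism (CommutativeRing.rawRing R) (CommutativeRing.rawRing S) κ) where
  private
    module R = CommutativeRing R
    module κ = RingHom.Properties R.ring (CommutativeRing.ring S) κ κ-isHom
  open Polynomial R.rawRing
  open PolynomialRing R using (polynomialCommutativeRing)
  private module P = CommutativeRing polynomialCommutativeRing
  open CommutativeRing S hiding (zero)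
  open SetoidReasoning setoid
  open CommutativeSemigroupProps +-commutativeSemigroup using (interchange)
  open CommutativeSemigroupProps *-commutativeSemigroup using (x∙yz≈y∙xz)

  eval : Carrier → Poly → Carrier
  eval h []      = 0#
  eval h (a ∷ f) = κ a + h * eval h f

  eval-congˡ : ∀ {h k} f → h ≈ k → eval h f ≈ eval k f
  eval-congˡ []      eq = refl
  eval-congˡ (a ∷ f) eq = +-congˡ (*-cong eq (eval-congˡ f eq))

  module _ (h : Carrier) where

    eval-∷ : ∀ {a x} → a ≈ 0# → x ≈ 0# → a + h * x ≈ 0#
    eval-∷ p q = trans (+-cong p (trans (*-congˡ q) (zeroʳ h))) (+-identityˡ 0#)

    eval-zero : ∀ f → (∀ i → coeff f i R.≈ R.0#) → eval h f ≈ 0#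
    eval-zero []      z = refl
    eval-zero (a ∷ f) z = eval-∷ (trans (κ.f-cong (z 0)) κ.0#-homo) (eval-zero f (z ∘ suc))

    eval-cong : ∀ f g → f ≈ₚ g → eval h f ≈ eval h g
    eval-cong []      g       eq = sym (eval-zero g (R.sym ∘ eq))
    eval-cong (a ∷ f) []      eq = eval-zero (a ∷ f) eq
    eval-cong (a ∷ f) (b ∷ g) eq =
      +-cong (κ.f-cong (eq 0)) (*-congˡ (eval-cong f g (eq ∘ suc)))

    eval-+ : ∀ f g → eval h (f +ₚ g) ≈ eval h f + eval h g
    eval-+ []      g       = sym (+-identityˡ _)
    eval-+ (a ∷ f) []      = sym (+-identityʳ _)
    eval-+ (a ∷ f) (b ∷ g) = begin
      κ (a R.+ b) + h * eval h (f +ₚ g)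
        ≈⟨ +-cong (κ.+-homo a b) (trans (*-congˡ (eval-+ f g)) (distribˡ h _ _)) ⟩
      κ a + κ b + (h * eval h f + h * eval h g)    ≈⟨ interchange _ _ _ _ ⟩
      κ a + h * eval h f + (κ b + h * eval h g)    ∎

    eval-scale : ∀ a g → eval h (map (a R.*_) g) ≈ κ a * eval h g
    eval-scale a []      = sym (zeroʳ _)
    eval-scale a (b ∷ g) = begin
      κ (a R.* b) + h * eval h (map (a R.*_) g)  ≈⟨ +-cong (κ.*-homo a b) (*-congˡ (eval-scale a g)) ⟩
      κ a * κ b + h * (κ a * eval h g)           ≈⟨ +-congˡ (x∙yz≈y∙xz _ _ _) ⟩
      κ a * κ b + κ a * (h * eval h g)           ≈⟨ distribˡ _ _ _ ⟨
      κ a * (κ b + h * eval h g)                 ∎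

    eval-* : ∀ f g → eval h (f *ₚ g) ≈ eval h f * eval h g
    eval-* []      g = sym (zeroˡ _)
    eval-* (a ∷ f) g = begin
      eval h (map (a R.*_) g +ₚ (R.0# ∷ f *ₚ g))             ≈⟨ eval-+ (map (a R.*_) g) _ ⟩
      eval h (map (a R.*_) g) + (κ R.0# + h * eval h (f *ₚ g))
        ≈⟨ +-cong (eval-scale a g) (trans (+-congʳ κ.0#-homo) (+-identityˡ _)) ⟩
      κ a * eval h g + h * eval h (f *ₚ g)                   ≈⟨ +-congˡ (*-congˡ (eval-* f g)) ⟩
      κ a * eval h g + h * (eval h f * eval h g)             ≈⟨ +-congˡ (*-assoc _ _ _) ⟨
      κ a * eval h g + h * eval h f * eval h g               ≈⟨ distribʳ _ _ _ ⟨
      (κ a + h * eval h f) * eval h g                        ∎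

    eval-const : ∀ a → eval h (const a) ≈ κ a
    eval-const a = trans (+-congˡ (zeroʳ h)) (+-identityʳ _)

    eval-X : eval h X ≈ h
    eval-X = begin
      κ R.0# + h * eval h (const R.1#)  ≈⟨ +-cong κ.0#-homo (*-congˡ (trans (eval-const R.1#) κ.1#-homo)) ⟩
      0# + h * 1#                       ≈⟨ +-identityˡ _ ⟩
      h * 1#                            ≈⟨ *-identityʳ h ⟩
      h                                 ∎

    eval-isHom : IsRingHomomorphism polynomialRing rawRing (eval h)
    eval-isHom = RingHom.isRingHomomorphism P.ring ring (eval h)
      (λ {f} {g} → eval-cong f g) eval-+ eval-* (trans (eval-const R.1#) κ.1#-homo)

  hom-eval : ∀ {ψ} → IsRingHomomorphism rawRing rawRing ψ → (∀ a → ψ (κ a) ≈ κ a) →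
             ∀ h f → ψ (eval h f) ≈ eval (ψ h) f
  hom-eval {ψ} isHom fixes h []      = RingHom.Properties.0#-homo ring ring ψ isHom
  hom-eval {ψ} isHom fixes h (a ∷ f) = trans (ψ.+-homo _ _)
    (+-cong (fixes a) (trans (ψ.*-homo _ _) (*-congˡ (hom-eval isHom fixes h f))))
    where module ψ = RingHom.Properties ring ring ψ isHom

  open SemiringSum semiring using (sum; sum-cong-≋; sum-init-last; *-distribˡ-sum)
  open SemiringExp semiring using (_^_)

  span-powers : ∀ P h → h ^ suc P ≈ 1# → ∀ f →
    ∃ λ (b : Fin (suc P) → R.Carrier) → eval h f ≈ sum (λ i → κ (b i) * h ^ toℕ i)
  span-powers P h h^P≈1 [] = (λ _ → R.0#) ,
    sym (trans (sum-cong-≋ {suc P} (λ i → trans (*-congʳ {h ^ toℕ i} κ.0#-homo) (zeroˡ _)))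
               (sum-replicate-zero (suc P)))
    where open SemiringSum semiring using (sum-replicate-zero)
  span-powers P h h^P≈1 (a ∷ f) = b′ , (begin
    κ a + h * eval h f                                              ≈⟨ +-congˡ (*-congˡ eq) ⟩
    κ a + h * sum (λ i → κ (b i) * h ^ toℕ i)                       ≈⟨ +-congˡ (*-distribˡ-sum h (λ i → κ (b i) * h ^ toℕ i)) ⟩
    κ a + sum (λ i → h * (κ (b i) * h ^ toℕ i))                     ≈⟨ +-congˡ (sum-cong-≋ (λ i → x∙yz≈y∙xz h (κ (b i)) (h ^ toℕ i))) ⟩
    κ a + sum (λ i → κ (b i) * h ^ suc (toℕ i))                     ≈⟨ +-congˡ (sum-init-last (λ i → κ (b i) * h ^ suc (toℕ i))) ⟩
    κ a + (sum (λ i → κ (b (inject₁ i)) * h ^ suc (toℕ (inject₁ i)))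
           + κ (b (fromℕ P)) * h ^ suc (toℕ (fromℕ P)))
      ≡⟨ ≡.cong (λ n → κ a + (sum (λ i → κ (b (inject₁ i)) * h ^ suc (toℕ (inject₁ i))) + κ (b (fromℕ P)) * h ^ suc n)) (toℕ-fromℕ P) ⟩
    κ a + (sum (λ i → κ (b (inject₁ i)) * h ^ suc (toℕ (inject₁ i))) + κ (b (fromℕ P)) * h ^ suc P)
      ≈⟨ +-congˡ (+-cong (sum-cong-≋ {P} λ i → *-congˡ {κ (b (inject₁ i))} (reflexive (≡.cong (λ n → h ^ suc n) (toℕ-inject₁ i)))) (*-congˡ h^P≈1)) ⟩
    κ a + (sum (λ i → κ (b (inject₁ i)) * h ^ suc (toℕ i)) + κ (b (fromℕ P)) * 1#)
      ≈⟨ +-congˡ (+-comm _ _) ⟩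
    κ a + (κ (b (fromℕ P)) * 1# + sum (λ i → κ (b (inject₁ i)) * h ^ suc (toℕ i)))
      ≈⟨ +-assoc _ _ _ ⟨
    κ a + κ (b (fromℕ P)) * 1# + sum (λ i → κ (b (inject₁ i)) * h ^ suc (toℕ i))
      ≈⟨ +-congʳ (trans (+-congʳ (sym (*-identityʳ _))) (trans (sym (distribʳ 1# _ _)) (*-congʳ (sym (κ.+-homo a (b (fromℕ P))))))) ⟩
    κ (a R.+ b (fromℕ P)) * 1# + sum (λ i → κ (b (inject₁ i)) * h ^ suc (toℕ i))  ∎)
    where
    IH = span-powers P h h^P≈1 f
    b = proj₁ IH
    eq = proj₂ IH
    b′ : Fin (suc P) → R.Carrier
    b′ zero    = a R.+ b (fromℕ P)
    b′ (suc i) = b (inject₁ i)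

  module _ {d : Carrier} where
    open PrincipalIdeal S d
    private module Q′ = CommutativeRing quotientCommutativeRing

    eval-≋ : ∀ {h k} → h Q.≋ k → ∀ f → eval h f Q.≋ eval k f
    eval-≋ h≋k []      = Q′.refl
    eval-≋ h≋k (a ∷ f) = Q′.+-congˡ (Q′.*-cong h≋k (eval-≋ h≋k f))

  -- An endomorphism over R of a quotient S of R[X] is determined by the image of X.
  module PowerEndomorphism {X} (lift : Carrier → Poly) (eval-lift : ∀ b → eval X (lift b) ≈ b)
    {ψ} (ψ-isHom : IsRingHomomorphism rawRing rawRing ψ) (ψ-κ : ∀ a → ψ (κ a) ≈ κ a)
    {a} (ψ-X : ψ X ≈ X ^ a) where
    open SemiringExp semiring using (^-congˡ; ^-assocʳ)
    private module ψ = RingHom.Properties ring ring ψ ψ-isHom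

    ψ≈eval : ∀ b → ψ b ≈ eval (X ^ a) (lift b)
    ψ≈eval b = begin
      ψ b                          ≈⟨ ψ.f-cong (eval-lift b) ⟨
      ψ (eval X (lift b))          ≈⟨ hom-eval ψ-isHom ψ-κ X (lift b) ⟩
      eval (ψ X) (lift b)          ≈⟨ eval-congˡ (lift b) ψ-X ⟩
      eval (X ^ a) (lift b)        ∎

    fold≈eval : ∀ n b → fold b ψ n ≈ eval (X ^ (a ℕ.^ n)) (lift b)
    fold≈eval zero    b = trans (sym (eval-lift b)) (eval-congˡ (lift b) (sym (*-identityʳ X)))
    fold≈eval (suc n) b = begin
      ψ (fold b ψ n)                       ≈⟨ ψ.f-cong (fold≈eval n b) ⟩
      ψ (eval (X ^ (a ℕ.^ n)) (lift b))    ≈⟨ hom-eval ψ-isHom ψ-κ _ (lift b) ⟩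
      eval (ψ (X ^ (a ℕ.^ n))) (lift b)    ≈⟨ eval-congˡ (lift b) (trans (ψ.^-homo X (a ℕ.^ n))
                                                (trans (^-congˡ (a ℕ.^ n) ψ-X) (^-assocʳ X a (a ℕ.^ n)))) ⟩
      eval (X ^ (a ℕ.^ suc n)) (lift b)    ∎

    fold≈id : ∀ {n} → X ^ (a ℕ.^ n) ≈ X → ∀ b → fold b ψ n ≈ b
    fold≈id {n} eq b = trans (fold≈eval n b) (trans (eval-congˡ (lift b) eq) (eval-lift b))

    ψ≡id : ∀ {d} → let open PrincipalIdeal S d in X ^ a Q.≋ X → ∀ b → ψ b Q.≋ b
    ψ≡id {d} eq b = PrincipalIdeal.Q.≋-trans S d (PrincipalIdeal.Q.≈⇒≋ S d (ψ≈eval b))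
      (PrincipalIdeal.Q.≋-trans S d (eval-≋ eq (lift b)) (PrincipalIdeal.Q.≈⇒≋ S d (eval-lift b)))

[r+tN]%N : ∀ {r} t N .{{_ : NonZero N}} → r < N → (r ℕ.+ t ℕ.* N) % N ≡ r
[r+tN]%N {r} t N r<N = ≡.trans ([m+kn]%n≡m%n r t N) (m<n⇒m%n≡m r<N)

[r+tN]/N : ∀ {r} t N .{{_ : NonZero N}} → r < N → (r ℕ.+ t ℕ.* N) / N ≡ t
[r+tN]/N {r} t N r<N = ≡.trans (+-distrib-/-∣ʳ r (n∣m*n t))
  (≡.cong₂ ℕ._+_ (m<n⇒m/n≡0 r<N) (m*n/n≡m t N))

module Single (R : CommutativeRing c ℓ) where
  open CommutativeRing R hiding (zero)
  open SemiringSum semiring using (sum; sum-cong-≋; sum-replicate-zero)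

  single : ∀ {n} → Carrier → Fin n → Fin n → Carrier
  single b zero    zero    = b
  single b zero    (suc k) = 0#
  single b (suc i) zero    = 0#
  single b (suc i) (suc k) = single b i k

  single-cong : ∀ {n a b} → a ≈ b → ∀ (i k : Fin n) → single a i k ≈ single b i k
  single-cong eq zero    zero    = eq
  single-cong eq zero    (suc k) = refl
  single-cong eq (suc i) zero    = refl
  single-cong eq (suc i) (suc k) = single-cong eq i k

  single-≡ : ∀ {n b} (i : Fin n) → single b i i ≡ b
  single-≡ zero    = ≡.refl
  single-≡ (suc i) = single-≡ i

  single-≢ : ∀ {n b} {i k : Fin n} → i ≢ k → single b i k ≡ 0#
  single-≢ {i = zero}  {zero}  i≢k = contradiction ≡.refl i≢k
  single-≢ {i = zero}  {suc k} i≢k = ≡.refl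
  single-≢ {i = suc i} {zero}  i≢k = ≡.refl
  single-≢ {i = suc i} {suc k} i≢k = single-≢ (i≢k ∘ ≡.cong suc)

  single-inject₁ : ∀ {n b} (i k : Fin n) → single b (inject₁ i) (inject₁ k) ≡ single b i k
  single-inject₁ zero    zero    = ≡.refl
  single-inject₁ zero    (suc k) = ≡.refl
  single-inject₁ (suc i) zero    = ≡.refl
  single-inject₁ (suc i) (suc k) = single-inject₁ i k

  single-inject₁-fromℕ : ∀ {n b} (i : Fin n) → single b (inject₁ i) (fromℕ n) ≡ 0#
  single-inject₁-fromℕ zero    = ≡.refl
  single-inject₁-fromℕ (suc i) = single-inject₁-fromℕ i

  single-fromℕ-inject₁ : ∀ {n b} (k : Fin n) → single b (fromℕ n) (inject₁ k) ≡ 0#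
  single-fromℕ-inject₁ zero    = ≡.refl
  single-fromℕ-inject₁ (suc k) = single-fromℕ-inject₁ k

  sum-zero : ∀ {n} {t : Fin n → Carrier} → (∀ i → t i ≈ 0#) → sum t ≈ 0#
  sum-zero {n} z = trans (sum-cong-≋ z) (sum-replicate-zero n)

  sum-single : ∀ {n} (x : Fin n → Carrier) k → sum (λ i → single (x i) i k) ≈ x k
  sum-single x zero    = trans (+-congˡ (sum-zero {t = λ i → single (x (suc i)) (suc i) zero} (λ _ → refl))) (+-identityʳ _)
  sum-single x (suc k) = trans (+-identityˡ _) (sum-single (x ∘ suc) k)

module CyclicAlgebraRing (R : CommutativeRing c ℓ)
  (σ : CommutativeRing.Carrier R → CommutativeRing.Carrier R)
  (σ-isHom : IsRingHomomorphism (CommutativeRing.rawRing R) (CommutativeRing.rawRing R) σ)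
  (γ : CommutativeRing.Carrier R) (N′ : ℕ)
  (σγ≈γ : CommutativeRing._≈_ R (σ γ) γ)
  (σᴺ≈id : ∀ b → CommutativeRing._≈_ R (fold b σ (suc N′)) b) where
  open CommutativeRing R hiding (zero)
  open SetoidReasoning setoid
  open SemiringSum semiring
  open CommutativeSemigroupProps *-commutativeSemigroup using (x∙yz≈y∙xz; x∙yz≈yx∙z)
  open RawSemiringDefs (Semiring.rawSemiring semiring) using (_^_)
  open Single R
  private
    module σ = RingHom.Properties ring ring σ σ-isHom
    N = suc N′
  module C = CyclicAlgebra rawRing σ γ N
  open C public using (Elt; monomial; const; u)
  module A = RawRing C.cyclicAlgebra
  open A public using () renaming (_≈_ to _≈ᴬ_; _+_ to _+ᴬ_; _*_ to _*ᴬ_)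

  monomial≈single : ∀ b n i t → n % N ≡ toℕ i → n / N ≡ t →
                    monomial b n ≈ᴬ single (b * γ ^ t) i
  monomial≈single b n i t n%N≡i n/N≡t k with n % N ℕ.≟ toℕ k
  ... | yes n%N≡k with ≡.refl ← toℕ-injective (≡.trans (≡.sym n%N≡i) n%N≡k) =
    reflexive (≡.trans (≡.cong (λ t → b * γ ^ t) n/N≡t) (≡.sym (single-≡ i)))
  ... | no n%N≢k = reflexive (≡.sym (single-≢ λ i≡k → n%N≢k (≡.trans n%N≡i (≡.cong toℕ i≡k))))

  monomial-+tN : ∀ b (i : Fin N) t → monomial b (toℕ i ℕ.+ t ℕ.* N) ≈ᴬ single (b * γ ^ t) i
  monomial-+tN b i t = monomial≈single b (toℕ i ℕ.+ t ℕ.* N) i t ([r+tN]%N t N (toℕ<n i)) ([r+tN]/N t N (toℕ<n i))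

  monomial-* : ∀ a b n k → monomial (a * b) n k ≈ a * monomial b n k
  monomial-* a b n k with n % N ℕ.≟ toℕ k
  ... | yes _ = *-assoc a b _
  ... | no  _ = sym (zeroʳ a)

  monomial-cong : ∀ {a b} → a ≈ b → ∀ n → monomial a n ≈ᴬ monomial b n
  monomial-cong eq n k with n % N ℕ.≟ toℕ k
  ... | yes _ = *-congʳ eq
  ... | no  _ = refl

  monomial-toℕ : ∀ b (i : Fin N) → monomial b (toℕ i) ≈ᴬ single b i
  monomial-toℕ b i k = trans (monomial≈single b (toℕ i) i 0 (m<n⇒m%n≡m (toℕ<n i)) (m<n⇒m/n≡0 (toℕ<n i)) k)
    (single-cong (*-identityʳ b) i k)

  -- Left multiplication by u.  Writing x * y = Σ xᵢ Uⁱ y, associativity follows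
  -- from U commuting with right multiplications.
  U : Elt → Elt
  U y zero    = γ * σ (y (fromℕ N′))
  U y (suc k) = σ (y (inject₁ k))

  U-cong : ∀ {x y} → x ≈ᴬ y → U x ≈ᴬ U y
  U-cong eq zero    = *-congˡ (σ.f-cong (eq _))
  U-cong eq (suc k) = σ.f-cong (eq _)

  U-+ : ∀ x y → U (x +ᴬ y) ≈ᴬ U x +ᴬ U y
  U-+ x y zero    = trans (*-congˡ (σ.+-homo _ _)) (distribˡ _ _ _)
  U-+ x y (suc k) = σ.+-homo _ _

  U-scale : ∀ b y → U (λ k → b * y k) ≈ᴬ λ k → σ b * U y k
  U-scale b y zero    = trans (*-congˡ (σ.*-homo _ _)) (x∙yz≈y∙xz _ _ _)
  U-scale b y (suc k) = σ.*-homo _ _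

  U-0 : U A.0# ≈ᴬ A.0#
  U-0 zero    = trans (*-congˡ σ.0#-homo) (zeroʳ γ)
  U-0 (suc k) = σ.0#-homo

  U-sum : ∀ {n} (t : Fin n → Elt) → U (λ k → sum (λ i → t i k)) ≈ᴬ λ k → sum (λ i → U (t i) k)
  U-sum {zero}  t k = U-0 k
  U-sum {suc n} t k = trans (U-+ (t zero) _ k) (+-congˡ (U-sum (t ∘ suc) k))

  U-lin : ∀ {n} (b : Fin n → Carrier) (y : Fin n → Elt) →
          U (λ k → sum (λ i → b i * y i k)) ≈ᴬ λ k → sum (λ i → σ (b i) * U (y i) k)
  U-lin b y k = trans (U-sum (λ i k → b i * y i k) k) (sum-cong-≋ λ i → U-scale (b i) (y i) k)

  U-single-inject₁ : ∀ b i → U (single b (inject₁ i)) ≈ᴬ single (σ b) (suc i)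
  U-single-inject₁ b i zero    =
    trans (*-congˡ (trans (σ.f-cong (reflexive (single-inject₁-fromℕ i))) σ.0#-homo)) (zeroʳ γ)
  U-single-inject₁ b i (suc k) = trans (σ.f-cong (reflexive (single-inject₁ i k))) (σ-single i k)
    where
    σ-single : ∀ {n} (i k : Fin n) → σ (single b i k) ≈ single (σ b) i k
    σ-single zero    zero    = refl
    σ-single zero    (suc k) = σ.0#-homo
    σ-single (suc i) zero    = σ.0#-homo
    σ-single (suc i) (suc k) = σ-single i k

  U-single-fromℕ : ∀ b → U (single b (fromℕ N′)) ≈ᴬ single (γ * σ b) zero
  U-single-fromℕ b zero    = *-congˡ (σ.f-cong (reflexive (single-≡ (fromℕ N′))))
  U-single-fromℕ b (suc k) = trans (σ.f-cong (reflexive (single-fromℕ-inject₁ k))) σ.0#-homo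

  σ-γ^ : ∀ t → σ (γ ^ t) ≈ γ ^ t
  σ-γ^ zero    = σ.1#-homo
  σ-γ^ (suc t) = trans (σ.*-homo _ _) (*-cong σγ≈γ (σ-γ^ t))

  U-monomial : ∀ b n → U (monomial b n) ≈ᴬ monomial (σ b) (suc n)
  U-monomial b n = ≡.subst (λ n → U (monomial b n) ≈ᴬ monomial (σ b) (suc n))
    (≡.sym n≡i+tN) (shift i)
    where
    i = fromℕ< (m%n<n n N)
    t = n / N
    n≡i+tN : n ≡ toℕ i ℕ.+ t ℕ.* N
    n≡i+tN = ≡.trans (m≡m%n+[m/n]*n n N) (≡.cong (ℕ._+ t ℕ.* N) (≡.sym (toℕ-fromℕ< (m%n<n n N))))
    shift : ∀ i → U (monomial b (toℕ i ℕ.+ t ℕ.* N)) ≈ᴬ monomial (σ b) (suc (toℕ i ℕ.+ t ℕ.* N))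
    shift i k with view i
    ... | ‵inject₁ j = begin
      U (monomial b (toℕ (inject₁ j) ℕ.+ t ℕ.* N)) k      ≈⟨ U-cong (monomial-+tN b (inject₁ j) t) k ⟩
      U (single (b * γ ^ t) (inject₁ j)) k                ≈⟨ U-single-inject₁ (b * γ ^ t) j k ⟩
      single (σ (b * γ ^ t)) (suc j) k                    ≈⟨ single-cong (trans (σ.*-homo _ _) (*-congˡ (σ-γ^ t))) (suc j) k ⟩
      single (σ b * γ ^ t) (suc j) k                      ≈⟨ monomial-+tN (σ b) (suc j) t k ⟨
      monomial (σ b) (suc (toℕ j) ℕ.+ t ℕ.* N) k          ≡⟨ ≡.cong (λ m → monomial (σ b) (suc m ℕ.+ t ℕ.* N) k) (toℕ-inject₁ j) ⟨
      monomial (σ b) (suc (toℕ (inject₁ j) ℕ.+ t ℕ.* N)) k ∎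
    ... | ‵fromℕ = begin
      U (monomial b (toℕ (fromℕ N′) ℕ.+ t ℕ.* N)) k       ≈⟨ U-cong (monomial-+tN b (fromℕ N′) t) k ⟩
      U (single (b * γ ^ t) (fromℕ N′)) k                 ≈⟨ U-single-fromℕ (b * γ ^ t) k ⟩
      single (γ * σ (b * γ ^ t)) zero k                   ≈⟨ single-cong (trans (*-congˡ (trans (σ.*-homo _ _) (*-congˡ (σ-γ^ t)))) (x∙yz≈y∙xz _ _ _)) zero k ⟩
      single (σ b * γ ^ suc t) zero k                     ≈⟨ monomial-+tN (σ b) zero (suc t) k ⟨
      monomial (σ b) (suc t ℕ.* N) k                      ≡⟨ ≡.cong (λ m → monomial (σ b) (suc m ℕ.+ t ℕ.* N) k) (toℕ-fromℕ N′) ⟨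
      monomial (σ b) (suc (toℕ (fromℕ N′) ℕ.+ t ℕ.* N)) k ∎

  U^ : ℕ → Elt → Elt
  U^ n y = fold y U n

  U^-cong : ∀ {x y} → x ≈ᴬ y → ∀ n → U^ n x ≈ᴬ U^ n y
  U^-cong eq zero    = eq
  U^-cong eq (suc n) = U-cong (U^-cong eq n)

  U^-+ : ∀ x y n → U^ n (x +ᴬ y) ≈ᴬ U^ n x +ᴬ U^ n y
  U^-+ x y zero    k = refl
  U^-+ x y (suc n) k = trans (U-cong (U^-+ x y n) k) (U-+ _ _ k)

  U^-monomial : ∀ b m n → U^ n (monomial b m) ≈ᴬ monomial (fold b σ n) (n ℕ.+ m)
  U^-monomial b m zero    k = refl
  U^-monomial b m (suc n) k = trans (U-cong (U^-monomial b m n) k) (U-monomial _ _ k)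

  U^-sum : ∀ y n → U^ n y ≈ᴬ λ k → sum λ j → monomial (fold (y j) σ n) (n ℕ.+ toℕ j) k
  U^-sum y zero    k = trans (sym (sum-single y k)) (sum-cong-≋ λ j → sym (monomial-toℕ (y j) j k))
  U^-sum y (suc n) k = trans (U-cong (U^-sum y n) k)
    (trans (U-sum (λ j → monomial (fold (y j) σ n) (n ℕ.+ toℕ j)) k)
           (sum-cong-≋ λ j → U-monomial (fold (y j) σ n) (n ℕ.+ toℕ j) k))

  U^N : ∀ z k → U^ N z k ≈ γ * z k
  U^N z k = begin
    U^ N z k                                                     ≈⟨ U^-sum z N k ⟩
    sum (λ j → monomial (fold (z j) σ N) (N ℕ.+ toℕ j) k)        ≈⟨ sum-cong-≋ (λ j → wrap j) ⟩
    sum (λ j → single (γ * z j) j k)                             ≈⟨ sum-single (λ j → γ * z j) k ⟩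
    γ * z k                                                      ∎
    where
    wrap : ∀ j → monomial (fold (z j) σ N) (N ℕ.+ toℕ j) k ≈ single (γ * z j) j k
    wrap j = begin
      monomial (fold (z j) σ N) (N ℕ.+ toℕ j) k        ≈⟨ monomial-cong (σᴺ≈id (z j)) (N ℕ.+ toℕ j) k ⟩
      monomial (z j) (N ℕ.+ toℕ j) k                   ≡⟨ ≡.cong (λ m → monomial (z j) m k)
                                                            (≡.trans (ℕ.+-comm N (toℕ j)) (≡.cong (toℕ j ℕ.+_) (≡.sym (ℕ.*-identityˡ N)))) ⟩
      monomial (z j) (toℕ j ℕ.+ 1 ℕ.* N) k             ≈⟨ monomial-+tN (z j) j 1 k ⟩
      single (z j * γ ^ 1) j k                         ≈⟨ single-cong (trans (*-congˡ (*-identityʳ γ)) (*-comm _ _)) j k ⟩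
      single (γ * z j) j k                             ∎

  infixl 7 _⋆_
  _⋆_ : Elt → Elt → Elt
  (x ⋆ y) k = sum λ i → x i * U^ (toℕ i) y k

  *≈⋆ : ∀ x y → x *ᴬ y ≈ᴬ x ⋆ y
  *≈⋆ x y k = sum-cong-≋ {N} λ i → begin
    sum (λ j → monomial (x i * fold (y j) σ (toℕ i)) (toℕ i ℕ.+ toℕ j) k)
      ≈⟨ sum-cong-≋ (λ j → monomial-* (x i) (fold (y j) σ (toℕ i)) (toℕ i ℕ.+ toℕ j) k) ⟩
    sum (λ j → x i * monomial (fold (y j) σ (toℕ i)) (toℕ i ℕ.+ toℕ j) k)
      ≈⟨ *-distribˡ-sum (x i) (λ j → monomial (fold (y j) σ (toℕ i)) (toℕ i ℕ.+ toℕ j) k) ⟨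
    x i * sum (λ j → monomial (fold (y j) σ (toℕ i)) (toℕ i ℕ.+ toℕ j) k)
      ≈⟨ *-congˡ (U^-sum y (toℕ i) k) ⟨
    x i * U^ (toℕ i) y k  ∎

  ⋆-cong : ∀ {x x′ y y′} → x ≈ᴬ x′ → y ≈ᴬ y′ → x ⋆ y ≈ᴬ x′ ⋆ y′
  ⋆-cong p q k = sum-cong-≋ {N} λ i → *-cong (p i) (U^-cong q (toℕ i) k)

  U-⋆ : ∀ x z → U x ⋆ z ≈ᴬ U (x ⋆ z)
  U-⋆ x z k = sym (begin
    U (x ⋆ z) k                                     ≈⟨ U-lin x (λ i → U^ (toℕ i) z) k ⟩
    sum (λ i → σ (x i) * U^ (suc (toℕ i)) z k)      ≈⟨ sum-init-last (λ i → σ (x i) * U^ (suc (toℕ i)) z k) ⟩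
    sum (λ i → σ (x (inject₁ i)) * U^ (suc (toℕ (inject₁ i))) z k)
      + σ (x (fromℕ N′)) * U^ (suc (toℕ (fromℕ N′))) z k
      ≈⟨ +-cong (sum-cong-≋ {N′} λ i → *-congˡ {σ (x (inject₁ i))} (reflexive (≡.cong (λ n → U^ (suc n) z k) (toℕ-inject₁ i))))
                (*-congˡ (trans (reflexive (≡.cong (λ n → U^ (suc n) z k) (toℕ-fromℕ N′))) (U^N z k))) ⟩
    sum (λ i → σ (x (inject₁ i)) * U^ (suc (toℕ i)) z k) + σ (x (fromℕ N′)) * (γ * z k)
      ≈⟨ trans (+-comm _ _) (+-congʳ (x∙yz≈yx∙z (σ (x (fromℕ N′))) γ (z k))) ⟩
    (U x ⋆ z) k                                     ∎)

  U^-⋆ : ∀ x z n → U^ n x ⋆ z ≈ᴬ U^ n (x ⋆ z)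
  U^-⋆ x z zero    k = refl
  U^-⋆ x z (suc n) k = trans (U-⋆ (U^ n x) z k) (U-cong (U^-⋆ x z n) k)

  ⋆-lin : ∀ {n} (b : Fin n → Carrier) (y : Fin n → Elt) z →
          (λ k → sum (λ i → b i * y i k)) ⋆ z ≈ᴬ λ k → sum (λ i → b i * (y i ⋆ z) k)
  ⋆-lin b y z k = begin
    sum (λ l → sum (λ i → b i * y i l) * U^ (toℕ l) z k)
      ≈⟨ sum-cong-≋ (λ l → *-distribʳ-sum (U^ (toℕ l) z k) (λ i → b i * y i l)) ⟩
    sum (λ l → sum (λ i → b i * y i l * U^ (toℕ l) z k))
      ≈⟨ ∑-comm (λ l i → b i * y i l * U^ (toℕ l) z k) ⟩
    sum (λ i → sum (λ l → b i * y i l * U^ (toℕ l) z k))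
      ≈⟨ sum-cong-≋ (λ i → trans (sum-cong-≋ {N} λ l → *-assoc (b i) (y i l) (U^ (toℕ l) z k))
           (sym (*-distribˡ-sum (b i) (λ l → y i l * U^ (toℕ l) z k)))) ⟩
    sum (λ i → b i * (y i ⋆ z) k)  ∎

  ⋆-assoc : ∀ x y z → (x ⋆ y) ⋆ z ≈ᴬ x ⋆ (y ⋆ z)
  ⋆-assoc x y z k = trans (⋆-lin x (λ i → U^ (toℕ i) y) z k)
    (sum-cong-≋ λ i → *-congˡ {x i} (U^-⋆ y z (toℕ i) k))

  const-⋆ : ∀ b z k → (const b ⋆ z) k ≈ b * z k
  const-⋆ b z k = begin
    sum {N} (λ i → const b i * U^ (toℕ i) z k)     ≈⟨ sum-cong-≋ {N} (λ i → *-congʳ {U^ (toℕ i) z k} (monomial-toℕ b zero i)) ⟩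
    sum {N} (λ i → single b zero i * U^ (toℕ i) z k) ≡⟨⟩
    b * z k + sum {N′} (λ i → 0# * U^ (suc (toℕ i)) z k) ≈⟨ +-congˡ (sum-zero {N′} λ i → zeroˡ (U^ (suc (toℕ i)) z k)) ⟩
    b * z k + 0#                                   ≈⟨ +-identityʳ _ ⟩
    b * z k                                        ∎

  ⋆-identityˡ : ∀ z → A.1# ⋆ z ≈ᴬ z
  ⋆-identityˡ z k = trans (const-⋆ 1# z k) (*-identityˡ _)

  ⋆-identityʳ : ∀ x → x ⋆ A.1# ≈ᴬ x
  ⋆-identityʳ x k = begin
    sum (λ i → x i * U^ (toℕ i) (monomial 1# 0) k)  ≈⟨ sum-cong-≋ (λ i → *-congˡ {x i} (powers i)) ⟩
    sum (λ i → x i * monomial 1# (toℕ i) k)         ≈⟨ sum-cong-≋ (λ i → trans (sym (monomial-* (x i) 1# (toℕ i) k))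
                                                         (monomial-cong (*-identityʳ (x i)) (toℕ i) k)) ⟩
    sum (λ i → monomial (x i) (toℕ i) k)            ≈⟨ sum-cong-≋ (λ i → monomial-toℕ (x i) i k) ⟩
    sum (λ i → single (x i) i k)                    ≈⟨ sum-single x k ⟩
    x k                                             ∎
    where
    σ^1 : ∀ n → fold 1# σ n ≈ 1#
    σ^1 zero    = refl
    σ^1 (suc n) = trans (σ.f-cong (σ^1 n)) σ.1#-homo
    powers : ∀ (i : Fin N) → U^ (toℕ i) (monomial 1# 0) k ≈ monomial 1# (toℕ i) k
    powers i = begin
      U^ (toℕ i) (monomial 1# 0) k                 ≈⟨ U^-monomial 1# 0 (toℕ i) k ⟩
      monomial (fold 1# σ (toℕ i)) (toℕ i ℕ.+ 0) k ≈⟨ monomial-cong (σ^1 (toℕ i)) (toℕ i ℕ.+ 0) k ⟩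
      monomial 1# (toℕ i ℕ.+ 0) k                  ≡⟨ ≡.cong (λ n → monomial 1# n k) (ℕ.+-comm (toℕ i) 0) ⟩
      monomial 1# (toℕ i) k                        ∎

  ⋆-distribˡ : ∀ x y z → x ⋆ (y +ᴬ z) ≈ᴬ (x ⋆ y) +ᴬ (x ⋆ z)
  ⋆-distribˡ x y z k = trans
    (sum-cong-≋ λ i → trans (*-congˡ (U^-+ y z (toℕ i) k)) (distribˡ (x i) (U^ (toℕ i) y k) (U^ (toℕ i) z k)))
    (∑-distrib-+ (λ i → x i * U^ (toℕ i) y k) (λ i → x i * U^ (toℕ i) z k))

  ⋆-distribʳ : ∀ x y z → (y +ᴬ z) ⋆ x ≈ᴬ (y ⋆ x) +ᴬ (z ⋆ x)
  ⋆-distribʳ x y z k = trans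
    (sum-cong-≋ λ i → distribʳ (U^ (toℕ i) x k) (y i) (z i))
    (∑-distrib-+ (λ i → y i * U^ (toℕ i) x k) (λ i → z i * U^ (toℕ i) x k))

  ≈ᴬ-refl : ∀ {x} → x ≈ᴬ x
  ≈ᴬ-refl _ = refl

  ≈ᴬ-sym : ∀ {x y} → x ≈ᴬ y → y ≈ᴬ x
  ≈ᴬ-sym p k = sym (p k)

  ≈ᴬ-trans : ∀ {x y z} → x ≈ᴬ y → y ≈ᴬ z → x ≈ᴬ z
  ≈ᴬ-trans p q k = trans (p k) (q k)

  isRing′ : IsRing _≈ᴬ_ _+ᴬ_ _*ᴬ_ A.-_ A.0# A.1#
  isRing′ = record
    { +-isAbelianGroup = record
      { isGroup = record
        { isMonoid = record
          { isSemigroup = record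
            { isMagma = record
              { isEquivalence = record
                { refl = λ {x} → ≈ᴬ-refl {x} ; sym = λ {x y} → ≈ᴬ-sym {x} {y}
                ; trans = λ {x y z} → ≈ᴬ-trans {x} {y} {z} }
              ; ∙-cong = λ p q k → +-cong (p k) (q k) }
            ; assoc = λ x y z k → +-assoc _ _ _ }
          ; identity = (λ x k → +-identityˡ _) , λ x k → +-identityʳ _ }
        ; inverse = (λ x k → -‿inverseˡ _) , λ x k → -‿inverseʳ _
        ; ⁻¹-cong = λ p k → -‿cong (p k) }
      ; comm = λ x y k → +-comm _ _ }
    ; *-cong = λ {x} {x′} {y} {y′} p q k → via (*≈⋆ x y) (*≈⋆ x′ y′) (⋆-cong p q) k
    ; *-assoc = λ x y z → via
        (λ k → trans (*≈⋆ (x *ᴬ y) z k) (⋆-cong {y = z} (*≈⋆ x y) (λ _ → refl) k))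
        (λ k → trans (*≈⋆ x (y *ᴬ z) k) (⋆-cong {x} (λ _ → refl) (*≈⋆ y z) k))
        (⋆-assoc x y z)
    ; *-identity = (λ x k → trans (*≈⋆ A.1# x k) (⋆-identityˡ x k))
                 , λ x k → trans (*≈⋆ x A.1# k) (⋆-identityʳ x k)
    ; distrib = (λ x y z → via (*≈⋆ x (y +ᴬ z)) (λ k → +-cong (*≈⋆ x y k) (*≈⋆ x z k)) (⋆-distribˡ x y z))
              , λ x y z → via (*≈⋆ (y +ᴬ z) x) (λ k → +-cong (*≈⋆ y x k) (*≈⋆ z x k)) (⋆-distribʳ x y z) }
    where
    via : ∀ {x x′ y y′} → x ≈ᴬ x′ → y ≈ᴬ y′ → x′ ≈ᴬ y′ → x ≈ᴬ y
    via p q r k = trans (p k) (trans (r k) (sym (q k)))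

  sumᴬ : ∀ {n} → (Fin n → Elt) → Elt
  sumᴬ = RawSemiringDefs.sum A.rawSemiring

  sumᴬ-apply : ∀ {n} (t : Fin n → Elt) k → sumᴬ t k ≡ sum (λ i → t i k)
  sumᴬ-apply {zero}  t k = ≡.refl
  sumᴬ-apply {suc n} t k = ≡.cong (t zero k +_) (sumᴬ-apply (t ∘ suc) k)

  const-* : ∀ b z → const b *ᴬ z ≈ᴬ λ k → b * z k
  const-* b z k = trans (*≈⋆ (const b) z k) (const-⋆ b z k)

  u≈U1 : u ≈ᴬ U A.1#
  u≈U1 k = trans (monomial-cong (sym σ.1#-homo) 1 k) (sym (U-monomial 1# 0 k))

  u-* : ∀ x → u *ᴬ x ≈ᴬ U x
  u-* x k = begin
    (u *ᴬ x) k        ≈⟨ *≈⋆ u x k ⟩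
    (u ⋆ x) k         ≈⟨ ⋆-cong {y = x} u≈U1 (λ _ → refl) k ⟩
    (U A.1# ⋆ x) k    ≈⟨ U-⋆ A.1# x k ⟩
    U (A.1# ⋆ x) k    ≈⟨ U-cong (⋆-identityˡ x) k ⟩
    U x k             ∎

  U^-U : ∀ y n → U^ n (U y) ≡ U (U^ n y)
  U^-U y zero    = ≡.refl
  U^-U y (suc n) = ≡.cong U (U^-U y n)

  u-*-comm : ∀ x → u *ᴬ x ≈ᴬ (σ ∘ x) *ᴬ u
  u-*-comm x k = begin
    (u *ᴬ x) k                                        ≈⟨ u-* x k ⟩
    U x k                                             ≈⟨ U-cong (⋆-identityʳ x) k ⟨
    U (x ⋆ A.1#) k                                    ≈⟨ U-lin x (λ i → U^ (toℕ i) A.1#) k ⟩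
    sum {N} (λ i → σ (x i) * U (U^ (toℕ i) A.1#) k)   ≈⟨ sum-cong-≋ {N} (λ i → *-congˡ {σ (x i)}
                                                           (reflexive (≡.cong (λ y → y k) (≡.sym (U^-U A.1# (toℕ i)))))) ⟩
    ((σ ∘ x) ⋆ U A.1#) k                              ≈⟨ ⋆-cong {σ ∘ x} (λ _ → refl) u≈U1 k ⟨
    ((σ ∘ x) ⋆ u) k                                   ≈⟨ *≈⋆ (σ ∘ x) u k ⟨
    ((σ ∘ x) *ᴬ u) k                                  ∎

  u-const : ∀ b → u *ᴬ const b ≈ᴬ const (σ b) *ᴬ u
  u-const b k = begin
    (u *ᴬ const b) k          ≈⟨ u-* (const b) k ⟩
    U (const b) k             ≈⟨ U-monomial b 0 k ⟩
    monomial (σ b) 1 k        ≈⟨ monomial-cong (*-identityʳ (σ b)) 1 k ⟨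
    monomial (σ b * 1#) 1 k   ≈⟨ monomial-* (σ b) 1# 1 k ⟩
    σ b * u k                 ≈⟨ const-* (σ b) u k ⟨
    (const (σ b) *ᴬ u) k      ∎

  u-invertible : ∀ {δ} → δ * γ ≈ 1# → AlgDefs.Invertible _≈ᴬ_ A.1# _*ᴬ_ u
  u-invertible {δ} δγ≈1 = v , v*u , u*v
    where
    w = U^ N′ A.1#
    v = const δ ⋆ w
    v≈δw : v ≈ᴬ λ k → δ * w k
    v≈δw = const-⋆ δ w
    σδγ≈1 : σ δ * γ ≈ 1#
    σδγ≈1 = trans (*-congˡ (sym σγ≈γ)) (trans (sym (σ.*-homo δ γ)) (trans (σ.f-cong δγ≈1) σ.1#-homo))
    cancel : ∀ {a} → a * γ ≈ 1# → ∀ k → a * U w k ≈ A.1# k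
    cancel {a} aγ≈1 k = begin
      a * U w k            ≈⟨ *-congˡ (U^N A.1# k) ⟩
      a * (γ * A.1# k)     ≈⟨ *-assoc a γ (A.1# k) ⟨
      a * γ * A.1# k       ≈⟨ *-congʳ aγ≈1 ⟩
      1# * A.1# k          ≈⟨ *-identityˡ _ ⟩
      A.1# k               ∎
    u*v : u *ᴬ v ≈ᴬ A.1#
    u*v k = begin
      (u *ᴬ v) k           ≈⟨ u-* v k ⟩
      U v k                ≈⟨ U-cong v≈δw k ⟩
      U (λ k → δ * w k) k  ≈⟨ U-scale δ w k ⟩
      σ δ * U w k          ≈⟨ cancel σδγ≈1 k ⟩
      A.1# k               ∎
    v*u : v *ᴬ u ≈ᴬ A.1#
    v*u k = begin
      (v *ᴬ u) k                    ≈⟨ *≈⋆ v u k ⟩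
      (const δ ⋆ w ⋆ u) k           ≈⟨ ⋆-assoc (const δ) w u k ⟩
      (const δ ⋆ (w ⋆ u)) k         ≈⟨ const-⋆ δ (w ⋆ u) k ⟩
      δ * (w ⋆ u) k                 ≈⟨ *-congˡ (U^-⋆ A.1# u N′ k) ⟩
      δ * U^ N′ (A.1# ⋆ u) k        ≈⟨ *-congˡ (U^-cong (⋆-identityˡ u) N′ k) ⟩
      δ * U^ N′ u k                 ≈⟨ *-congˡ (U^-cong u≈U1 N′ k) ⟩
      δ * U^ N′ (U A.1#) k          ≡⟨ ≡.cong (λ y → δ * y k) (U^-U A.1# N′) ⟩
      δ * U w k                     ≈⟨ cancel δγ≈1 k ⟩
      A.1# k                        ∎

  span : ∀ x → x ≈ᴬ sumᴬ (λ i → const (x i) *ᴬ U^ (toℕ i) A.1#)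
  span x k = begin
    x k                                            ≈⟨ ⋆-identityʳ x k ⟨
    (x ⋆ A.1#) k                                   ≈⟨ sum-cong-≋ {N} (λ i → const-* (x i) (U^ (toℕ i) A.1#) k) ⟨
    sum {N} (λ i → (const (x i) *ᴬ U^ (toℕ i) A.1#) k)
      ≡⟨ sumᴬ-apply (λ i → const (x i) *ᴬ U^ (toℕ i) A.1#) k ⟨
    sumᴬ (λ i → const (x i) *ᴬ U^ (toℕ i) A.1#) k  ∎

  normal : ∀ {b h} → σ b ≈ b * h → ∀ x → ∃[ y ] x *ᴬ const b ≈ᴬ const b *ᴬ y
  normal {b} {h} σb≈bh x = y , λ k → begin
    (x *ᴬ const b) k
      ≈⟨ *≈⋆ x (const b) k ⟩
    sum {N} (λ i → x i * U^ (toℕ i) (const b) k)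
      ≈⟨ sum-cong-≋ {N} (λ i → *-congˡ {x i} (powers i k)) ⟩
    sum {N} (λ i → x i * (b * t i k))
      ≈⟨ sum-cong-≋ {N} (λ i → x∙yz≈y∙xz (x i) b (t i k)) ⟩
    sum {N} (λ i → b * (x i * t i k))
      ≈⟨ *-distribˡ-sum b (λ i → x i * t i k) ⟨
    b * y k
      ≈⟨ const-* b y k ⟨
    (const b *ᴬ y) k  ∎
    where
    h^ : ℕ → Carrier
    h^ zero    = 1#
    h^ (suc n) = h * σ (h^ n)
    σ^b : ∀ n → fold b σ n ≈ b * h^ n
    σ^b zero    = sym (*-identityʳ b)
    σ^b (suc n) = trans (σ.f-cong (σ^b n)) (trans (σ.*-homo b (h^ n))
      (trans (*-congʳ σb≈bh) (*-assoc b h _)))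
    t : Fin N → Elt
    t i = monomial (h^ (toℕ i)) (toℕ i ℕ.+ 0)
    y : Elt
    y k = sum {N} (λ i → x i * t i k)
    powers : ∀ i k → U^ (toℕ i) (const b) k ≈ b * t i k
    powers i k = trans (U^-monomial b 0 (toℕ i) k)
      (trans (monomial-cong (σ^b (toℕ i)) (toℕ i ℕ.+ 0) k) (monomial-* b (h^ (toℕ i)) (toℕ i ℕ.+ 0) k))

module _ (R : CommutativeRing c ℓ)
  (σ : CommutativeRing.Carrier R → CommutativeRing.Carrier R) (γ : CommutativeRing.Carrier R)
  (N : ℕ) .{{N≢0 : NonZero N}} where
  open CommutativeRing R
  private
    module C = CyclicAlgebra rawRing σ γ N
    module A = RawRing C.cyclicAlgebra
  open RawSemiringDefs A.rawSemiring using (sum)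

  record IsCyclicAlgebra : Set (c ⊔ ℓ) where
    field
      isRing       : IsRing A._≈_ A._+_ A._*_ A.-_ A.0# A.1#
      const-*      : ∀ b z → C.const b A.* z A.≈ λ k → b * z k
      u-*-comm     : ∀ x → C.u A.* x A.≈ (σ ∘ x) A.* C.u
      u-const      : ∀ b → C.u A.* C.const b A.≈ C.const (σ b) A.* C.u
      u-invertible : ∀ {δ} → δ * γ ≈ 1# → AlgDefs.Invertible A._≈_ A.1# A._*_ C.u
      span         : ∃ λ (e : Fin N → C.Elt) → ∀ x → x A.≈ sum (λ i → C.const (x i) A.* e i)
      normal       : ∀ {b h} → σ b ≈ b * h → ∀ x → ∃[ y ] x A.* C.const b A.≈ C.const b A.* y

isCyclicAlgebra : (R : CommutativeRing c ℓ) → let open CommutativeRing R in ∀ {σ} →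
  IsRingHomomorphism rawRing rawRing σ → ∀ {γ} N .{{_ : NonZero N}} → σ γ ≈ γ →
  (∀ b → fold b σ N ≈ b) → IsCyclicAlgebra R σ γ N
isCyclicAlgebra R {σ} σ-isHom {γ} (suc N′) σγ≈γ σᴺ≈id = record
  { isRing = M.isRing′ ; const-* = M.const-* ; u-*-comm = M.u-*-comm ; u-const = M.u-const
  ; u-invertible = M.u-invertible ; span = (λ i → M.U^ (toℕ i) M.A.1#) , M.span ; normal = M.normal }
  where module M = CyclicAlgebraRing R σ σ-isHom γ N′ σγ≈γ σᴺ≈id

module Nakayama (A : CommutativeRing c ℓ) (D : Ring c′ ℓ′)
  (φ : CommutativeRing.Carrier A → Ring.Carrier D)
  (φ-isHom : IsRingHomomorphism (CommutativeRing.rawRing A) (Ring.rawRing D) φ)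
  (ϖ : CommutativeRing.Carrier A) where
  open Ring D hiding (zero)
  open RingProps D
  open SetoidReasoning setoid
  open SemiringSum semiring using (sum; *-distribˡ-sum; sum-cong-≋)
  open Invertibility D
  private
    module A = CommutativeRing A
    module φ = RingHom.Properties A.ring D φ φ-isHom

  record IsSubmodule (N : Carrier → Set ι) : Set (c ⊔ c′ ⊔ ℓ′ ⊔ ι) where
    field
      resp     : ∀ {x y} → x ≈ y → N x → N y
      0∈       : N 0#
      +-closed : ∀ {x y} → N x → N y → N (x + y)
      φ-closed : ∀ a {x} → N x → N (φ a * x)

  module _ {N : Carrier → Set ι} (isSub : IsSubmodule N) where
    open IsSubmodule isSub

    sum-closed : ∀ {n} (t : Fin n → Carrier) → (∀ i → N (t i)) → N (sum t)
    sum-closed {zero}  t t∈ = 0∈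
    sum-closed {suc n} t t∈ = +-closed (t∈ zero) (sum-closed (t ∘ suc) (t∈ ∘ suc))

    -‿+-closed : ∀ {x y u v} → N (x - y) → N (u - v) → N ((x + u) - (y + v))
    -‿+-closed {x} {y} {u} {v} p q =
      resp (trans (interchange x (- y) u (- v)) (+-congˡ (-‿+-comm y v))) (+-closed p q)
      where open CommutativeSemigroupProps +-commutativeSemigroup using (interchange)

    φ-‿-closed : ∀ a {x y} → N (x - y) → N (φ a * x - φ a * y)
    φ-‿-closed a {x} {y} p = resp (x[y-z]≈xy-xz (φ a) x y) (φ-closed a p)

    -‿resp : ∀ {x y y′} → y ≈ y′ → N (x - y) → N (x - y′)
    -‿resp eq = resp (+-congˡ (-‿cong eq))

    _+⟨_⟩ : Carrier → Carrier → Set (c ⊔ ι)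
    _+⟨_⟩ e x = ∃[ a ] N (x - φ a * e)

    +⟨⟩-isSubmodule : ∀ e → IsSubmodule (e +⟨_⟩)
    +⟨⟩-isSubmodule e = record
      { resp     = λ eq (a , p) → a , resp (+-congʳ eq) p
      ; 0∈       = A.0# , resp (sym (trans (+-congˡ (-‿cong (trans (*-congʳ φ.0#-homo) (zeroˡ e)))) (-‿inverseʳ 0#))) 0∈
      ; +-closed = λ (a , p) (b , q) → a A.+ b ,
          -‿resp (trans (sym (distribʳ e (φ a) (φ b))) (*-congʳ (sym (φ.+-homo a b)))) (-‿+-closed p q)
      ; φ-closed = λ a (b , p) → a A.* b ,
          -‿resp (trans (sym (*-assoc _ _ e)) (*-congʳ (sym (φ.*-homo a b)))) (φ-‿-closed a p) }

    combination : ∀ {n} e (y : Fin n → Carrier) → (∀ i → e +⟨ y i ⟩) → (b : Fin n → A.Carrier) →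
      ∃[ t ] N (sum (λ j → φ (ϖ A.* b j) * y j) - φ (ϖ A.* t) * e)
    combination {zero} e y y∈ b = A.0# ,
      resp (sym (trans (+-congˡ (-‿cong (trans (*-congʳ (trans (φ.f-cong (A.zeroʳ ϖ)) φ.0#-homo)) (zeroˡ e))))
                       (-‿inverseʳ 0#))) 0∈
    combination {suc n} e y y∈ b with y∈ zero | combination e (y ∘ suc) (y∈ ∘ suc) (b ∘ suc)
    ... | a , p | t , q = b zero A.* a A.+ t ,
      -‿resp eq (-‿+-closed (φ-‿-closed (ϖ A.* b zero) p) q)
      where
      eq : φ (ϖ A.* b zero) * (φ a * e) + φ (ϖ A.* t) * e ≈ φ (ϖ A.* (b zero A.* a A.+ t)) * e
      eq = begin
        φ (ϖ A.* b zero) * (φ a * e) + φ (ϖ A.* t) * e   ≈⟨ +-congʳ (*-assoc _ _ e) ⟨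
        φ (ϖ A.* b zero) * φ a * e + φ (ϖ A.* t) * e     ≈⟨ distribʳ e _ _ ⟨
        (φ (ϖ A.* b zero) * φ a + φ (ϖ A.* t)) * e       ≈⟨ *-congʳ (+-congʳ (φ.*-homo _ a)) ⟨
        (φ (ϖ A.* b zero A.* a) + φ (ϖ A.* t)) * e       ≈⟨ *-congʳ (φ.+-homo _ _) ⟨
        φ (ϖ A.* b zero A.* a A.+ ϖ A.* t) * e           ≈⟨ *-congʳ (φ.f-cong (A.+-congʳ (A.*-assoc ϖ _ a))) ⟩
        φ (ϖ A.* (b zero A.* a) A.+ ϖ A.* t) * e         ≈⟨ *-congʳ (φ.f-cong (A.distribˡ ϖ _ t)) ⟨
        φ (ϖ A.* (b zero A.* a A.+ t)) * e               ∎

  module _ (1-ϖa-invertible : ∀ a → ∃[ b ] b A.* (A.1# A.- ϖ A.* a) A.≈ A.1#) where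

    -- The generators are eliminated one at a time, the first being absorbed into N.
    nakayama : ∀ {n} (e : Fin n → Carrier) {N : Carrier → Set ι} → IsSubmodule N →
      (∀ i → ∃ λ (b : Fin n → A.Carrier) → N (e i - sum (λ j → φ (ϖ A.* b j) * e j))) → ∀ i → N (e i)
    nakayama {n = suc n} e {N} isSub e∈ = λ { zero → e₀∈ ; (suc i) → rest i }
      where
      open IsSubmodule isSub
      e₀ = e zero
      x-[y+s]≈x-s-y : ∀ x y s → x - (y + s) ≈ (x - s) - y
      x-[y+s]≈x-s-y x y s = begin
        x - (y + s)      ≈⟨ +-congˡ (-‿cong (+-comm y s)) ⟩
        x - (s + y)      ≈⟨ +-congˡ (-‿+-comm s y) ⟨
        x + (- s - y)    ≈⟨ +-assoc x (- s) (- y) ⟨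
        (x - s) - y      ∎
      modulo-e₀ : ∀ i → _+⟨_⟩ isSub e₀ (e (suc i))
      modulo-e₀ = nakayama (e ∘ suc) (+⟨⟩-isSubmodule isSub e₀) λ i →
        let b , p = e∈ (suc i) in
        b ∘ suc , ϖ A.* b zero , resp (x-[y+s]≈x-s-y _ _ _) p
      e₀∈ : N e₀
      e₀∈ with e∈ zero
      ... | b , p with combination isSub e₀ (e ∘ suc) modulo-e₀ (b ∘ suc)
      ... | t , q with 1-ϖa-invertible (b zero A.+ t)
      ... | a , inv = resp cancel (φ-closed a (resp collect (+-closed (resp (x-[y+s]≈x-s-y _ _ _) (resp (+-congˡ (-‿cong (+-comm _ _))) p)) q)))
        where
        S = sum (λ j → φ (ϖ A.* b (suc j)) * e (suc j))
        collect : (e₀ - φ (ϖ A.* b zero) * e₀ - S) + (S - φ (ϖ A.* t) * e₀) ≈ φ (A.1# A.- ϖ A.* (b zero A.+ t)) * e₀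
        collect = begin
          (e₀ - φ (ϖ A.* b zero) * e₀ - S) + (S - φ (ϖ A.* t) * e₀)    ≈⟨ [x-y]+[y-z]≈x-z _ S _ ⟩
          e₀ - φ (ϖ A.* b zero) * e₀ - φ (ϖ A.* t) * e₀                ≈⟨ x-[y+s]≈x-s-y e₀ _ _ ⟨
          e₀ - (φ (ϖ A.* t) * e₀ + φ (ϖ A.* b zero) * e₀)              ≈⟨ +-congˡ (-‿cong (+-comm _ _)) ⟩
          e₀ - (φ (ϖ A.* b zero) * e₀ + φ (ϖ A.* t) * e₀)              ≈⟨ +-congˡ (-‿cong (distribʳ e₀ _ _)) ⟨
          e₀ - (φ (ϖ A.* b zero) + φ (ϖ A.* t)) * e₀                   ≈⟨ +-congˡ (-‿cong (*-congʳ (φ.+-homo _ _))) ⟨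
          e₀ - φ (ϖ A.* b zero A.+ ϖ A.* t) * e₀                       ≈⟨ +-congˡ (-‿cong (*-congʳ (φ.f-cong (A.distribˡ ϖ _ t)))) ⟨
          e₀ - φ (ϖ A.* (b zero A.+ t)) * e₀                           ≈⟨ [1-y]x≈x-yx e₀ _ ⟨
          (1# - φ (ϖ A.* (b zero A.+ t))) * e₀                         ≈⟨ *-congʳ (+-congʳ φ.1#-homo) ⟨
          (φ A.1# - φ (ϖ A.* (b zero A.+ t))) * e₀                     ≈⟨ *-congʳ (φ.minus-homo _ _) ⟨
          φ (A.1# A.- ϖ A.* (b zero A.+ t)) * e₀                       ∎
        cancel : φ a * (φ (A.1# A.- ϖ A.* (b zero A.+ t)) * e₀) ≈ e₀
        cancel = begin
          φ a * (φ (A.1# A.- ϖ A.* (b zero A.+ t)) * e₀)    ≈⟨ *-assoc _ _ e₀ ⟨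
          φ a * φ (A.1# A.- ϖ A.* (b zero A.+ t)) * e₀      ≈⟨ *-congʳ (φ.*-homo a _) ⟨
          φ (a A.* (A.1# A.- ϖ A.* (b zero A.+ t))) * e₀    ≈⟨ *-congʳ (trans (φ.f-cong inv) φ.1#-homo) ⟩
          1# * e₀                                           ≈⟨ *-identityˡ e₀ ⟩
          e₀                                                ∎
      rest : ∀ i → N (e (suc i))
      rest i = let a , p = modulo-e₀ i in
        resp (//-rightDividesˡ (φ a * e₀) (e (suc i))) (+-closed p (φ-closed a e₀∈))

    module _ {n} (e : Fin n → Carrier) (span : ∀ x → ∃ λ (b : Fin n → A.Carrier) → x ≈ sum (λ i → φ (b i) * e i))
      (central : ∀ x → φ ϖ * x ≈ x * φ ϖ) where

      left-inverse : ∀ v → ∃[ y ] y * (1# - φ ϖ * v) ≈ 1#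
      left-inverse v = let y , p = 1∈ in y , sym p
        where
        w = 1# - φ ϖ * v
        N : Carrier → Set (c′ ⊔ ℓ′)
        N x = ∃[ y ] x ≈ y * w
        isSub : IsSubmodule N
        isSub = record
          { resp     = λ eq (y , p) → y , trans (sym eq) p
          ; 0∈       = 0# , sym (zeroˡ w)
          ; +-closed = λ (y , p) (z , q) → y + z , trans (+-cong p q) (sym (distribʳ w y z))
          ; φ-closed = λ a (y , p) → φ a * y , trans (*-congˡ p) (sym (*-assoc _ y w)) }
        e∈ : ∀ i → N (e i)
        e∈ = nakayama e isSub λ i → let b , p = span (e i * v) in
          b , e i , (begin
            e i - sum (λ j → φ (ϖ A.* b j) * e j)      ≈⟨ +-congˡ (-‿cong (sum-cong-≋ λ j →
                                                            trans (*-congʳ (φ.*-homo ϖ (b j))) (*-assoc _ _ (e j)))) ⟩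
            e i - sum (λ j → φ ϖ * (φ (b j) * e j))    ≈⟨ +-congˡ (-‿cong (*-distribˡ-sum (φ ϖ) λ j → φ (b j) * e j)) ⟨
            e i - φ ϖ * sum (λ j → φ (b j) * e j)      ≈⟨ +-congˡ (-‿cong (*-congˡ p)) ⟨
            e i - φ ϖ * (e i * v)                      ≈⟨ +-congˡ (-‿cong (trans (sym (*-assoc _ _ v))
                                                            (trans (*-congʳ (central (e i))) (*-assoc _ _ v)))) ⟩
            e i - e i * (φ ϖ * v)                      ≈⟨ x[1-y]≈x-xy (e i) _ ⟨
            e i * w                                    ∎)
        1∈ : N 1#
        1∈ = let b , p = span 1# in
          IsSubmodule.resp isSub (sym p) (sum-closed isSub _ λ i → IsSubmodule.φ-closed isSub (b i) (e∈ i))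

      1-ϖv-unit : ∀ v → IsUnit (1# - φ ϖ * v)
      1-ϖv-unit v with left-inverse v
      ... | y , yw≈1 with left-inverse (- (y * v))
      ... | z , zy′≈1 = inverses⇒unit yw≈1 (begin
          w * y            ≈⟨ *-congʳ (trans (sym (*-identityˡ w)) (*-congʳ (sym zy≈1))) ⟩
          z * y * w * y    ≈⟨ *-congʳ (trans (*-assoc z y w) (trans (*-congˡ yw≈1) (*-identityʳ z))) ⟩
          z * y            ≈⟨ zy≈1 ⟩
          1#               ∎)
        where
        w = 1# - φ ϖ * v
        y≈1-ϖ[-yv] : y ≈ 1# - φ ϖ * (- (y * v))
        y≈1-ϖ[-yv] = begin
          y                                     ≈⟨ //-rightDividesˡ (y * (φ ϖ * v)) y ⟨
          y - y * (φ ϖ * v) + y * (φ ϖ * v)     ≈⟨ +-congʳ (x[1-y]≈x-xy y _) ⟨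
          y * w + y * (φ ϖ * v)                 ≈⟨ +-cong yw≈1 (trans (sym (*-assoc y _ v))
                                                     (trans (*-congʳ (sym (central y))) (*-assoc _ y v))) ⟩
          1# + φ ϖ * (y * v)                    ≈⟨ +-congˡ (-‿involutive _) ⟨
          1# - - (φ ϖ * (y * v))                ≈⟨ +-congˡ (-‿cong (-‿distribʳ-* _ _)) ⟩
          1# - φ ϖ * (- (y * v))                ∎
        zy≈1 : z * y ≈ 1#
        zy≈1 = trans (*-congˡ y≈1-ϖ[-yv]) zy′≈1

absorption : ∀ n k → suc k ℕ.* (suc n C suc k) ≡ suc n ℕ.* (n C k)
absorption n       zero    = ≡.trans (ℕ.*-identityˡ _) (≡.trans (nC1≡n (suc n)) (≡.sym (ℕ.*-identityʳ (suc n))))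
absorption zero    (suc k) = ℕ.*-zeroʳ (suc (suc k))
absorption (suc n) (suc k) = begin
  suc (suc k) ℕ.* (suc (suc n) C suc (suc k))
    ≡⟨ ≡.cong (suc (suc k) ℕ.*_) (nCk+nC[k+1]≡[n+1]C[k+1] (suc n) (suc k)) ⟨
  suc (suc k) ℕ.* (suc n C suc k ℕ.+ suc n C suc (suc k))
    ≡⟨ split k (suc n C suc k) (suc n C suc (suc k)) ⟩
  suc n C suc k ℕ.+ (suc k ℕ.* (suc n C suc k) ℕ.+ suc (suc k) ℕ.* (suc n C suc (suc k)))
    ≡⟨ ≡.cong (suc n C suc k ℕ.+_) (≡.cong₂ ℕ._+_ (absorption n k) (absorption n (suc k))) ⟩
  suc n C suc k ℕ.+ (suc n ℕ.* (n C k) ℕ.+ suc n ℕ.* (n C suc k))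
    ≡⟨ ≡.cong (suc n C suc k ℕ.+_) (ℕ.*-distribˡ-+ (suc n) (n C k) (n C suc k)) ⟨
  suc n C suc k ℕ.+ suc n ℕ.* (n C k ℕ.+ n C suc k)
    ≡⟨ ≡.cong (λ c → suc n C suc k ℕ.+ suc n ℕ.* c) (nCk+nC[k+1]≡[n+1]C[k+1] n k) ⟩
  suc (suc n) ℕ.* (suc n C suc k)  ∎
  where
  open ≡.≡-Reasoning
  split : ∀ k a b → suc (suc k) ℕ.* (a ℕ.+ b) ≡ a ℕ.+ (suc k ℕ.* a ℕ.+ suc (suc k) ℕ.* b)
  split = ℕSolver.solve-∀

prime∣binomial : ∀ {p k} → Prime p → suc k ℕ.< p → p ∣ p C suc k
prime∣binomial {p@(suc n)} {k} p-prime 1+k<p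
  with euclidsLemma (suc k) (p C suc k) p-prime (≡.subst (p ∣_) (≡.sym (absorption n k)) (m∣m*n (n C k)))
... | inj₁ p∣1+k = contradiction (∣⇒≤ p∣1+k) (ℕ.<⇒≱ 1+k<p)
... | inj₂ p∣C   = p∣C

triangle : ℕ → ℕ
triangle zero    = 0
triangle (suc n) = triangle n ℕ.+ n

2*triangle : ∀ n → 2 ℕ.* triangle (suc n) ≡ suc n ℕ.* n
2*triangle zero    = ≡.refl
2*triangle (suc n) = ≡.trans (step (triangle (suc n)) n) (≡.trans (≡.cong (ℕ._+ 2 ℕ.* suc n) (2*triangle n)) (finish n))
  where
  step : ∀ t n → 2 ℕ.* (t ℕ.+ suc n) ≡ 2 ℕ.* t ℕ.+ 2 ℕ.* suc n
  step = ℕSolver.solve-∀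
  finish : ∀ n → suc n ℕ.* n ℕ.+ 2 ℕ.* suc n ≡ suc (suc n) ℕ.* suc n
  finish = ℕSolver.solve-∀

oddPrime∣triangle : ∀ {p} → Prime p → p ≢ 2 → p ∣ triangle p
oddPrime∣triangle {p@(suc n)} p-prime p≢2
  with euclidsLemma 2 (triangle p) p-prime (≡.subst (p ∣_) (≡.sym (2*triangle n)) (m∣m*n n))
... | inj₁ p∣2 = contradiction (ℕ.≤-antisym (∣⇒≤ p∣2) (ℕ.nonTrivial⇒n>1 p {{prime⇒nonTrivial p-prime}})) p≢2
... | inj₂ p∣t = p∣t

module Expansion (S : CommutativeSemiring c ℓ) where
  open CommutativeSemiring S hiding (zero)
  open SemiringExp semiring using (_^_)
  open SemiringMult semiring using () renaming (_×_ to _·_)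
  open SetoidReasoning setoid
  open CommutativeSemigroupProps +-commutativeSemigroup using (x∙yz≈y∙xz)

  [1+y]^ : ∀ n y → ∃[ k ] (1# + y) ^ n ≈ 1# + (n · y + y * (y * k))
  [1+y]^ zero    y = 0# , sym (trans (+-congˡ (trans (+-identityˡ _) (trans (*-congˡ (zeroʳ y)) (zeroʳ y)))) (+-identityʳ 1#))
  [1+y]^ (suc n) y with [1+y]^ n y
  ... | k , eq = n · 1# + (k + y * k) , (begin
    (1# + y) * (1# + y) ^ n                                          ≈⟨ *-congˡ eq ⟩
    (1# + y) * (1# + (n · y + y * (y * k)))                          ≈⟨ distribʳ _ 1# y ⟩
    1# * (1# + (n · y + y * (y * k))) + y * (1# + (n · y + y * (y * k)))
      ≈⟨ +-cong (*-identityˡ _) (trans (distribˡ y _ _) (+-cong (*-identityʳ y) (distribˡ y _ _))) ⟩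
    1# + (n · y + y * (y * k)) + (y + (y * n · y + y * (y * (y * k))))
      ≈⟨ +-assoc _ _ _ ⟩
    1# + (n · y + y * (y * k) + (y + (y * n · y + y * (y * (y * k)))))
      ≈⟨ +-congˡ (x∙yz≈y∙xz _ _ _) ⟩
    1# + (y + (n · y + y * (y * k) + (y * n · y + y * (y * (y * k)))))
      ≈⟨ +-congˡ (+-congˡ (trans (+-assoc _ _ _) (+-congˡ (x∙yz≈y∙xz _ _ _)))) ⟩
    1# + (y + (n · y + (y * n · y + (y * (y * k) + y * (y * (y * k))))))
      ≈⟨ +-congˡ (+-assoc y _ _) ⟨
    1# + (suc n · y + (y * n · y + (y * (y * k) + y * (y * (y * k)))))
      ≈⟨ +-congˡ (+-congˡ (+-cong (*-congˡ (n·y n)) (trans (sym (distribˡ y _ _)) (*-congˡ (sym (distribˡ y _ _)))))) ⟩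
    1# + (suc n · y + (y * (y * n · 1#) + y * (y * (k + y * k))))
      ≈⟨ +-congˡ (+-congˡ (trans (sym (distribˡ y _ _)) (*-congˡ (sym (distribˡ y _ _))))) ⟩
    1# + (suc n · y + y * (y * (n · 1# + (k + y * k))))              ∎)
    where
    n·y : ∀ n → n · y ≈ y * n · 1#
    n·y zero    = sym (zeroʳ y)
    n·y (suc n) = trans (+-cong (sym (*-identityʳ y)) (n·y n)) (sym (distribˡ y _ _))

module Expansionℕ = Expansion ℕ.+-*-commutativeSemiring

ℕ-^ : ∀ x n → SemiringExp._^_ ℕ.+-*-semiring x n ≡ x ℕ.^ n
ℕ-^ x zero    = ≡.refl
ℕ-^ x (suc n) = ≡.cong (x ℕ.*_) (ℕ-^ x n)

ℕ-× : ∀ n x → SemiringMult._×_ ℕ.+-*-semiring n x ≡ n ℕ.* x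
ℕ-× zero    x = ≡.refl
ℕ-× (suc n) x = ≡.cong (x ℕ.+_) (ℕ-× n x)

[1+y]^ℕ : ∀ n y → ∃[ k ] (1 ℕ.+ y) ℕ.^ n ≡ 1 ℕ.+ (n ℕ.* y ℕ.+ y ℕ.* (y ℕ.* k))
[1+y]^ℕ n y with Expansionℕ.[1+y]^ n y
... | k , eq = k , ≡.trans (≡.sym (ℕ-^ (1 ℕ.+ y) n)) (≡.trans eq (≡.cong (λ z → 1 ℕ.+ (z ℕ.+ y ℕ.* (y ℕ.* k))) (ℕ-× n y)))

[1+p^r]^p^s : ∀ p r s → ∃[ t ] (1 ℕ.+ p ℕ.^ suc r) ℕ.^ (p ℕ.^ s) ≡ 1 ℕ.+ t ℕ.* p ℕ.^ (suc r ℕ.+ s)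
[1+p^r]^p^s p r zero    = 1 , ≡.cong suc (≡.trans (ℕ.*-identityʳ _)
  (≡.trans (≡.cong (p ℕ.^_) (≡.sym (ℕ.+-identityʳ (suc r)))) (≡.sym (ℕ.*-identityˡ _))))
[1+p^r]^p^s p r (suc s) with [1+p^r]^p^s p r s
... | t , eq with [1+y]^ℕ p (t ℕ.* p ℕ.^ (suc r ℕ.+ s))
... | k , eq′ = t ℕ.+ t ℕ.* (p ℕ.^ (r ℕ.+ s) ℕ.* (t ℕ.* k)) , (begin
  (1 ℕ.+ p ℕ.^ suc r) ℕ.^ (p ℕ.* p ℕ.^ s)           ≡⟨ ≡.cong ((1 ℕ.+ p ℕ.^ suc r) ℕ.^_) (ℕ.*-comm p (p ℕ.^ s)) ⟩
  (1 ℕ.+ p ℕ.^ suc r) ℕ.^ (p ℕ.^ s ℕ.* p)           ≡⟨ ℕ.^-*-assoc (1 ℕ.+ p ℕ.^ suc r) (p ℕ.^ s) p ⟨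
  ((1 ℕ.+ p ℕ.^ suc r) ℕ.^ (p ℕ.^ s)) ℕ.^ p         ≡⟨ ≡.cong (ℕ._^ p) eq ⟩
  (1 ℕ.+ t ℕ.* p ℕ.^ (suc r ℕ.+ s)) ℕ.^ p           ≡⟨ eq′ ⟩
  1 ℕ.+ (p ℕ.* (t ℕ.* (p ℕ.* P)) ℕ.+ t ℕ.* (p ℕ.* P) ℕ.* (t ℕ.* (p ℕ.* P) ℕ.* k))
                                                    ≡⟨ rearrange p t P k ⟩
  1 ℕ.+ (t ℕ.+ t ℕ.* (P ℕ.* (t ℕ.* k))) ℕ.* (p ℕ.* (p ℕ.* P))
                                                    ≡⟨ ≡.cong (λ e → 1 ℕ.+ (t ℕ.+ t ℕ.* (P ℕ.* (t ℕ.* k))) ℕ.* (p ℕ.* p ℕ.^ e)) (ℕ.+-suc r s) ⟨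
  1 ℕ.+ (t ℕ.+ t ℕ.* (P ℕ.* (t ℕ.* k))) ℕ.* (p ℕ.* p ℕ.^ (r ℕ.+ suc s))  ∎)
  where
  open ≡.≡-Reasoning
  P = p ℕ.^ (r ℕ.+ s)
  rearrange : ∀ p t P k → 1 ℕ.+ (p ℕ.* (t ℕ.* (p ℕ.* P)) ℕ.+ t ℕ.* (p ℕ.* P) ℕ.* (t ℕ.* (p ℕ.* P) ℕ.* k))
    ≡ 1 ℕ.+ (t ℕ.+ t ℕ.* (P ℕ.* (t ℕ.* k))) ℕ.* (p ℕ.* (p ℕ.* P))
  rearrange = ℕSolver.solve-∀

module Frobenius (R : CommutativeRing c ℓ) {p : ℕ} (p-prime : Prime p) where
  open CommutativeRing R hiding (zero)
  open SemiringExp semiring using (_^_; ^-congˡ; ^-assocʳ)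
  open SemiringMult semiring using (×-congʳ; ×-assocˡ; ×-assoc-*) renaming (_×_ to _·_)
  open SemiringSum semiring using (sum; sum-cong-≋; sum-replicate-zero; sum-init-last)
  open Binomial commutativeSemiring using (binomialTerm; theorem)
  open SetoidReasoning setoid

  p∣n⇒n·x≈0 : p · 1# ≈ 0# → ∀ {n} → p ∣ n → ∀ x → n · x ≈ 0#
  p∣n⇒n·x≈0 p≈0 (divides m ≡.refl) x = begin
    (m ℕ.* p) · x      ≈⟨ ×-assocˡ x m p ⟨
    m · (p · x)        ≈⟨ ×-congʳ m (×-congʳ p (*-identityˡ x)) ⟨
    m · (p · (1# * x)) ≈⟨ ×-congʳ m (×-assoc-* p 1# x) ⟨
    m · (p · 1# * x)   ≈⟨ ×-congʳ m (trans (*-congʳ p≈0) (zeroˡ x)) ⟩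
    m · 0#             ≈⟨ m·0 m ⟩
    0#                 ∎
    where
    m·0 : ∀ m → m · 0# ≈ 0#
    m·0 zero    = refl
    m·0 (suc m) = trans (+-identityˡ _) (m·0 m)

  [x+y]^p : p · 1# ≈ 0# → ∀ x y → (x + y) ^ p ≈ x ^ p + y ^ p
  [x+y]^p p≈0 x y = main p ≡.refl
    where
    main : ∀ n → p ≡ n → (x + y) ^ n ≈ x ^ n + y ^ n
    main zero    ≡.refl with () ← prime⇒nonZero p-prime
    main (suc n) ≡.refl = begin
      (x + y) ^ p                              ≈⟨ theorem p x y ⟩
      1 · (1# * y ^ p) + sum {p} (λ k → term (suc k))
        ≈⟨ +-cong (trans (+-identityʳ _) (*-identityˡ _)) (sum-init-last (λ k → term (suc k))) ⟩
      y ^ p + (sum {n} (λ k → term (suc (inject₁ k))) + term (fromℕ p))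
        ≈⟨ +-congˡ (+-cong (trans (sum-cong-≋ {n} middle) (sum-replicate-zero n)) top) ⟩
      y ^ p + (0# + x ^ p)                     ≈⟨ +-congˡ (+-identityˡ _) ⟩
      y ^ p + x ^ p                            ≈⟨ +-comm _ _ ⟩
      x ^ p + y ^ p                            ∎
      where
      term = binomialTerm x y p
      middle : ∀ k → term (suc (inject₁ k)) ≈ 0#
      middle k = p∣n⇒n·x≈0 p≈0 (prime∣binomial p-prime
        (ℕ.s≤s (≡.subst (ℕ._< n) (≡.sym (toℕ-inject₁ k)) (toℕ<n k)))) _
      top : term (fromℕ p) ≈ x ^ p
      top = begin
        (p C toℕ (fromℕ p)) · (x ^ toℕ (fromℕ p) * y ^ (p ℕ.∸ toℕ (fromℕ p)))
          ≡⟨ ≡.cong (λ k → (p C k) · (x ^ k * y ^ (p ℕ.∸ k))) (toℕ-fromℕ p) ⟩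
        (p C p) · (x ^ p * y ^ (p ℕ.∸ p))
          ≡⟨ ≡.cong₂ (λ a b → a · (x ^ p * y ^ b)) (nCn≡1 p) (ℕ.n∸n≡0 p) ⟩
        1 · (x ^ p * 1#)    ≈⟨ trans (+-identityʳ _) (*-identityʳ _) ⟩
        x ^ p               ∎

  [x+y]^p^j : p · 1# ≈ 0# → ∀ x y j → (x + y) ^ (p ℕ.^ j) ≈ x ^ (p ℕ.^ j) + y ^ (p ℕ.^ j)
  [x+y]^p^j p≈0 x y zero    = trans (*-identityʳ _) (+-cong (sym (*-identityʳ x)) (sym (*-identityʳ y)))
  [x+y]^p^j p≈0 x y (suc j) = begin
    (x + y) ^ (p ℕ.* p ℕ.^ j)                     ≈⟨ ^-assocʳ (x + y) p (p ℕ.^ j) ⟨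
    ((x + y) ^ p) ^ (p ℕ.^ j)                     ≈⟨ ^-congˡ (p ℕ.^ j) ([x+y]^p p≈0 x y) ⟩
    (x ^ p + y ^ p) ^ (p ℕ.^ j)                   ≈⟨ [x+y]^p^j p≈0 (x ^ p) (y ^ p) j ⟩
    (x ^ p) ^ (p ℕ.^ j) + (y ^ p) ^ (p ℕ.^ j)     ≈⟨ +-cong (^-assocʳ x p _) (^-assocʳ y p _) ⟩
    x ^ (p ℕ.* p ℕ.^ j) + y ^ (p ℕ.* p ℕ.^ j)     ∎

CyclotomicRelation : (S : CommutativeRing c ℓ) → ℕ → CommutativeRing.Carrier S → ℕ → Set ℓ
CyclotomicRelation S p X m = sum {p} (λ i → X ^ (toℕ i ℕ.* p ℕ.^ m)) ≈ 0#
  where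
  open CommutativeRing S
  open SemiringExp semiring using (_^_)
  open SemiringSum semiring using (sum)

-- S and X stand for 𝔒[ζ] and ζ, a primitive p^(m+1)-th root of unity.
module Cyclotomic (S : CommutativeRing c ℓ) {p : ℕ} (p-prime : Prime p) (p≢2 : p ≢ 2)
  (X : CommutativeRing.Carrier S) (m : ℕ)
  (Φ≈0 : CyclotomicRelation S p X m) where
  open CommutativeRing S hiding (zero)
  open SemiringExp semiring using (_^_; ^-congˡ; ^-assocʳ; ^-congʳ; ^-homo-*)
  open SemiringMult semiring using (×-congʳ; ×-comm-*) renaming (_×_ to _·_)
  open SemiringSum semiring using (sum; sum-cong-≋; *-distribˡ-sum)
  open RingProps ring
  private module ≈-R = SetoidReasoning setoid
  open Invertibility ring
  open CommutativeSemiringExp commutativeSemiring using (^-distrib-*)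
  open CommutativeSemigroupProps *-commutativeSemigroup using (x∙yz≈y∙zx; x∙yz≈y∙xz; x∙yz≈yx∙z)

  Π ϖ Y : Carrier
  Π = 1# - X
  ϖ = p · 1#
  Y = X ^ (p ℕ.^ m)

  module Mod (f : Carrier) where
    open PrincipalIdeal S f public
    open Q public using (_≋_; ≈⇒≋; ≋0⇒I; module π)
    module Q′ = CommutativeRing quotientCommutativeRing
    module ≋-R = SetoidReasoning Q′.setoid

  sum-powers : ∀ n y → sum {n} (λ i → y ^ toℕ i) ≈ geometric y n
  sum-powers zero    y = refl
  sum-powers (suc n) y = +-congˡ (trans (sym (*-distribˡ-sum {n} y (λ i → y ^ toℕ i))) (*-congˡ (sum-powers n y)))

  geometric-Y≈0 : geometric Y p ≈ 0#
  geometric-Y≈0 = begin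
    geometric Y p                        ≈⟨ sum-powers p Y ⟨
    sum {p} (λ i → Y ^ toℕ i)            ≈⟨ sum-cong-≋ {p} (λ i → trans (^-assocʳ X (p ℕ.^ m) (toℕ i))
                                              (^-congʳ X (ℕ.*-comm (p ℕ.^ m) (toℕ i)))) ⟩
    sum {p} (λ i → X ^ (toℕ i ℕ.* p ℕ.^ m)) ≈⟨ Φ≈0 ⟩
    0#                                   ∎
    where open ≈-R

  1^q : ∀ q → 1# ^ q ≈ 1#
  1^q zero    = refl
  1^q (suc q) = trans (*-identityˡ _) (1^q q)

  X^p^1+m≈1 : X ^ (p ℕ.^ suc m) ≈ 1#
  X^p^1+m≈1 = begin
    X ^ (p ℕ.* p ℕ.^ m)    ≈⟨ ^-congʳ X (ℕ.*-comm p (p ℕ.^ m)) ⟩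
    X ^ (p ℕ.^ m ℕ.* p)    ≈⟨ ^-assocʳ X (p ℕ.^ m) p ⟨
    Y ^ p                  ≈⟨ x∙y⁻¹≈ε⇒x≈y 1# (Y ^ p) (trans (sym (*-geometric Y p)) (trans (*-congˡ geometric-Y≈0) (zeroʳ _))) ⟨
    1#                     ∎
    where open ≈-R

  X^-periodic : ∀ k t → X ^ (k ℕ.+ t ℕ.* p ℕ.^ suc m) ≈ X ^ k
  X^-periodic k t = begin
    X ^ (k ℕ.+ t ℕ.* p ℕ.^ suc m)     ≈⟨ ^-homo-* X k (t ℕ.* p ℕ.^ suc m) ⟩
    X ^ k * X ^ (t ℕ.* p ℕ.^ suc m)   ≈⟨ *-congˡ (^-congʳ X (ℕ.*-comm t (p ℕ.^ suc m))) ⟩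
    X ^ k * X ^ (p ℕ.^ suc m ℕ.* t)   ≈⟨ *-congˡ (^-assocʳ X (p ℕ.^ suc m) t) ⟨
    X ^ k * (X ^ (p ℕ.^ suc m)) ^ t   ≈⟨ *-congˡ (trans (^-congˡ t X^p^1+m≈1) (1^q t)) ⟩
    X ^ k * 1#                        ≈⟨ *-identityʳ _ ⟩
    X ^ k                             ∎
    where open ≈-R

  X^[1+p^r]^p^s : ∀ r s → suc m ≡ suc r ℕ.+ s → X ^ ((1 ℕ.+ p ℕ.^ suc r) ℕ.^ (p ℕ.^ s)) ≈ X
  X^[1+p^r]^p^s r s 1+m≡r+s = begin
    X ^ ((1 ℕ.+ p ℕ.^ suc r) ℕ.^ (p ℕ.^ s))      ≈⟨ ^-congʳ X (proj₂ ([1+p^r]^p^s p r s)) ⟩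
    X ^ (1 ℕ.+ t ℕ.* p ℕ.^ (suc r ℕ.+ s))        ≡⟨ ≡.cong (λ e → X ^ (1 ℕ.+ t ℕ.* p ℕ.^ e)) 1+m≡r+s ⟨
    X ^ (1 ℕ.+ t ℕ.* p ℕ.^ suc m)                ≈⟨ X^-periodic 1 t ⟩
    X ^ 1                                        ≈⟨ *-identityʳ X ⟩
    X                                            ∎
    where
    open ≈-R
    t = proj₁ ([1+p^r]^p^s p r s)

  Π+X≈1 : Π + X ≈ 1#
  Π+X≈1 = //-rightDividesˡ X 1#

  1≋Π^q+X^q : ∀ j → let q = p ℕ.^ j in Mod._≋_ ϖ 1# (Π ^ q + X ^ q)
  1≋Π^q+X^q j = begin
    1#                     ≈⟨ ≈⇒≋ (trans (sym (1^q q)) (^-congˡ q (sym Π+X≈1))) ⟩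
    (Π + X) ^ q            ≈⟨ π.^-homo (Π + X) q ⟩
    (Π + X) ^′ q           ≈⟨ Frobenius.[x+y]^p^j quotientCommutativeRing p-prime
                                (Q′.trans (Q′.sym (π.×1-homo p)) f≋0) Π X j ⟩
    Π ^′ q + X ^′ q        ≈⟨ Q′.+-cong (π.^-homo Π q) (π.^-homo X q) ⟨
    Π ^ q + X ^ q          ∎
    where
    open Mod ϖ
    open ≋-R
    open SemiringExp Q′.semiring using () renaming (_^_ to _^′_)
    q = p ℕ.^ j

  1-X^p^j : ∀ j → ∃[ e ] 1# - X ^ (p ℕ.^ j) ≈ Π ^ (p ℕ.^ j) + e * ϖ
  1-X^p^j j = e , (begin
    1# - X ^ q                              ≈⟨ [x-y]+[y-z]≈x-z 1# (Π ^ q + X ^ q) (X ^ q) ⟨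
    1# - (Π ^ q + X ^ q) + (Π ^ q + X ^ q - X ^ q) ≈⟨ +-cong (proj₂ (1≋Π^q+X^q j)) (//-rightDividesʳ (X ^ q) (Π ^ q)) ⟩
    e * ϖ + Π ^ q                           ≈⟨ +-comm _ _ ⟩
    Π ^ q + e * ϖ                           ∎)
    where
    open ≈-R
    q = p ℕ.^ j
    e = proj₁ (1≋Π^q+X^q j)

  Π^p^[1+m]∈⟨ϖ⟩ : ∃[ e ] Π ^ (p ℕ.^ suc m) ≈ ϖ * e
  Π^p^[1+m]∈⟨ϖ⟩ = let e , eq = 1-X^p^j (suc m) in - e , (begin
    Π ^ (p ℕ.^ suc m)                    ≈⟨ +-inverseˡ-unique _ (e * ϖ) (trans (sym eq)
                                              (trans (+-congˡ (-‿cong X^p^1+m≈1)) (-‿inverseʳ 1#))) ⟩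
    - (e * ϖ)                            ≈⟨ -‿cong (*-comm e ϖ) ⟩
    - (ϖ * e)                            ≈⟨ -‿distribʳ-* ϖ e ⟩
    ϖ * - e                              ∎)
    where open ≈-R

  -- K n is (n - Σ_{i<n} Yⁱ) / (1 - Y).
  K : ℕ → Carrier
  K zero    = 0#
  K (suc n) = K n + geometric Y n

  n≈geometric+K : ∀ n → n · 1# ≈ geometric Y n + (1# - Y) * K n
  n≈geometric+K zero    = sym (trans (+-identityˡ _) (zeroʳ _))
  n≈geometric+K (suc n) = begin
    1# + n · 1#                                                ≈⟨ +-congˡ (n≈geometric+K n) ⟩
    1# + (geometric Y n + (1# - Y) * K n)                      ≈⟨ +-congˡ (+-congʳ split) ⟨
    1# + (Y * geometric Y n + (1# - Y) * geometric Y n + (1# - Y) * K n)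
                                                               ≈⟨ +-congˡ (+-assoc _ _ _) ⟩
    1# + (Y * geometric Y n + ((1# - Y) * geometric Y n + (1# - Y) * K n))
                                                               ≈⟨ +-assoc 1# _ _ ⟨
    geometric Y (suc n) + ((1# - Y) * geometric Y n + (1# - Y) * K n)
                                                               ≈⟨ +-congˡ (trans (+-comm _ _) (sym (distribˡ _ _ _))) ⟩
    geometric Y (suc n) + (1# - Y) * K (suc n)                 ∎
    where
    open ≈-R
    split : Y * geometric Y n + (1# - Y) * geometric Y n ≈ geometric Y n
    split = begin
      Y * geometric Y n + (1# - Y) * geometric Y n   ≈⟨ distribʳ _ _ _ ⟨
      (Y + (1# - Y)) * geometric Y n                 ≈⟨ *-congʳ (trans (+-comm _ _) (//-rightDividesˡ Y 1#)) ⟩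
      1# * geometric Y n                             ≈⟨ *-identityˡ _ ⟩
      geometric Y n                                  ∎

  K∈⟨Π⟩ : ∃[ k ] K p ≈ k * Π
  K∈⟨Π⟩ = ≋0⇒I (begin
    K p                     ≈⟨ K≋triangle p ⟩
    triangle p ·′ 1#        ≈⟨ Frobenius.p∣n⇒n·x≈0 quotientCommutativeRing p-prime
                                 ϖ≋0 (oddPrime∣triangle p-prime p≢2) 1# ⟩
    0#                      ∎)
    where
    open Mod Π
    open ≋-R
    open SemiringExp Q′.semiring using () renaming (_^_ to _^′_; ^-congˡ to ^′-congˡ)
    open SemiringMult Q′.semiring using () renaming (_×_ to _·′_; ×-homo-+ to ·′-homo-+)
    X≋1 : X ≋ 1#
    X≋1 = Q′.sym f≋0′
      where
      f≋0′ : 1# ≋ X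
      f≋0′ = 1# , sym (*-identityˡ Π)
    1^′ : ∀ q → 1# ^′ q ≋ 1#
    1^′ zero    = Q′.refl
    1^′ (suc q) = Q′.trans (Q′.*-identityˡ _) (1^′ q)
    Y≋1 : Y ≋ 1#
    Y≋1 = Q′.trans (π.^-homo X (p ℕ.^ m)) (Q′.trans (^′-congˡ (p ℕ.^ m) X≋1) (1^′ (p ℕ.^ m)))
    geometric≋n : ∀ n → geometric Y n ≋ n ·′ 1#
    geometric≋n zero    = Q′.refl
    geometric≋n (suc n) = Q′.+-congˡ (Q′.trans (Q′.*-cong Y≋1 (geometric≋n n)) (Q′.*-identityˡ _))
    K≋triangle : ∀ n → K n ≋ triangle n ·′ 1#
    K≋triangle zero    = Q′.refl
    K≋triangle (suc n) = Q′.trans (Q′.+-cong (K≋triangle n) (geometric≋n n)) (Q′.sym (·′-homo-+ 1# (triangle n) n))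
    ϖ≋0 : p ·′ 1# ≋ 0#
    ϖ≋0 = Q′.trans (Q′.sym (geometric≋n p)) (≈⇒≋ geometric-Y≈0)

  ϖ∈⟨Π^[1+p^m]⟩ : ∃[ t ] ϖ ≈ t * Π ^ suc (p ℕ.^ m)
  ϖ∈⟨Π^[1+p^m]⟩ = ≋0⇒I (begin
    ϖ                             ≈⟨ absorb (suc Q) ⟩
    ϖ * b ^ suc Q                 ≈⟨ Q′.*-congˡ (≈⇒≋ (^-distrib-* (e * k) Π (suc Q))) ⟩
    ϖ * ((e * k) ^ suc Q * Π ^ suc Q) ≈⟨ Q′.*-congˡ (Q′.trans (Q′.*-congˡ f≋0) (Q′.zeroʳ _)) ⟩
    ϖ * 0#                        ≈⟨ Q′.zeroʳ ϖ ⟩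
    0#                            ∎)
    where
    Q = p ℕ.^ m
    e = proj₁ (1-X^p^j m)
    k = proj₁ K∈⟨Π⟩
    b = e * k * Π
    open Mod (Π ^ suc Q)
    ϖ≈ : ϖ ≈ k * Π ^ suc Q + ϖ * b
    ϖ≈ = begin
      ϖ                                            ≈⟨ n≈geometric+K p ⟩
      geometric Y p + (1# - Y) * K p               ≈⟨ +-cong geometric-Y≈0 (*-cong (proj₂ (1-X^p^j m)) (proj₂ K∈⟨Π⟩)) ⟩
      0# + (Π ^ Q + e * ϖ) * (k * Π)               ≈⟨ trans (+-identityˡ _) (distribʳ _ _ _) ⟩
      Π ^ Q * (k * Π) + e * ϖ * (k * Π)            ≈⟨ +-cong (x∙yz≈y∙zx _ _ _) (trans (*-congʳ (*-comm e ϖ)) (trans (*-assoc _ _ _) (*-congˡ (sym (*-assoc _ _ _))))) ⟩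
      k * Π ^ suc Q + ϖ * b                        ∎
      where open ≈-R
    ϖ≋ϖb : ϖ ≋ ϖ * b
    ϖ≋ϖb = Q′.trans (≈⇒≋ ϖ≈) (Q′.trans (Q′.+-congʳ (Q′.trans (Q′.*-congˡ f≋0) (Q′.zeroʳ k))) (Q′.+-identityˡ _))
    absorb : ∀ j → ϖ ≋ ϖ * b ^ j
    absorb zero    = Q′.sym (Q′.*-identityʳ ϖ)
    absorb (suc j) = Q′.trans (absorb j) (Q′.trans (Q′.*-congʳ ϖ≋ϖb) (Q′.*-assoc ϖ b _))
    open ≋-R

  Π^-split : ∀ {j k} → j ℕ.≤ k → Π ^ k ≈ Π ^ (k ℕ.∸ j) * Π ^ j
  Π^-split {j} {k} j≤k = trans (^-congʳ Π (≡.sym (ℕ.m∸n+n≡m j≤k))) (^-homo-* Π (k ℕ.∸ j) j)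

  module Conjugate (r : ℕ) (r≤m : r ℕ.≤ m) (q″ : ℕ) (p^r≡2+q″ : p ℕ.^ r ≡ suc (suc q″)) where
    q q′ : ℕ
    q = p ℕ.^ r
    q′ = suc q″

    ϖ∈⟨Π^[1+q]⟩ : ∃[ t ] ϖ ≈ t * Π ^ suc q
    ϖ∈⟨Π^[1+q]⟩ = let t , eq = ϖ∈⟨Π^[1+p^m]⟩ in t * Π ^ (suc (p ℕ.^ m) ℕ.∸ suc q) ,
      trans eq (trans (*-congˡ (Π^-split (ℕ.s≤s (ℕ.^-monoʳ-≤ p {{prime⇒nonZero p-prime}} r≤m)))) (sym (*-assoc _ _ _)))

    1-X^q≋Π^q : Mod._≋_ (Π ^ suc q) (1# - X ^ q) (Π ^ q)
    1-X^q≋Π^q = begin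
      1# - X ^ q                  ≈⟨ ≈⇒≋ (trans (proj₂ (1-X^p^j r)) (+-congˡ (*-congˡ (proj₂ ϖ∈⟨Π^[1+q]⟩)))) ⟩
      Π ^ q + e * (t * Π ^ suc q) ≈⟨ Q′.+-congˡ (Q′.*-congˡ (Q′.trans (Q′.*-congˡ f≋0) (Q′.zeroʳ t))) ⟩
      Π ^ q + e * 0#              ≈⟨ Q′.trans (Q′.+-congˡ (Q′.zeroʳ e)) (Q′.+-identityʳ _) ⟩
      Π ^ q                       ∎
      where
      open Mod (Π ^ suc q)
      open ≋-R
      e = proj₁ (1-X^p^j r)
      t = proj₁ ϖ∈⟨Π^[1+q]⟩

    X[1-X^q]≋Π^q : Mod._≋_ (Π ^ suc q) (X * (1# - X ^ q)) (Π ^ q)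
    X[1-X^q]≋Π^q = begin
      X * (1# - X ^ q)        ≈⟨ Q′.*-congˡ 1-X^q≋Π^q ⟩
      X * Π ^ q               ≈⟨ Q′.+-identityʳ _ ⟨
      X * Π ^ q + 0#          ≈⟨ Q′.+-congˡ f≋0 ⟨
      X * Π ^ q + Π * Π ^ q   ≈⟨ ≈⇒≋ (trans (sym (distribʳ _ _ _)) (*-congʳ (trans (+-comm X Π) Π+X≈1))) ⟩
      1# * Π ^ q              ≈⟨ Q′.*-identityˡ _ ⟩
      Π ^ q                   ∎
      where
      open Mod (Π ^ suc q)
      open ≋-R

    X^[1+q]≋X : Mod._≋_ (Π ^ q) (X ^ suc q) X
    X^[1+q]≋X = Q.≋-sym (proj₁ X[1-X^q]≋Π^q * Π + 1# , (begin
      X - X * X ^ q                                 ≈⟨ x[1-y]≈x-xy X (X ^ q) ⟨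
      X * (1# - X ^ q)                              ≈⟨ //-rightDividesˡ (Π ^ q) _ ⟨
      X * (1# - X ^ q) - Π ^ q + Π ^ q              ≈⟨ +-cong (proj₂ X[1-X^q]≋Π^q) (sym (*-identityˡ _)) ⟩
      w * (Π * Π ^ q) + 1# * Π ^ q                  ≈⟨ +-congʳ (*-assoc _ _ _) ⟨
      w * Π * Π ^ q + 1# * Π ^ q                    ≈⟨ distribʳ _ _ _ ⟨
      (w * Π + 1#) * Π ^ q                          ∎))
      where
      open PrincipalIdeal S (Π ^ q) using (module Q)
      open ≈-R
      w = proj₁ X[1-X^q]≋Π^q

    gΠ : Carrier
    gΠ = 1# - X ^ suc q

    private
      w = proj₁ X[1-X^q]≋Π^q

    ε : Carrier
    ε = Π ^ q′ + w * Π ^ suc q′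

    gΠ≈Π[1+ε] : gΠ ≈ Π * (1# + ε)
    gΠ≈Π[1+ε] = begin
      1# - X * X ^ q                            ≈⟨ [x-y]+[y-z]≈x-z 1# X (X * X ^ q) ⟨
      Π + (X - X * X ^ q)                       ≈⟨ +-congˡ (x[1-y]≈x-xy X (X ^ q)) ⟨
      Π + X * (1# - X ^ q)                      ≈⟨ +-congˡ (//-rightDividesˡ (Π ^ q) _) ⟨
      Π + (X * (1# - X ^ q) - Π ^ q + Π ^ q)    ≈⟨ +-congˡ (+-congʳ (proj₂ X[1-X^q]≋Π^q)) ⟩
      Π + (w * (Π * Π ^ q) + Π ^ q)             ≈⟨ +-congˡ (+-cong (trans (*-congˡ (*-congˡ (^-congʳ Π p^r≡2+q″))) (x∙yz≈y∙xz w Π _)) (^-congʳ Π p^r≡2+q″)) ⟩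
      Π + (Π * (w * Π ^ suc q′) + Π * Π ^ q′)   ≈⟨ +-congˡ (trans (+-comm _ _) (sym (distribˡ Π _ _))) ⟩
      Π + Π * ε                                 ≈⟨ +-congʳ (*-identityʳ Π) ⟨
      Π * 1# + Π * ε                            ≈⟨ distribˡ Π 1# ε ⟨
      Π * (1# + ε)                              ∎
      where open ≈-R

    gΠ^n : ∀ n → Mod._≋_ (Π ^ suc (q′ ℕ.+ n)) (gΠ ^ n) (Π ^ n + Π ^ (q′ ℕ.+ n) * n · 1#)
    gΠ^n n = begin
      gΠ ^ n                                        ≈⟨ ≈⇒≋ (trans (^-congˡ n gΠ≈Π[1+ε]) (trans (^-distrib-* Π (1# + ε) n) (*-congˡ (proj₂ ([1+y]^ n ε))))) ⟩
      Π ^ n * (1# + (n · ε + ε * (ε * k)))          ≈⟨ ≈⇒≋ expand ⟩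
      Π ^ n + (Π ^ n * ε * n · 1# + Π ^ n * ε * (ε * k))
                                                    ≈⟨ Q′.+-congˡ (Q′.+-cong (Q′.*-congʳ Π^nε≋) (Q′.*-congʳ Π^nε≋)) ⟩
      Π ^ n + (Π ^ J * n · 1# + Π ^ J * (ε * k))    ≈⟨ Q′.+-congˡ (Q′.+-congˡ Π^Jε≋0) ⟩
      Π ^ n + (Π ^ J * n · 1# + 0#)                 ≈⟨ Q′.+-congˡ (Q′.+-identityʳ _) ⟩
      Π ^ n + Π ^ J * n · 1#                        ∎
      where
      open Expansion commutativeSemiring using ([1+y]^)
      J = q′ ℕ.+ n
      k = proj₁ ([1+y]^ n ε)
      open Mod (Π ^ suc J)
      open ≋-R
      n·ε≈ε*n : n · ε ≈ ε * n · 1#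
      n·ε≈ε*n = trans (×-congʳ n (sym (*-identityʳ ε))) (sym (×-comm-* n ε 1#))
      expand : Π ^ n * (1# + (n · ε + ε * (ε * k))) ≈ Π ^ n + (Π ^ n * ε * n · 1# + Π ^ n * ε * (ε * k))
      expand = trans (distribˡ _ _ _) (+-cong (*-identityʳ _) (trans (distribˡ _ _ _)
        (+-cong (trans (*-congˡ n·ε≈ε*n) (sym (*-assoc _ _ _))) (sym (*-assoc _ _ _)))))
      Π^nε≋ : Π ^ n * ε ≋ Π ^ J
      Π^nε≋ = begin
        Π ^ n * (Π ^ q′ + w * Π ^ suc q′)        ≈⟨ ≈⇒≋ (trans (*-comm _ _) (distribʳ _ _ _)) ⟩
        Π ^ q′ * Π ^ n + w * Π ^ suc q′ * Π ^ n  ≈⟨ ≈⇒≋ (+-cong (^-homo-* Π q′ n) (trans (*-congˡ (^-homo-* Π (suc q′) n)) (sym (*-assoc _ _ _)))) ⟨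
        Π ^ J + w * Π ^ suc J                    ≈⟨ Q′.+-congˡ (Q′.trans (Q′.*-congˡ f≋0) (Q′.zeroʳ w)) ⟩
        Π ^ J + 0#                               ≈⟨ Q′.+-identityʳ _ ⟩
        Π ^ J                                    ∎
      Π^Jε≋0 : Π ^ J * (ε * k) ≋ 0#
      Π^Jε≋0 = begin
        Π ^ J * (ε * k)                          ≈⟨ ≈⇒≋ (*-congˡ (*-congʳ (trans (+-congˡ (x∙yz≈y∙xz w Π _)) (sym (distribˡ Π _ _))))) ⟩
        Π ^ J * (Π * (Π ^ q″ + w * Π ^ q′) * k)  ≈⟨ ≈⇒≋ (*-congˡ (*-assoc Π _ k)) ⟩
        Π ^ J * (Π * ((Π ^ q″ + w * Π ^ q′) * k)) ≈⟨ ≈⇒≋ (x∙yz≈yx∙z _ Π _) ⟩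
        Π ^ suc J * ((Π ^ q″ + w * Π ^ q′) * k)  ≈⟨ Q′.trans (Q′.*-congʳ f≋0) (Q′.zeroˡ _) ⟩
        0#                                       ∎

IsNormalElement : (Δ : Ring c ℓ) → Ring.Carrier Δ → Set (c ⊔ ℓ)
IsNormalElement Δ Π = ∀ x → ∃[ y ] x * Π ≈ Π * y
  where open Ring Δ

module Filtration (Δ : Ring c ℓ) (Π : Ring.Carrier Δ) (normal : IsNormalElement Δ Π) where
  open Ring Δ hiding (zero)
  open RingProps Δ
  open SemiringExp semiring using (_^_; ^-homo-*)
  open SetoidReasoning setoid

  infix 8 Π^_Δ
  Π^_Δ : ℕ → Carrier → Set (c ⊔ ℓ)
  Π^ k Δ = λ x → ∃[ z ] x ≈ Π ^ k * z

  normal^ : ∀ k x → ∃[ y ] x * Π ^ k ≈ Π ^ k * y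
  normal^ zero    x = x , trans (*-identityʳ x) (sym (*-identityˡ x))
  normal^ (suc k) x = let y , p = normal x ; z , q = normal^ k y in z , (begin
    x * (Π * Π ^ k)    ≈⟨ *-assoc _ _ _ ⟨
    x * Π * Π ^ k      ≈⟨ *-congʳ p ⟩
    Π * y * Π ^ k      ≈⟨ *-assoc _ _ _ ⟩
    Π * (y * Π ^ k)    ≈⟨ *-congˡ q ⟩
    Π * (Π ^ k * z)    ≈⟨ *-assoc _ _ _ ⟨
    Π * Π ^ k * z      ∎)

  isIdeal : ∀ k → IsIdeal Δ (Π^ k Δ)
  isIdeal k = record
    { resp      = λ eq (z , p) → z , trans (sym eq) p
    ; 0∈        = 0# , sym (zeroʳ _)
    ; +-closed  = λ (z , p) (z′ , p′) → z + z′ , trans (+-cong p p′) (sym (distribˡ _ z z′))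
    ; *ˡ-closed = λ a (z , p) → let b , q = normal^ k a in
        b * z , trans (*-congˡ p) (trans (sym (*-assoc _ _ _)) (trans (*-congʳ q) (*-assoc _ _ _)))
    ; *ʳ-closed = λ a (z , p) → z * a , trans (*-congʳ p) (*-assoc _ z a) }

  Π^-* : ∀ j {k x} → (Π^ k Δ) x → (Π^ (j ℕ.+ k) Δ) (Π ^ j * x)
  Π^-* j {k} {x} (z , p) = z , (begin
    Π ^ j * x               ≈⟨ *-congˡ p ⟩
    Π ^ j * (Π ^ k * z)     ≈⟨ *-assoc _ _ z ⟨
    Π ^ j * Π ^ k * z       ≈⟨ *-congʳ (^-homo-* Π j k) ⟨
    Π ^ (j ℕ.+ k) * z       ∎)

  Π^-weaken : ∀ j {k x} → (Π^ (j ℕ.+ k) Δ) x → (Π^ j Δ) x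
  Π^-weaken j {k} {x} (z , p) = Π ^ k * z , trans p (trans (*-congʳ (^-homo-* Π j k)) (*-assoc _ _ z))

  [Πx]^ : ∀ x k → (Π^ k Δ) ((Π * x) ^ k)
  [Πx]^ x zero    = 1# , sym (*-identityˡ 1#)
  [Πx]^ x (suc k) = let z , p = IsIdeal.*ˡ-closed (isIdeal k) x ([Πx]^ x k) in z , (begin
    Π * x * (Π * x) ^ k     ≈⟨ *-assoc _ _ _ ⟩
    Π * (x * (Π * x) ^ k)   ≈⟨ *-congˡ p ⟩
    Π * (Π ^ k * z)         ≈⟨ *-assoc _ _ z ⟨
    Π * Π ^ k * z           ∎)

module NatMultiples (Δ : Ring c ℓ) where
  open Ring Δ hiding (zero)
  open RingProps Δ
  open SemiringMult semiring using (×1-homo-*; ×-congʳ; ×-comm-*; ×-assoc-*) renaming (_×_ to _·_)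
  open SetoidReasoning setoid

  ·1-central : ∀ n x → n · 1# * x ≈ x * n · 1#
  ·1-central n x = begin
    n · 1# * x     ≈⟨ ×-assoc-* n 1# x ⟩
    n · (1# * x)   ≈⟨ ×-congʳ n (trans (*-identityˡ x) (sym (*-identityʳ x))) ⟩
    n · (x * 1#)   ≈⟨ ×-comm-* n x 1# ⟨
    x * n · 1#     ∎

  -- Bézout gives an inverse of -m rather than m, up to the sign taken up by a.
  inverse-mod : ∀ {p m} → Coprime m p → ∃[ a ] ∃[ s ] m · 1# * a + 1# ≈ p · 1# * s
  inverse-mod {p} {m} m⊥p with coprime-Bézout m⊥p
  ... | Bézout.+- x y 1+yp≡xm = - (x · 1#) , - (y · 1#) , (begin
    m · 1# * - (x · 1#) + 1#           ≈⟨ +-congʳ (-‿distribʳ-* _ _) ⟨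
    - (m · 1# * x · 1#) + 1#           ≈⟨ +-congʳ (-‿cong (trans (·1-central m _) (sym (×1-homo-* x m)))) ⟩
    - ((x ℕ.* m) · 1#) + 1#            ≡⟨ ≡.cong (λ k → - (k · 1#) + 1#) 1+yp≡xm ⟨
    - (1# + (y ℕ.* p) · 1#) + 1#       ≈⟨ +-congʳ (-‿anti-homo-+ _ _) ⟩
    - ((y ℕ.* p) · 1#) - 1# + 1#       ≈⟨ //-rightDividesˡ 1# _ ⟩
    - ((y ℕ.* p) · 1#)                 ≈⟨ -‿cong (trans (×1-homo-* y p) (·1-central y _)) ⟩
    - (p · 1# * y · 1#)                ≈⟨ -‿distribʳ-* _ _ ⟩
    p · 1# * - (y · 1#)                ∎)
  ... | Bézout.-+ x y 1+xm≡yp = x · 1# , y · 1# , (begin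
    m · 1# * x · 1# + 1#               ≈⟨ +-comm _ _ ⟩
    1# + m · 1# * x · 1#               ≈⟨ +-congˡ (trans (·1-central m _) (sym (×1-homo-* x m))) ⟩
    (1 ℕ.+ x ℕ.* m) · 1#               ≡⟨ ≡.cong (_· 1#) 1+xm≡yp ⟩
    (y ℕ.* p) · 1#                     ≈⟨ trans (×1-homo-* y p) (·1-central y _) ⟩
    p · 1# * y · 1#                    ∎)

module CommutatorApproximation (Δ : Ring c ℓ) {Π : Ring.Carrier Δ} (normal : IsNormalElement Δ Π) where
  open Ring Δ hiding (zero)
  open SemiringExp semiring using (_^_; ^-homo-*)
  open SemiringMult semiring using () renaming (_×_ to _·_)
  open Filtration Δ Π normal
  open RingProps Δ
  open Invertibility Δ
  open NatMultiples Δ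

  module _ {u gΠ : Carrier} {g : Carrier → Carrier}
    (u-* : ∀ x → u * x ≈ g x * u) (u-Π : u * Π ≈ gΠ * u)
    {p q′ m′ : ℕ} (m⊥p : Coprime (suc m′) p) (p∈ΠΔ : (Π^ 1 Δ) (p · 1#))
    (gx≡x : ∀ x → (Π^ suc q′ Δ) (g x - x))
    (gΠ^m≡ : (Π^ suc (q′ ℕ.+ suc m′) Δ)
      (gΠ ^ suc m′ - (Π ^ suc m′ + Π ^ (q′ ℕ.+ suc m′) * suc m′ · 1#))) where
    private
      m = suc m′
      q = suc q′
      n = q′ ℕ.+ m
      module Q = Quotient Δ (isIdeal (suc n))
      module Q′ = Ring Q.quotientRing
    open Q using (_≋_; ≈⇒≋)

    private
      a = proj₁ (inverse-mod m⊥p)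

      M = m · 1#

      Π^n-cong : ∀ {x y} → (Π^ 1 Δ) (x - y) → Π ^ n * x ≋ Π ^ n * y
      Π^n-cong {x} {y} x≡y = IsIdeal.resp (isIdeal (suc n)) (x[y-z]≈xy-xz (Π ^ n) x y)
        (≡.subst (λ k → (Π^ k Δ) (Π ^ n * (x - y))) (ℕ.+-comm n 1) (Π^-* n x≡y))

      u-Π^ : ∀ k → u * Π ^ k ≈ gΠ ^ k * u
      u-Π^ zero    = trans (*-identityʳ u) (sym (*-identityˡ u))
      u-Π^ (suc k) = begin
        u * (Π * Π ^ k)        ≈⟨ *-assoc _ _ _ ⟨
        u * Π * Π ^ k          ≈⟨ *-congʳ u-Π ⟩
        gΠ * u * Π ^ k         ≈⟨ *-assoc _ _ _ ⟩
        gΠ * (u * Π ^ k)       ≈⟨ *-congˡ (u-Π^ k) ⟩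
        gΠ * (gΠ ^ k * u)      ≈⟨ *-assoc _ _ _ ⟨
        gΠ * gΠ ^ k * u        ∎
        where open SetoidReasoning setoid

    module _ {d z} (d-1≈Π^nz : d - 1# ≈ Π ^ n * z) where

      x y : Carrier
      x = a * z
      y = 1# - Π ^ m * x

      private
        gΠ^m[gx]≋ : gΠ ^ m * g x ≋ Π ^ m * x - Π ^ n * z
        gΠ^m[gx]≋ = begin
          gΠ ^ m * g x                              ≈⟨ Q′.*-congʳ gΠ^m≡ ⟩
          (Π ^ m + Π ^ n * M) * g x                 ≈⟨ ≈⇒≋ (trans (distribʳ _ _ _) (+-congˡ (*-assoc _ _ _))) ⟩
          Π ^ m * g x + Π ^ n * (M * g x)           ≈⟨ Q′.+-cong Π^m[gx]≋ (Q′.trans (Π^n-cong M[gx]≡) (Π^n-cong M[az]≡-z)) ⟩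
          Π ^ m * x + Π ^ n * - z                   ≈⟨ ≈⇒≋ (+-congˡ (-‿distribʳ-* _ _)) ⟨
          Π ^ m * x - Π ^ n * z                     ∎
          where
          open SetoidReasoning Q′.setoid
          Π^m[gx]≋ : Π ^ m * g x ≋ Π ^ m * x
          Π^m[gx]≋ = IsIdeal.resp (isIdeal (suc n)) (x[y-z]≈xy-xz (Π ^ m) (g x) x)
            (≡.subst (λ k → (Π^ k Δ) (Π ^ m * (g x - x))) (≡.trans (ℕ.+-comm m q) ≡.refl) (Π^-* m (gx≡x x)))
          M[gx]≡ : (Π^ 1 Δ) (M * g x - M * x)
          M[gx]≡ = IsIdeal.resp (isIdeal 1) (x[y-z]≈xy-xz M (g x) x)
            (IsIdeal.*ˡ-closed (isIdeal 1) M (Π^-weaken 1 {q′} (gx≡x x)))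
          M[az]≡-z : (Π^ 1 Δ) (M * (a * z) - - z)
          M[az]≡-z = IsIdeal.resp (isIdeal 1)
            (trans (*-congʳ (sym (proj₂ (proj₂ (inverse-mod m⊥p)))))
              (trans (distribʳ z _ _) (+-cong (*-assoc _ _ _) (trans (*-identityˡ z) (sym (-‿involutive z))))))
            (IsIdeal.*ʳ-closed (isIdeal 1) z (IsIdeal.*ʳ-closed (isIdeal 1) (proj₁ (proj₂ (inverse-mod m⊥p))) p∈ΠΔ))

        uy≋ : u * y ≋ (y + Π ^ n * z) * u
        uy≋ = begin
          u * (1# - Π ^ m * x)                      ≈⟨ ≈⇒≋ (x[1-y]≈x-xy u _) ⟩
          u - u * (Π ^ m * x)                       ≈⟨ ≈⇒≋ (+-congˡ (-‿cong move)) ⟩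
          u - gΠ ^ m * g x * u                      ≈⟨ ≈⇒≋ ([1-y]x≈x-yx u _) ⟨
          (1# - gΠ ^ m * g x) * u                   ≈⟨ Q′.*-congʳ (Q′.+-congˡ (Q′.-‿cong gΠ^m[gx]≋)) ⟩
          (1# - (Π ^ m * x - Π ^ n * z)) * u        ≈⟨ ≈⇒≋ (*-congʳ (trans (+-congˡ (sym (-‿+-comm _ _))) (trans (sym (+-assoc _ _ _)) (+-congˡ (-‿involutive _))))) ⟩
          (y + Π ^ n * z) * u                       ∎
          where
          open SetoidReasoning Q′.setoid
          move : u * (Π ^ m * x) ≈ gΠ ^ m * g x * u
          move = trans (sym (*-assoc _ _ _)) (trans (*-congʳ (u-Π^ m)) (trans (*-assoc _ _ _) (trans (*-congˡ (u-* x)) (sym (*-assoc _ _ _)))))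

        dy≋ : d * y ≋ y + Π ^ n * z
        dy≋ = begin
          d * y                          ≈⟨ ≈⇒≋ (*-congʳ (//-rightDividesˡ 1# d)) ⟨
          (d - 1# + 1#) * y              ≈⟨ ≈⇒≋ (*-congʳ (trans (+-congʳ d-1≈Π^nz) (+-comm _ _))) ⟩
          (1# + Π ^ n * z) * y           ≈⟨ ≈⇒≋ (trans (distribʳ _ _ _) (+-cong (*-identityˡ y) (*-assoc _ z y))) ⟩
          y + Π ^ n * (z * y)            ≈⟨ Q′.+-congˡ (Π^n-cong zy≡z) ⟩
          y + Π ^ n * z                  ∎
          where
          open SetoidReasoning Q′.setoid
          Π^mx∈ΠΔ : (Π^ 1 Δ) (Π ^ m * x)
          Π^mx∈ΠΔ = Π^-weaken 1 {m′} (x , refl)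
          zy≡z : (Π^ 1 Δ) (z * y - z)
          zy≡z = IsIdeal.resp (isIdeal 1)
            (sym (trans (+-congʳ (x[1-y]≈x-xy z (Π ^ m * x))) (trans (xyx⁻¹≈y z _) (-‿distribʳ-* z _))))
            (IsIdeal.*ˡ-closed (isIdeal 1) z (Quotient.neg-closed Δ (isIdeal 1) Π^mx∈ΠΔ))

      d≋[u,y] : ∃ λ x → ∀ {u⁻¹ y⁻¹} → u * u⁻¹ ≈ 1# → (1# - Π ^ m * x) * y⁻¹ ≈ 1# →
                (Π^ suc n Δ) (d - u * (1# - Π ^ m * x) * u⁻¹ * y⁻¹)
      d≋[u,y] = x , λ {u⁻¹} {y⁻¹} uu⁻¹ yy⁻¹ → begin
        d                                   ≈⟨ ≈⇒≋ (cancel uu⁻¹ yy⁻¹) ⟨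
        d * y * u * u⁻¹ * y⁻¹               ≈⟨ Q′.*-congʳ (Q′.*-congʳ (Q′.*-congʳ dy≋)) ⟩
        (y + Π ^ n * z) * u * u⁻¹ * y⁻¹     ≈⟨ Q′.*-congʳ (Q′.*-congʳ uy≋) ⟨
        u * y * u⁻¹ * y⁻¹                   ∎
        where
        open SetoidReasoning Q′.setoid
        cancel : ∀ {u⁻¹ y⁻¹} → u * u⁻¹ ≈ 1# → y * y⁻¹ ≈ 1# → d * y * u * u⁻¹ * y⁻¹ ≈ d
        cancel {u⁻¹} {y⁻¹} uu⁻¹ yy⁻¹ = trans (*-congʳ (trans (*-assoc _ u u⁻¹) (trans (*-congˡ uu⁻¹) (*-identityʳ _))))
          (trans (*-assoc d y y⁻¹) (trans (*-congˡ yy⁻¹) (*-identityʳ d)))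

module CyclicOrder (S : CommutativeRing c ℓ) {p : ℕ} (p-prime : Prime p) (p≢2 : p ≢ 2)
  (X : CommutativeRing.Carrier S) (e : ℕ) (Φ≈0 : CyclotomicRelation S p X e)
  (r : ℕ) (r≤e : r ≤ e) (q″ : ℕ) (p^r≡2+q″ : p ℕ.^ r ≡ suc (suc q″)) where
  private
    module S = CommutativeRing S
    module Cyc = Cyclotomic S p-prime p≢2 X e Φ≈0
    module Conj = Cyc.Conjugate r r≤e q″ p^r≡2+q″
  open SemiringExp S.semiring using () renaming (_^_ to _^S_)

  module _ (σ₀ : S.Carrier → S.Carrier) (σ₀-isHom : IsRingHomomorphism S.rawRing S.rawRing σ₀)
    (σ₀-X : σ₀ X S.≈ X ^S suc Conj.q)
    (σ₀≡id : ∀ a → ∃[ v ] σ₀ a S.- a S.≈ v S.* Cyc.Π ^S Conj.q)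
    (N : ℕ) .{{_ : NonZero N}} (fold-σ₀≈id : ∀ a → fold a σ₀ N S.≈ a) where
    open SeriesRing S hiding (_·_; module S)
    open SeriesDivision S
    open SeriesMap S σ₀ σ₀-isHom
    private
      module B = CommutativeRing seriesRing
      module σ₀ = RingHom.Properties S.ring S.ring σ₀ σ₀-isHom

    γ : B.Carrier
    γ = B.1# B.+ P.T

    σγ≈γ : σ₀ ∘ γ B.≈ γ
    σγ≈γ zero          = S.trans (σ₀.+-homo _ _) (S.+-cong σ₀.1#-homo σ₀.0#-homo)
    σγ≈γ (suc zero)    = S.trans (σ₀.+-homo _ _) (S.+-cong σ₀.0#-homo σ₀.1#-homo)
    σγ≈γ (suc (suc n)) = S.trans (σ₀.+-homo _ _) (S.+-cong σ₀.0#-homo σ₀.0#-homo)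

    fold-σ≈id : ∀ b → fold b (σ₀ ∘_) N B.≈ b
    fold-σ≈id b n = S.trans (S.reflexive (fold-apply N)) (fold-σ₀≈id (b n))
      where
      fold-apply : ∀ k → fold b (σ₀ ∘_) k n ≡ fold (b n) σ₀ k
      fold-apply zero    = ≡.refl
      fold-apply (suc k) = ≡.cong σ₀ (fold-apply k)

    γ⁻¹ : ∃[ δ ] γ B.* δ B.≈ B.1#
    γ⁻¹ = invertible {S.1#} {γ} (S.trans (S.*-identityʳ _) (S.+-identityʳ S.1#))

    cyclic : IsCyclicAlgebra seriesRing (σ₀ ∘_) γ N
    cyclic = isCyclicAlgebra seriesRing map-isHom N σγ≈γ fold-σ≈id

    module C = CyclicAlgebra B.rawRing (σ₀ ∘_) γ N
    module Cyclic = IsCyclicAlgebra cyclic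

    Δ : Ring c ℓ
    Δ = record { isRing = Cyclic.isRing }

    open Ring Δ hiding (zero)
    open Invertibility Δ
    open NatMultiples Δ
    open SemiringExp semiring using (_^_)
    open SemiringMult semiring using () renaming (_×_ to _·_)
    open SetoidReasoning setoid

    u-unit : IsUnit C.u
    u-unit = let δ , γδ≈1 = γ⁻¹ in Cyclic.u-invertible {δ} (B.trans (B.*-comm δ γ) γδ≈1)

    const-isHom′ : IsRingHomomorphism B.rawRing rawRing C.const
    const-isHom′ = RingHom.isRingHomomorphism B.ring Δ C.const
      (λ {a} {b} eq → via a b λ k → B.*-congʳ {1# k} eq)
      (λ a b k → B.trans (as-scalar (a B.+ b) k) (B.trans (B.distribʳ (1# k) a b)
        (B.sym (B.+-cong {C.const a k} (as-scalar a k) (as-scalar b k)))))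
      (λ a b k → B.trans (as-scalar (a B.* b) k) (B.trans (B.*-assoc a b (1# k))
        (B.sym (B.trans (Cyclic.const-* a (C.const b) k) (B.*-congˡ {a} (as-scalar b k))))))
      (λ _ → B.refl)
      where
      as-scalar : ∀ b k → C.const b k B.≈ b B.* 1# k
      as-scalar b k = B.trans (B.sym {(C.const b * 1#) k} (*-identityʳ (C.const b) k)) (Cyclic.const-* b 1# k)
      via : ∀ a b → (∀ k → a B.* 1# k B.≈ b B.* 1# k) → C.const a ≈ C.const b
      via a b eq k = B.trans (as-scalar a k) (B.trans (eq k) (B.sym {C.const b k} (as-scalar b k)))

    τ : S.Carrier → Carrier
    τ a = C.const (P.const a)

    τ-isHom : IsRingHomomorphism S.rawRing rawRing τ
    τ-isHom = RingHom.isRingHomomorphism S.ring Δ τ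
      (λ {a} {b} eq → c.f-cong (b′.f-cong eq))
      (λ a b → trans (c.f-cong (b′.+-homo a b)) (c.+-homo (P.const a) (P.const b)))
      (λ a b → trans (c.f-cong (b′.*-homo a b)) (c.*-homo (P.const a) (P.const b)))
      (trans (c.f-cong b′.1#-homo) c.1#-homo)
      where
      module c = RingHom.Properties B.ring Δ C.const const-isHom′
      module b′ = RingHom.Properties S.ring B.ring P.const const-isHom

    private
      module τ = RingHom.Properties S.ring Δ τ τ-isHom

    σ-const : ∀ a → σ₀ ∘ P.const a B.≈ P.const (σ₀ a)
    σ-const a zero    = S.refl
    σ-const a (suc n) = σ₀.0#-homo

    σ₀-Π : σ₀ Cyc.Π S.≈ Conj.gΠ
    σ₀-Π = S.trans (σ₀.minus-homo S.1# X) (S.+-cong σ₀.1#-homo (S.-‿cong σ₀-X))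

    Π gΠ : Carrier
    Π = τ Cyc.Π
    gΠ = τ Conj.gΠ

    normal : ∀ x → ∃[ y ] x * Π ≈ Π * y
    normal = Cyclic.normal {P.const Cyc.Π} {P.const (S.1# S.+ Conj.ε)}
      (B.trans (σ-const Cyc.Π) (B.trans (b′.f-cong (S.trans σ₀-Π Conj.gΠ≈Π[1+ε])) (b′.*-homo Cyc.Π (S.1# S.+ Conj.ε))))
      where module b′ = RingHom.Properties S.ring B.ring P.const const-isHom

    open Filtration Δ Π normal

    τ-Π^ : ∀ k x → Π ^ k * x ≈ τ (Cyc.Π ^S k) * x
    τ-Π^ k x = *-congʳ {x} (sym (τ.^-homo Cyc.Π k))

    u-Π : C.u * Π ≈ gΠ * C.u
    u-Π = trans (Cyclic.u-const (P.const Cyc.Π)) (*-congʳ {C.u} (c.f-cong (B.trans (σ-const Cyc.Π) (b′.f-cong σ₀-Π))))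
      where
      module c = RingHom.Properties B.ring Δ C.const const-isHom′
      module b′ = RingHom.Properties S.ring B.ring P.const const-isHom

    τ-∈ : ∀ k {a b} → a S.≈ b S.* Cyc.Π ^S k → (Π^ k Δ) (τ a)
    τ-∈ k {a} {b} eq = τ b , (begin
      τ a                        ≈⟨ τ.f-cong (S.trans eq (S.*-comm b _)) ⟩
      τ (Cyc.Π ^S k S.* b)        ≈⟨ τ.*-homo _ b ⟩
      τ (Cyc.Π ^S k) * τ b        ≈⟨ τ-Π^ k (τ b) ⟨
      Π ^ k * τ b                ∎)

    gx≡x : ∀ x → (Π^ Conj.q Δ) ((λ k n → σ₀ (x k n)) - x)
    gx≡x x = V , sym (begin
      Π ^ Conj.q * V                          ≈⟨ τ-Π^ Conj.q V ⟩
      τ (Cyc.Π ^S Conj.q) * V                  ≈⟨ Cyclic.const-* (P.const (Cyc.Π ^S Conj.q)) V ⟩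
      (λ k → P.const (Cyc.Π ^S Conj.q) B.* V k) ≈⟨ (λ k n → S.trans (const-⊛ (Cyc.Π ^S Conj.q) (V k) n)
                                                 (S.trans (S.*-comm _ _) (S.sym (proj₂ (σ₀≡id (x k n)))))) ⟩
      (λ k n → σ₀ (x k n)) - x              ∎)
      where
      V : Carrier
      V k n = proj₁ (σ₀≡id (x k n))

    τ-ϖ : τ Cyc.ϖ ≈ p · 1#
    τ-ϖ = τ.×1-homo p

    p∈ΠΔ : (Π^ 1 Δ) (p · 1#)
    p∈ΠΔ = IsIdeal.resp (isIdeal 1) τ-ϖ
      (Π^-weaken 1 {Conj.q} (τ-∈ (suc Conj.q) (proj₂ Conj.ϖ∈⟨Π^[1+q]⟩)))

    ϖ-unit⇒∈Π^ : ∀ {t} → Cyc.ϖ S.* t S.≈ S.1# → ∀ k x → (Π^ k Δ) x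
    ϖ-unit⇒∈Π^ {t} ϖt≈1 k x = τ (w ^S k) * x , (begin
      x                                  ≈⟨ *-identityˡ x ⟨
      1# * x                             ≈⟨ *-congʳ {x} 1≈ ⟩
      τ (Cyc.Π ^S k) * τ (w ^S k) * x     ≈⟨ *-assoc (τ (Cyc.Π ^S k)) (τ (w ^S k)) x ⟩
      τ (Cyc.Π ^S k) * (τ (w ^S k) * x)   ≈⟨ τ-Π^ k (τ (w ^S k) * x) ⟨
      Π ^ k * (τ (w ^S k) * x)           ∎)
      where
      open CommutativeSemiringExp S.commutativeSemiring using (^-distrib-*; ^-congˡ)
      w : S.Carrier
      w = proj₁ Conj.ϖ∈⟨Π^[1+q]⟩ S.* Cyc.Π ^S Conj.q S.* t
      Πw≈1 : Cyc.Π S.* w S.≈ S.1#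
      Πw≈1 = S.trans (S.sym (S.*-assoc _ _ _)) (S.trans (S.*-congʳ (S.sym
        (S.trans (proj₂ Conj.ϖ∈⟨Π^[1+q]⟩) (x∙yz≈y∙xz _ _ _)))) ϖt≈1)
        where open CommutativeSemigroupProps S.*-commutativeSemigroup using (x∙yz≈y∙xz)
      1≈ : 1# ≈ τ (Cyc.Π ^S k) * τ (w ^S k)
      1≈ = begin
        1#                             ≈⟨ τ.1#-homo ⟨
        τ S.1#                         ≈⟨ τ.f-cong (Cyc.1^q k) ⟨
        τ (S.1# ^S k)                  ≈⟨ τ.f-cong (^-congˡ k Πw≈1) ⟨
        τ ((Cyc.Π S.* w) ^S k)          ≈⟨ τ.f-cong (^-distrib-* Cyc.Π w k) ⟩
        τ (Cyc.Π ^S k S.* w ^S k)       ≈⟨ τ.*-homo _ _ ⟩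
        τ (Cyc.Π ^S k) * τ (w ^S k)     ∎

    module _ (1-ϖa-unit : ∀ a → ∃[ b ] (S.1# S.- Cyc.ϖ S.* a) S.* b S.≈ S.1#) where

      1-pv-unit : ∀ v → IsUnit (1# - p · 1# * v)
      1-pv-unit v = unit-resp {1# - τ Cyc.ϖ * v} {1# - p · 1# * v} (+-congˡ {1#} (-‿cong {τ Cyc.ϖ * v} (*-congʳ {v} τ-ϖ)))
        (Nakayama.1-ϖv-unit seriesRing Δ C.const const-isHom′ (P.const Cyc.ϖ) B-units
          (proj₁ Cyclic.span) (λ x → x , proj₂ Cyclic.span x)
          (λ x → trans (*-congʳ {x} τ-ϖ) (trans (·1-central p x) (*-congˡ {x} (sym τ-ϖ)))) v)
        where
        B-units : ∀ a → ∃[ b ] b B.* (B.1# B.- P.const Cyc.ϖ B.* a) B.≈ B.1#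
        B-units a = let b₀ , inv = 1-ϖa-unit (a 0)
                        f = B.1# B.- P.const Cyc.ϖ B.* a
                        b , eq = invertible {b₀} {f} (S.trans (S.*-congʳ {b₀} (S.+-congˡ {S.1#} (S.-‿cong (const-⊛ Cyc.ϖ a 0)))) inv)
                    in b , B.trans (B.*-comm b f) eq

      1-Πx-unit : ∀ x → IsUnit (1# - Π * x)
      1-Πx-unit x = 1-w^k-unit⇒1-w-unit (Π * x) K 
        (unit-resp {1# - p · 1# * (τ t * v)} {1# - (Π * x) ^ K} eq (1-pv-unit (τ t * v)))
        where
        K = p ℕ.^ suc e
        t = proj₁ Cyc.Π^p^[1+m]∈⟨ϖ⟩
        v = proj₁ ([Πx]^ x K)
        eq : 1# - p · 1# * (τ t * v) ≈ 1# - (Π * x) ^ K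
        eq = +-congˡ {1#} (-‿cong {p · 1# * (τ t * v)} (begin
          p · 1# * (τ t * v)      ≈⟨ *-assoc (p · 1#) (τ t) v ⟨
          p · 1# * τ t * v        ≈⟨ *-congʳ {v} (*-congʳ {τ t} τ-ϖ) ⟨
          τ Cyc.ϖ * τ t * v        ≈⟨ *-congʳ {v} (τ.*-homo Cyc.ϖ t) ⟨
          τ (Cyc.ϖ S.* t) * v      ≈⟨ *-congʳ {v} (τ.f-cong (proj₂ Cyc.Π^p^[1+m]∈⟨ϖ⟩)) ⟨
          τ (Cyc.Π ^S K) * v       ≈⟨ τ-Π^ K v ⟨
          Π ^ K * v               ≈⟨ proj₂ ([Πx]^ x K) ⟨
          (Π * x) ^ K             ∎))

      approximation : ∀ m′ {d} → let m = suc m′ ; n = Conj.q′ ℕ.+ m in Coprime m p →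
        (Π^ n Δ) (d - 1#) →
        ∃ λ x → Σ (IsUnit C.u) λ (u⁻¹ , _) → Σ (IsUnit (1# - Π ^ m * x)) λ (y⁻¹ , _) →
        (Π^ suc n Δ) (d - C.u * (1# - Π ^ m * x) * u⁻¹ * y⁻¹)
      approximation m′ {d} m⊥p (z , d-1≈Π^nz) =
        let x , d≋[u,y] = CommutatorApproximation.d≋[u,y] Δ {Π} normal {C.u} {gΠ} {λ x k n → σ₀ (x k n)}
              Cyclic.u-*-comm u-Π {p} {Conj.q′} {m′} m⊥p p∈ΠΔ gx≡x′ gΠ^m≡ {d} {z} d-1≈Π^nz
        in x , u-unit , y-unit x ,
           d≋[u,y] {proj₁ u-unit} {proj₁ (y-unit x)} (proj₂ (proj₂ u-unit)) (proj₂ (proj₂ (y-unit x)))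
        where
        m = suc m′
        n = Conj.q′ ℕ.+ m
        gx≡x′ : ∀ x → (Π^ suc Conj.q′ Δ) ((λ k n → σ₀ (x k n)) - x)
        gx≡x′ x = ≡.subst (λ k → (Π^ k Δ) ((λ k n → σ₀ (x k n)) - x)) p^r≡2+q″ (gx≡x x)
        gΠ^m≡ : (Π^ suc n Δ) (gΠ ^ m - (Π ^ m + Π ^ n * m · 1#))
        gΠ^m≡ = IsIdeal.resp (isIdeal (suc n)) eq (τ-∈ (suc n) (proj₂ (Conj.gΠ^n m)))
          where
          open SemiringMult S.semiring using () renaming (_×_ to _·S_)
          eq : τ (Conj.gΠ ^S m S.- (Cyc.Π ^S m S.+ Cyc.Π ^S n S.* m ·S S.1#)) ≈ gΠ ^ m - (Π ^ m + Π ^ n * m · 1#)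
          eq = begin
            τ (Conj.gΠ ^S m S.- (Cyc.Π ^S m S.+ Cyc.Π ^S n S.* m ·S S.1#))
              ≈⟨ τ.minus-homo _ _ ⟩
            τ (Conj.gΠ ^S m) - τ (Cyc.Π ^S m S.+ Cyc.Π ^S n S.* m ·S S.1#)
              ≈⟨ +-cong (τ.^-homo Conj.gΠ m) (-‿cong (trans (τ.+-homo _ _) (+-cong (τ.^-homo Cyc.Π m) (trans (τ.*-homo _ _) (*-cong (τ.^-homo Cyc.Π n) (τ.×1-homo m)))))) ⟩
            gΠ ^ m - (Π ^ m + Π ^ n * m · 1#)  ∎
        y-unit : ∀ x → IsUnit (1# - Π ^ m * x)
        y-unit x = unit-resp {1# - Π * (Π ^ m′ * x)} {1# - Π ^ m * x}
          (+-congˡ {1#} (-‿cong {Π * (Π ^ m′ * x)} (sym (*-assoc Π (Π ^ m′) x)))) (1-Πx-unit (Π ^ m′ * x))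

module UnitLifting (O : CommutativeRing c ℓ) (S : CommutativeRing c′ ℓ′)
  (κ : CommutativeRing.Carrier O → CommutativeRing.Carrier S)
  (κ-isHom : IsRingHomomorphism (CommutativeRing.rawRing O) (CommutativeRing.rawRing S) κ)
  (p : ℕ) where
  private
    module O = CommutativeRing O
    module S = CommutativeRing S
    module κ = RingHom.Properties O.ring S.ring κ κ-isHom
  open SemiringMult O.semiring using () renaming (_×_ to _·O_)
  open SemiringMult S.semiring using () renaming (_×_ to _·S_)
  open SemiringExp S.semiring using () renaming (_^_ to _^S_)
  open Evaluation O S κ κ-isHom

  κ-unit : ∀ {t} → p ·O O.1# O.* t O.≈ O.1# → p ·S S.1# S.* κ t S.≈ S.1#
  κ-unit {t} pt≈1 = S.trans (S.*-congʳ (S.sym (κ.×1-homo p)))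
    (S.trans (S.sym (κ.*-homo _ t)) (S.trans (κ.f-cong pt≈1) κ.1#-homo))

  1-pa-units : ∀ {X P} (lift : S.Carrier → Polynomial.Poly O.rawRing) → (∀ b → eval X (lift b) S.≈ b) →
    X ^S suc P S.≈ S.1# → (∀ a → ∃[ b ] b O.* (O.1# O.- p ·O O.1# O.* a) O.≈ O.1#) →
    ∀ a → ∃[ b ] (S.1# S.- p ·S S.1# S.* a) S.* b S.≈ S.1#
  1-pa-units {X} {P} lift eval-lift X^P≈1 O-units a =
    let b , _ , inv = Nakayama.1-ϖv-unit O S.ring κ κ-isHom (p ·O O.1#) O-units (λ i → X ^S toℕ i)
          (λ x → let b , eq = span-powers P X X^P≈1 (lift x) in b , S.trans (S.sym (eval-lift x)) eq)
          (λ x → S.*-comm _ x) a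
    in b , S.trans (S.*-congʳ (S.+-congˡ (S.-‿cong (S.*-congʳ (S.sym (κ.×1-homo p)))))) inv

module CyclotomicOrder {p : ℕ} (p-prime : Prime p) (p≢2 : p ≢ 2) (O : CommutativeRing c ℓ)
  (r′ s′ : ℕ) where
  private
    r = suc r′
    s = suc s′
    m = r′ ℕ.+ s
    instance
      p≢0 : NonZero p
      p≢0 = prime⇒nonZero p-prime
      p^s≢0 : NonZero (p ℕ.^ s)
      p^s≢0 = ℕ.m^n≢0 p s
    module O = CommutativeRing O
  module Ord = Order p-prime O r s
  open PolynomialRing O
  private
    module Pr = CommutativeRing polynomialCommutativeRing
    module PSum = RawSemiringDefs (Semiring.rawSemiring Pr.semiring)

  module Pid = PrincipalIdeal polynomialCommutativeRing (Ord.Φ (suc m))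
  S : CommutativeRing c (c ⊔ ℓ)
  S = Pid.quotientCommutativeRing
  module S = CommutativeRing S
  open Pid.Q using (≈⇒≋; module π)
  open SemiringExp S.semiring using () renaming (_^_ to _^S_; ^-congˡ to ^S-congˡ; ^-assocʳ to ^S-assocʳ)
  open SemiringSum S.semiring using () renaming (sum to sumS; sum-cong-≋ to sumS-cong)

  Φ≈0 : CyclotomicRelation S p X m
  Φ≈0 = begin
    sumS {p} (λ i → X ^S (toℕ i ℕ.* p ℕ.^ m))        ≈⟨ sumS-cong {p} (λ i → π.^-homo X (toℕ i ℕ.* p ℕ.^ m)) ⟨
    sumS {p} (λ i → X PSum.^ (toℕ i ℕ.* p ℕ.^ m))    ≈⟨ π.sum-homo {p} (λ i → X PSum.^ (toℕ i ℕ.* p ℕ.^ m)) ⟨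
    Ord.Φ (suc m)                                     ≈⟨ Pid.f≋0 ⟩
    S.0#                                             ∎
    where open SetoidReasoning S.setoid

  module Cyc = Cyclotomic S p-prime p≢2 X m Φ≈0

  q : ℕ
  q = p ℕ.^ r

  κ-isHom : IsRingHomomorphism O.rawRing S.rawRing const
  κ-isHom = Composition.isRingHomomorphism (λ {x} {y} {z} → S.trans {x} {y} {z}) const-isHom Pid.Q.π-isHom

  module E = Evaluation O S const κ-isHom
  open E using (eval)

  ⟪⟫≡eval : ∀ f h → f ⟪ h ⟫ ≡ eval h f
  ⟪⟫≡eval []      h = ≡.refl
  ⟪⟫≡eval (a ∷ f) h = ≡.cong (λ e → const a +ₚ h *ₚ e) (⟪⟫≡eval f h)

  ∷≈const+X* : ∀ a f → (a ∷ f) ≈ₚ (const a +ₚ X *ₚ f)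
  ∷≈const+X* a f i = O.sym (O.trans (coeff-+ (const a) (X *ₚ f) i)
    (O.trans (O.+-congˡ (O.trans (coeff-+ (map (O.0# O.*_) f) _ i)
      (O.trans (O.+-congʳ (O.trans (coeff-map (O.zeroˡ O.0#) f i) (O.zeroˡ _))) (O.+-identityˡ _)))) (shift i)))
    where
    shift : ∀ i → coeff (const a) i O.+ coeff (O.0# ∷ const O.1# *ₚ f) i O.≈ coeff (a ∷ f) i
    shift zero    = O.+-identityʳ a
    shift (suc i) = O.trans (O.+-identityˡ _) (Pr.*-identityˡ f i)

  eval-X≈id : ∀ f → eval X f S.≈ f
  eval-X≈id []      = S.refl {[]}
  eval-X≈id (a ∷ f) = begin
    const a S.+ X S.* eval X f    ≈⟨ S.+-congˡ {const a} {X S.* eval X f} {X S.* f}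
                                       (S.*-congˡ {X} {eval X f} {f} (eval-X≈id f)) ⟩
    const a S.+ X S.* f           ≈⟨ ≈⇒≋ {a ∷ f} {const a +ₚ X *ₚ f} (∷≈const+X* a f) ⟨
    a ∷ f                         ∎
    where open SetoidReasoning S.setoid

  h : S.Carrier
  h = X PSum.^ (1 ℕ.+ q)

  h≈X^[1+q] : h S.≈ X ^S (1 ℕ.+ q)
  h≈X^[1+q] = π.^-homo X (1 ℕ.+ q)

  eval-h-X : eval h X S.≈ X ^S (1 ℕ.+ q)
  eval-h-X = begin
    eval h X             ≈⟨ E.eval-X h ⟩
    h                    ≈⟨ h≈X^[1+q] ⟩
    X ^S (1 ℕ.+ q)       ∎
    where open SetoidReasoning S.setoid

  private module ev = RingHom.Properties Pr.ring S.ring (eval h) (E.eval-isHom h)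

  eval-Φ≈0 : eval h (Ord.Φ (suc m)) S.≈ S.0#
  eval-Φ≈0 = begin
    eval h (Ord.Φ (suc m))                                         ≈⟨ ev.sum-homo {p} (λ i → X PSum.^ (toℕ i ℕ.* p ℕ.^ m)) ⟩
    sumS {p} (λ i → eval h (X PSum.^ (toℕ i ℕ.* p ℕ.^ m)))        ≈⟨ sumS-cong {p} (λ i → term (toℕ i)) ⟩
    sumS {p} (λ i → X ^S (toℕ i ℕ.* p ℕ.^ m))                     ≈⟨ Φ≈0 ⟩
    S.0#                                                          ∎
    where
    open SetoidReasoning S.setoid
    exponent : ∀ i → (1 ℕ.+ q) ℕ.* (i ℕ.* p ℕ.^ m) ≡ i ℕ.* p ℕ.^ m ℕ.+ (i ℕ.* p ℕ.^ r′) ℕ.* p ℕ.^ suc m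
    exponent i = regroup p (p ℕ.^ r′) (p ℕ.^ m) i
      where
      regroup : ∀ p R M i → (1 ℕ.+ p ℕ.* R) ℕ.* (i ℕ.* M) ≡ i ℕ.* M ℕ.+ (i ℕ.* R) ℕ.* (p ℕ.* M)
      regroup = ℕSolver.solve-∀
    term : ∀ i → eval h (X PSum.^ (i ℕ.* p ℕ.^ m)) S.≈ X ^S (i ℕ.* p ℕ.^ m)
    term i = begin
      eval h (X PSum.^ (i ℕ.* p ℕ.^ m))              ≈⟨ ev.^-homo X (i ℕ.* p ℕ.^ m) ⟩
      eval h X ^S (i ℕ.* p ℕ.^ m)                    ≈⟨ ^S-congˡ (i ℕ.* p ℕ.^ m) eval-h-X ⟩
      (X ^S (1 ℕ.+ q)) ^S (i ℕ.* p ℕ.^ m)            ≈⟨ ^S-assocʳ X (1 ℕ.+ q) (i ℕ.* p ℕ.^ m) ⟩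
      X ^S ((1 ℕ.+ q) ℕ.* (i ℕ.* p ℕ.^ m))           ≡⟨ ≡.cong (X ^S_) (exponent i) ⟩
      X ^S (i ℕ.* p ℕ.^ m ℕ.+ (i ℕ.* p ℕ.^ r′) ℕ.* p ℕ.^ suc m)
                                                     ≈⟨ Cyc.X^-periodic (i ℕ.* p ℕ.^ m) (i ℕ.* p ℕ.^ r′) ⟩
      X ^S (i ℕ.* p ℕ.^ m)                           ∎

  eval-isHom : IsRingHomomorphism S.rawRing S.rawRing (eval h)
  eval-isHom = Pid.descend S.ring (E.eval-isHom h) eval-Φ≈0

  g₀≈eval : ∀ f → Ord.g₀ f S.≈ eval h f
  g₀≈eval f = S.reflexive (⟪⟫≡eval f h)

  g₀-isHom : IsRingHomomorphism S.rawRing S.rawRing Ord.g₀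
  g₀-isHom = isRingHomomorphism-resp S.ring S.ring g₀≈eval eval-isHom

  g₀-X : Ord.g₀ X S.≈ X ^S (1 ℕ.+ q)
  g₀-X = begin
    Ord.g₀ X              ≈⟨ g₀≈eval X ⟩
    eval h X             ≈⟨ eval-h-X ⟩
    X ^S (1 ℕ.+ q)       ∎
    where open SetoidReasoning S.setoid

  g₀-const : ∀ b → Ord.g₀ (const b) S.≈ const b
  g₀-const b = begin
    Ord.g₀ (const b)      ≈⟨ g₀≈eval (const b) ⟩
    eval h (const b)     ≈⟨ E.eval-const h b ⟩
    const b              ∎
    where open SetoidReasoning S.setoid

  r≤m : r ≤ m
  r≤m = ≡.subst (r ≤_) (≡.sym (ℕ.+-suc r′ s′)) (ℕ.m≤m+n r s′)

  q″ : ℕ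
  q″ = q ∸ 2

  q≡2+q″ : q ≡ suc (suc q″)
  q≡2+q″ = ≡.sym (ℕ.m+[n∸m]≡n 2≤q)
    where
    2≤p : 2 ≤ p
    2≤p = ℕ.nonTrivial⇒n>1 p {{prime⇒nonTrivial p-prime}}
    2≤q : 2 ≤ q
    2≤q = ℕ.≤-trans 2≤p (ℕ.≤-trans (ℕ.≤-reflexive (≡.sym (ℕ.*-identityʳ p))) (ℕ.*-monoʳ-≤ p (ℕ.m^n>0 p r′)))

  module Conj = Cyc.Conjugate r r≤m q″ q≡2+q″

  open E.PowerEndomorphism {X} id eval-X≈id {Ord.g₀} g₀-isHom g₀-const {1 ℕ.+ q} g₀-X

  fold-g₀≈id : ∀ f → fold f Ord.g₀ (p ℕ.^ s) S.≈ f
  fold-g₀≈id = fold≈id {p ℕ.^ s} (Cyc.X^[1+p^r]^p^s r′ s ≡.refl)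

  g₀f≡f : ∀ f → ∃[ v ] Ord.g₀ f S.- f S.≈ v S.* Cyc.Π ^S q
  g₀f≡f = ψ≡id {Cyc.Π ^S q} Conj.X^[1+q]≋X

  module L = CyclicOrder S p-prime p≢2 X m Φ≈0 r r≤m q″ q≡2+q″
  open UnitLifting O S const κ-isHom p
  open SemiringMult O.semiring using () renaming (_×_ to _·O_)

  level⇒p-nonunit : ∀ {d n} → Ord.HasLevel d n → ∀ {t} → ¬ (p ·O O.1# O.* t O.≈ O.1#)
  level⇒p-nonunit {d} {n} (_ , _ , max) {t} pt≈1 = ℕ.1+n≰n
    (max (suc n) (ℕ.s≤s ℕ.z≤n) (L.ϖ-unit⇒∈Π^ Ord.g₀ g₀-isHom g₀-X g₀f≡f (p ℕ.^ s) fold-g₀≈id {const t} (κ-unit {t} pt≈1) (suc n) (d Ord.- Ord.1#)))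

  module _
    (unramified : ∀ y → AlgDefs.Invertible O._≈_ O.1# O._*_ y ⊎ (∃[ z ] y O.≈ (p ·O O.1#) O.* z)) where

    O-units : (∀ {t} → ¬ (p ·O O.1# O.* t O.≈ O.1#)) → ∀ a → ∃[ b ] b O.* (O.1# O.- p ·O O.1# O.* a) O.≈ O.1#
    O-units p-nonunit a with unramified (O.1# O.- p ·O O.1# O.* a)
    ... | inj₁ (b , inv , _) = b , inv
    ... | inj₂ (z , eq)      = contradiction p[z+a]≈1 p-nonunit
      where
      open SetoidReasoning O.setoid
      open RingProps O.ring
      p[z+a]≈1 : p ·O O.1# O.* (z O.+ a) O.≈ O.1#
      p[z+a]≈1 = begin
        p ·O O.1# O.* (z O.+ a)                                ≈⟨ O.distribˡ _ z a ⟩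
        p ·O O.1# O.* z O.+ p ·O O.1# O.* a                    ≈⟨ O.+-congʳ eq ⟨
        O.1# O.- p ·O O.1# O.* a O.+ p ·O O.1# O.* a           ≈⟨ //-rightDividesˡ _ O.1# ⟩
        O.1#                                                   ∎

    X^[1+P]≈1 : X ^S suc (ℕ.pred (p ℕ.^ suc m)) S.≈ S.1#
    X^[1+P]≈1 = begin
      X ^S suc (ℕ.pred (p ℕ.^ suc m))    ≡⟨ ≡.cong (X ^S_) (ℕ.suc-pred (p ℕ.^ suc m) {{ℕ.m^n≢0 p (suc m)}}) ⟩
      X ^S (p ℕ.^ suc m)                 ≈⟨ Cyc.X^p^1+m≈1 ⟩
      S.1#                               ∎
      where open SetoidReasoning S.setoid

    commutator-approximation : ∀ d n m → Ord.HasLevel d n → n ≡ q ℕ.+ m ∸ 1 → Ord.HasType n 0 →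
      ∃ λ x → Σ (Ord.IsUnit Ord.u) λ u-unit →
      Σ (Ord.IsUnit (Ord.1# Ord.- (Ord.Π Ord.^Δ m) Ord.* x)) λ y-unit →
      d Ord.≡ Ord.commutator u-unit y-unit [modΠ^ suc n ]
    commutator-approximation d n m level n≡q+m-1 (k , 1≤k , p∤k , n≡) =
      approximate n m (≡.trans n≡q+m-1 (≡.cong (λ q → q ℕ.+ m ∸ 1) q≡2+q″)) level
        (≡.subst (1 ≤_) (≡.sym m≡k) 1≤k) (λ p∣m → p∤k (≡.subst (p ∣_) m≡k p∣m))
      where
      m≡k : m ≡ k
      m≡k = ℕ.+-cancelˡ-≡ (suc q″) m k (begin
        suc q″ ℕ.+ m                         ≡⟨ ≡.cong (λ q → q ℕ.+ m ∸ 1) q≡2+q″ ⟨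
        q ℕ.+ m ∸ 1                          ≡⟨ n≡q+m-1 ⟨
        n                                    ≡⟨ n≡ ⟩
        p ℕ.^ (r ℕ.+ 0) ℕ.+ 1 ℕ.* k ∸ 1      ≡⟨ ≡.cong₂ (λ i j → p ℕ.^ i ℕ.+ j ∸ 1) (ℕ.+-identityʳ r) (ℕ.*-identityˡ k) ⟩
        q ℕ.+ k ∸ 1                          ≡⟨ ≡.cong (λ q → q ℕ.+ k ∸ 1) q≡2+q″ ⟩
        suc q″ ℕ.+ k                         ∎)
        where open ≡.≡-Reasoning
      p∤m⇒coprime : ∀ {m} → ¬ (p ∣ m) → Coprime m p
      p∤m⇒coprime p∤m {e} (e∣m , e∣p) with prime⇒irreducible p-prime e∣p
      ... | inj₁ e≡1    = e≡1
      ... | inj₂ ≡.refl = contradiction e∣m p∤m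
      approximate : ∀ n m → n ≡ Conj.q′ ℕ.+ m → Ord.HasLevel d n → 1 ≤ m → ¬ (p ∣ m) →
        ∃ λ x → Σ (Ord.IsUnit Ord.u) λ u-unit →
        Σ (Ord.IsUnit (Ord.1# Ord.- (Ord.Π Ord.^Δ m) Ord.* x)) λ y-unit →
        d Ord.≡ Ord.commutator u-unit y-unit [modΠ^ suc n ]
      approximate _ (suc k) ≡.refl level@(_ , d≡1 , _) _ p∤m =
        L.approximation Ord.g₀ g₀-isHom g₀-X g₀f≡f (p ℕ.^ s) fold-g₀≈id
          (1-pa-units {X} {ℕ.pred (p ℕ.^ suc (r′ ℕ.+ s))} id eval-X≈id X^[1+P]≈1 (O-units λ {t} → level⇒p-nonunit {d} level {t}))
          k {d} (p∤m⇒coprime p∤m) d≡1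

open import Data.Nat.Base using (_^_)

mainTheorem8 : ∀ {a ℓ ℓ′ b ℓ₀ : Level} {p : ℕ} (p-prime : Prime p) → p ≢ 2 →
  (F : FiniteUnramifiedExtension p a ℓ ℓ′ b ℓ₀) →
  (r s : ℕ) → 1 ≤ r → 1 ≤ s →
  let open Order p-prime (FiniteUnramifiedExtension.𝔒 F) r s in
  (d : Carrier) (n m : ℕ) → IsUnit d → HasLevel d n →
  n ≡ p ^ r ℕ.+ m ∸ 1 → HasType n 0 →
  ∃ λ (x : Carrier) →
  Σ (IsUnit u) λ u-unit →
  Σ (IsUnit (1# - (Π ^Δ m) * x)) λ y-unit →
  d ≡ commutator u-unit y-unit [modΠ^ suc n ]
mainTheorem8 p-prime p≢2 F (suc r′) (suc s′) _ _ d n m _ =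
  CyclotomicOrder.commutator-approximation p-prime p≢2 (FiniteUnramifiedExtension.𝔒 F) r′ s′
    (FiniteUnramifiedExtension.unramified F) d n m
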